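{- There is a deterministic online algorithm for the online firefighting game on cactus graphs that is $(15\sqrt{n}+1)$-competitive, where $n$ is the number of vertices of the input graph. This is asymptotically optimal: no deterministic online algorithm is $o(\sqrt{n})$-competitive on cactus graphs.
   Context: Online firefighting game: an instance is $\mathcal{I} = (G, r, (f_i)_{i\ge 1})$, where $G$ is a finite undirected graph with $n$ vertices, $r \in V(G)$ is the fire source, and $f_i \ge 0$ are integers. The graph $G$ and $r$ are known to the algorithm in advance; $f_i$ is revealed only at the beginning of round $i$. Initially only $r$ is burning. In round $i$, after learning $f_i$, the algorithm assigns at most $f_i$ firefighters to vertices that are neither burning nor already protected (a protected vertex never burns); then the fire spreads from every burning vertex to all of its unprotected neighbours. A vertex is saved if it never burns. $\mathrm{ALG}(\mathcal{I})$ is the number of vertices saved by algorithm ALG, and $\mathrm{OPT}(\mathcal{I})$ the maximum number of vertices that can be saved by any strategy knowing the whole sequence $(f_i)$ in advance. A deterministic online algorithm makes its round-$i$ decisions as a deterministic function of $G, r, f_1,\dots,f_i$. An algorithm is $c$-competitive (where $c$ may depend on $n$) on a graph class if $\mathrm{OPT}(\mathcal{I})/\mathrm{ALG}(\mathcal{I}) \le c$ for every instance whose graph is in the class and has $n$ vertices. A cactus graph is a graph in which every edge lies on at most one simple cycle (equivalently, any two simple cycles share at most one vertex). -}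

module Defs where

open import Data.Nat using (ℕ; zero; suc; _+_; _*_; _∸_; _^_; _≤_)
open import Data.Bool using (Bool; true; false; _∧_; not)
open import Data.Fin using (Fin; zero; suc; toℕ; inject₁; fromℕ)
open import Data.Fin.Subset using (Subset; _∈_; _∉_; _∪_; ∣_∣; ⁅_⁆; ⊥)
open import Data.Vec using (Vec; tabulate; lookup)
open import Data.List using (allFin)
open import Data.Bool.ListAction using (any)
open import Data.Product using (Σ; ∃; ∃-syntax; _×_; _,_)
open import Data.Sum using (_⊎_)
open import Relation.Binary.PropositionalEquality using (_≡_)
open import Relation.Nullary using (¬_)

record Graph (n : ℕ) : Set where
  field
    E      : Fin n → Fin n → Bool
    sym    : ∀ u v → E u v ≡ E v u
    irrefl : ∀ v → E v v ≡ false

open Graph public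

Adj : ∀ {n} → Graph n → Fin n → Fin n → Set
Adj G u v = E G u v ≡ true

record Cycle {n : ℕ} (G : Graph n) : Set where
  field
    m       : ℕ
    long    : 2 ≤ m
    vert    : Fin (suc m) → Fin n
    inj     : ∀ i j → vert i ≡ vert j → i ≡ j
    step    : ∀ (i : Fin m) → Adj G (vert (inject₁ i)) (vert (suc i))
    close   : Adj G (vert (fromℕ m)) (vert zero)

open Cycle public

SamePair : ∀ {n} → Fin n → Fin n → Fin n → Fin n → Set
SamePair a b x y = (a ≡ x × b ≡ y) ⊎ (a ≡ y × b ≡ x)

EdgeOf : ∀ {n} {G : Graph n} → Cycle G → Fin n → Fin n → Set
EdgeOf C a b =
  (∃[ i ] SamePair a b (vert C (inject₁ i)) (vert C (suc i)))
  ⊎ SamePair a b (vert C (fromℕ (m C))) (vert C zero)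

-- Cactus: every edge lies on at most one simple cycle, i.e. any two simple
-- cycles through a common edge have the same edge set (are the same cycle).
Cactus : ∀ {n} → Graph n → Set
Cactus G = ∀ (C₁ C₂ : Cycle G) a b → EdgeOf C₁ a b → EdgeOf C₂ a b →
           ∀ x y → (EdgeOf C₁ x y → EdgeOf C₂ x y) × (EdgeOf C₂ x y → EdgeOf C₁ x y)

-- A strategy: the set of vertices protected in round t+1 (rounds 0-indexed).
Strategy : ℕ → Set
Strategy n = ℕ → Subset n

spread : ∀ {n} → Graph n → Subset n → Subset n → Subset n
spread {n} G B P =
  tabulate (λ v → not (lookup P v) ∧ any (λ u → lookup B u ∧ E G u v) (allFin n))

-- state (burning, protected) at the beginning of round t+1 (after t rounds)
state : ∀ {n} → Graph n → Fin n → Strategy n → ℕ → Subset n × Subset n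
state G r S zero = ⁅ r ⁆ , ⊥
state G r S (suc t) =
  let B  = Data.Product.proj₁ (state G r S t)
      P′ = Data.Product.proj₂ (state G r S t) ∪ S t
  in (B ∪ spread G B P′) , P′

burning : ∀ {n} → Graph n → Fin n → Strategy n → ℕ → Subset n
burning G r S t = Data.Product.proj₁ (state G r S t)

protected : ∀ {n} → Graph n → Fin n → Strategy n → ℕ → Subset n
protected G r S t = Data.Product.proj₂ (state G r S t)

-- Budgets: f t = f_{t+1} (number of firefighters of round t+1).
-- Validity: in round t+1 at most f t firefighters, placed on vertices that are
-- neither burning nor protected at that time.
Valid : ∀ {n} → Graph n → Fin n → (ℕ → ℕ) → Strategy n → Set
Valid G r f S = ∀ t → (∣ S t ∣ ≤ f t) ×
  (∀ v → v ∈ S t → (v ∉ burning G r S t) × (v ∉ protected G r S t))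

SavedSet : ∀ {n} → Graph n → Fin n → Strategy n → Subset n → Set
SavedSet G r S X = ∀ v → v ∈ X → ∀ t → v ∉ burning G r S t

-- Round t+1 decision depends only on G, r and f_1, …, f_{t+1}.
OnlineAlg : Set
OnlineAlg = (n : ℕ) → Graph n → Fin n → (t : ℕ) → Vec ℕ (suc t) → Subset n

run : OnlineAlg → ∀ {n} → Graph n → Fin n → (ℕ → ℕ) → Strategy n
run A {n} G r f t = A n G r t (tabulate (λ i → f (toℕ i)))

ValidOnCacti : OnlineAlg → Set
ValidOnCacti A = ∀ n (G : Graph n) (r : Fin n) (f : ℕ → ℕ) → Cactus G →
  Valid G r f (run A G r f)

-- OPT ≤ (15√n + 1)·ALG, i.e. for every legal offline strategy S and every set X
-- saved by S there is a set Y saved by A with |X| - |Y| ≤ 15√n·|Y|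
-- (squared to avoid √).
Competitive15 : OnlineAlg → Set
Competitive15 A = ∀ n (G : Graph n) (r : Fin n) (f : ℕ → ℕ) → Cactus G →
  ∀ (S : Strategy n) → Valid G r f S → ∀ X → SavedSet G r S X →
  ∃[ Y ] SavedSet G r (run A G r f) Y ×
         ((∣ X ∣ ∸ ∣ Y ∣) ^ 2 ≤ 225 * n * ∣ Y ∣ ^ 2)

-- A is o(√n)-competitive on cacti: for every ε = 1/q > 0 there is N such that
-- for all cactus instances with n ≥ N vertices, OPT ≤ ε√n·ALG,
-- i.e. (q·OPT)² ≤ n·ALG².
LittleOSqrtCompetitive : OnlineAlg → Set
LittleOSqrtCompetitive A = ∀ q → 1 ≤ q → ∃[ N ] ∀ n → N ≤ n →
  ∀ (G : Graph n) (r : Fin n) (f : ℕ → ℕ) → Cactus G →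
  ∀ (S : Strategy n) → Valid G r f S → ∀ X → SavedSet G r S X →
  ∃[ Y ] SavedSet G r (run A G r f) Y ×
         ((q * ∣ X ∣) ^ 2 ≤ n * ∣ Y ∣ ^ 2)

{-# OPTIONS --safe #-}
module Submission where

-- Upper bound. A protected vertex never burns, so it may as well have been
-- protected from the start: what burns by round t is the ball of radius t around
-- the source in the graph without the protected vertices. Let B be the ball burnt
-- at the moment a firefighter arrives. In a cactus a component of the rest is
-- attached to B by at most two edges, and it is a spine x₀, …, x_L between the two
-- attachment vertices with pieces hanging off the spine; the weight of xᵢ is the
-- number of vertices it separates from the source. If some weight exceeds √n/15,
-- protecting that vertex suffices. Otherwise the algorithm protects a vertex z
-- maximising (latest possible arrival of the fire) + 2 · weight over all spines,
-- and uses the next firefighter to cut the spine of z in front of the fire. If v is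
-- the maximum minus the elapsed time, then this pair saves at least (v − 1)/2
-- vertices, whereas a single vertex protected in place of z keeps only vertices
-- hanging off O(v) spine vertices unburnt. So each pair of firefighters pays,
-- up to a factor O(√n), for the components touched by the corresponding pair of
-- offline firefighters, and charging components only once gives the bound.
--
-- Lower bound. On a cycle with about n vertices and a pendant path with about √n
-- vertices, both at the source, one firefighter saves the path and two save nearly
-- the whole cycle, but the first one has to be placed before the number is known.

open import Defs
open import Data.Nat renaming (_≟_ to _≟ℕ_)
open import Data.Nat.Properties hiding (_≟_)
open import Relation.Binary.Definitions using (tri<; tri≈; tri>)
open import Data.Nat.Tactic.RingSolver using (solve-∀)
open import Data.Bool using (Bool; true; false; _∧_; not; T)
import Data.Bool.Properties as Bool
open import Data.Bool.ListAction using (any)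
open import Data.Fin using (Fin; zero; suc; toℕ; fromℕ; fromℕ<; inject₁; _≟_)
open import Data.Fin.Relation.Unary.Top using (view; ‵fromℕ; ‵inject₁)
open import Data.Fin.Properties using (any?; all?; toℕ<n; toℕ-fromℕ<; toℕ-injective; toℕ-inject₁; toℕ-fromℕ)
open import Data.Fin.Subset using (Subset; inside; outside; _∈_; _∉_; _⊆_; _∪_; _∩_; ∣_∣; ⁅_⁆; ⊥; ⊤)
open import Data.Fin.Subset.Properties
open import Data.Vec using (Vec; []; _∷_; here; there; tabulate; lookup)
open import Data.Vec.Properties using ([]=⇒lookup; lookup⇒[]=; lookup∘tabulate)
open import Data.List using (List; []; _∷_; _++_; length; allFin; map; upTo; applyUpTo; foldr)
open import Data.List.Properties using (length-map; length-++; length-upTo; length-applyUpTo)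
open import Data.List.Relation.Unary.All as All using (All; []; _∷_)
import Data.List.Relation.Unary.All.Properties as All
open import Data.List.Relation.Unary.Any using (Any; here; there; satisfied) renaming (any? to anyˡ?)
open import Data.List.Relation.Unary.Any.Properties using (any⁺; any⁻)
open import Data.List.Relation.Unary.AllPairs using ([]; _∷_)
open import Data.List.Relation.Unary.Unique.Propositional using (Unique)
open import Data.List.Membership.Propositional using (lose) renaming (_∈_ to _∈ˡ_; _∉_ to _∉ˡ_)
open import Data.List.Relation.Unary.Unique.Propositional.Properties using (++⁺; applyUpTo⁺₁)
open import Data.List.Membership.Propositional.Properties using (∈-allFin; ∈-map⁺; ∈-lookup; ∈-++⁺ˡ; ∈-++⁺ʳ; ∈-++⁻; ∈-upTo⁺)
import Data.List.Membership.DecPropositional as DecMem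
open import Data.Maybe using (Maybe; just; nothing)
open import Data.Product using (Σ; ∃; ∃-syntax; _×_; _,_; proj₁; proj₂)
open import Data.Sum using (_⊎_; inj₁; inj₂; [_,_]′)
open import Level using (Lift; lift)
open import Data.Empty using (⊥-elim) renaming (⊥ to Empty)
open import Data.Unit using (tt) renaming (⊤ to Unit)
open import Function using (_∘_; id; case_of_)
open import Function.Bundles using (Equivalence; mk⇔)
open import Relation.Nullary using (¬_; Dec; yes; no; does; ¬?; _×-dec_; _⊎-dec_; _→-dec_; contradiction)
open import Relation.Nullary.Decidable using (map′; dec-true; dec-false; does-⇔)
open import Relation.Binary.PropositionalEquality using (_≡_; _≢_; refl; trans; cong; cong₂; subst; subst₂)
  renaming (sym to ≡sym)

-- The obstacle is that z is placed before the round T of its partner is known. `Good` therefore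
-- asks of z an answer q for every T, each answer paying for every component that is still live.
-- This property is decidable, and the algorithm simply searches for a vertex that has it; spines
-- and potentials occur only in the proof, by `phase`, that in a cactus the search succeeds as long
-- as a live vertex is left. When a phase closes, the component of z becomes `dead`, so the gains of
-- different phases lie in disjoint sets and add up. Constants: a phase with gain g pays 13·s·g for
-- one component and has three to pay for (its own and those of two offline firefighters), hence
-- 39·s·g. With s about √n/15 this costs only 39/15·√n; the ratio 15√n comes from the other branch,
-- a gain above √n/15 compared with all n vertices.

private variable
  n : ℕ

-- Counting

subset : {P : Fin n → Set} → (∀ x → Dec (P x)) → Subset n
subset P? = tabulate (λ x → does (P? x))

∈-subset⁺ : {P : Fin n → Set} (P? : ∀ x → Dec (P x)) {x : Fin n} → P x → x ∈ subset P?
∈-subset⁺ P? {x} px = lookup⇒[]= x _ (trans (lookup∘tabulate _ x) (dec-true (P? x) px))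

∈-subset⁻ : {P : Fin n → Set} (P? : ∀ x → Dec (P x)) {x : Fin n} → x ∈ subset P? → P x
∈-subset⁻ P? {x} x∈ with P? x | trans (≡sym (lookup∘tabulate (λ y → does (P? y)) x)) ([]=⇒lookup x∈)
... | yes px | _ = px

∣p∪q∣≤∣p∣+∣q∣ : ∀ (p q : Subset n) → ∣ p ∪ q ∣ ≤ ∣ p ∣ + ∣ q ∣
∣p∪q∣≤∣p∣+∣q∣ [] [] = z≤n
∣p∪q∣≤∣p∣+∣q∣ (inside ∷ p) (inside ∷ q) =
  s≤s (≤-trans (∣p∪q∣≤∣p∣+∣q∣ p q) (+-monoʳ-≤ ∣ p ∣ (n≤1+n _)))
∣p∪q∣≤∣p∣+∣q∣ (inside ∷ p) (outside ∷ q) = s≤s (∣p∪q∣≤∣p∣+∣q∣ p q)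
∣p∪q∣≤∣p∣+∣q∣ (outside ∷ p) (inside ∷ q) =
  ≤-trans (s≤s (∣p∪q∣≤∣p∣+∣q∣ p q)) (≤-reflexive (≡sym (+-suc ∣ p ∣ ∣ q ∣)))
∣p∪q∣≤∣p∣+∣q∣ (outside ∷ p) (outside ∷ q) = ∣p∪q∣≤∣p∣+∣q∣ p q

cover : ∀ {p : Subset n} q s → (∀ {x} → x ∈ p → x ∈ q ⊎ x ∈ s) → ∣ p ∣ ≤ ∣ q ∣ + ∣ s ∣
cover q s f = ≤-trans (p⊆q⇒∣p∣≤∣q∣ (λ x∈ → x∈p∪q⁺ (f x∈))) (∣p∪q∣≤∣p∣+∣q∣ q s)

disjoint-∣∪∣ : ∀ (p q : Subset n) → (∀ {x} → x ∈ p → x ∉ q) → ∣ p ∣ + ∣ q ∣ ≤ ∣ p ∪ q ∣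
disjoint-∣∪∣ [] [] d = z≤n
disjoint-∣∪∣ (inside ∷ p) (inside ∷ q) d = contradiction here (d here)
disjoint-∣∪∣ (inside ∷ p) (outside ∷ q) d = s≤s (disjoint-∣∪∣ p q (λ x∈ y∈ → d (there x∈) (there y∈)))
disjoint-∣∪∣ (outside ∷ p) (inside ∷ q) d =
  ≤-trans (≤-reflexive (+-suc ∣ p ∣ ∣ q ∣)) (s≤s (disjoint-∣∪∣ p q (λ x∈ y∈ → d (there x∈) (there y∈))))
disjoint-∣∪∣ (outside ∷ p) (outside ∷ q) d = disjoint-∣∪∣ p q (λ x∈ y∈ → d (there x∈) (there y∈))

union-bound : ∀ {A : Set} (F : A → Subset n) {s} is → (∀ i → ∣ F i ∣ ≤ s) →
  ∀ p → (∀ {x} → x ∈ p → Any (λ i → x ∈ F i) is) → ∣ p ∣ ≤ length is * s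
union-bound {n} F [] b p c = ≤-trans (p⊆q⇒∣p∣≤∣q∣ {q = ⊥} (λ x∈ → case c x∈ of λ ()))
  (≤-reflexive (∣⊥∣≡0 n))
union-bound F {s} (i ∷ is) b p c =
  ≤-trans (cover (F i) (subset (λ x → in? x)) split)
    (+-mono-≤ (b i) (union-bound F is b _ (λ x∈ → ∈-subset⁻ in? x∈)))
  where
  in? : ∀ x → Dec (Any (λ j → x ∈ F j) is)
  in? x = anyˡ? (λ j → x ∈? F j) is
  split : ∀ {x} → x ∈ p → x ∈ F i ⊎ x ∈ subset in?
  split x∈ with c x∈
  ... | here h = inj₁ h
  ... | there h = inj₂ (∈-subset⁺ in? h)

length+∣p∣≤∣q∣ : ∀ (xs : List (Fin n)) {p q : Subset n} → Unique xs → p ⊆ q →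
  All (λ x → x ∈ q) xs → All (λ x → x ∉ p) xs → length xs + ∣ p ∣ ≤ ∣ q ∣
length+∣p∣≤∣q∣ [] _ p⊆q _ _ = p⊆q⇒∣p∣≤∣q∣ p⊆q
length+∣p∣≤∣q∣ (x ∷ xs) (x# ∷ u) p⊆q (x∈ ∷ xs∈) (x∉ ∷ xs∉) =
  ≤-trans (s≤s (length+∣p∣≤∣q∣ xs u
      (λ {y} y∈ → x∈p∧x≢y⇒x∈p-y (p⊆q y∈) λ { refl → x∉ y∈ })
      (All.zipWith (λ { (y∈ , x≢y) → x∈p∧x≢y⇒x∈p-y y∈ (x≢y ∘ ≡sym) }) (xs∈ , x#)) xs∉))
    (x∈p⇒∣p-x∣<∣p∣ x∈)

length≤∣q∣ : ∀ (xs : List (Fin n)) {q : Subset n} → Unique xs → All (λ x → x ∈ q) xs → length xs ≤ ∣ q ∣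
length≤∣q∣ {n} xs {q} u xs∈ = ≤-trans (m≤m+n _ _) (length+∣p∣≤∣q∣ xs {⊥} u
  (λ x∈ → contradiction x∈ ∉⊥) xs∈ (All.map (λ _ → ∉⊥) xs∈))

-- The value `f x px` may depend on the proof, as the peak of a vertex is computed from a proof that
-- it is live. Hence the comparison is with some proof `py`, not with every one.
argmax : ∀ {P : Fin n → Set} → (∀ x → Dec (P x)) → (f : ∀ x → P x → ℕ) → ∃ P →
  Σ (Fin n) λ x → Σ (P x) λ px → ∀ y → P y → ∃[ py ] f y py ≤ f x px
argmax {suc n} {P} P? f (w , pw) with P? zero | any? {P = λ x → P (suc x)} (λ x → P? (suc x))
... | no ¬p0 | no ¬ps = ⊥-elim (none w pw)
  where
  none : ∀ x → ¬ P x
  none zero p = ¬p0 p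
  none (suc x) p = ¬ps (x , p)
... | yes p0 | no ¬ps = zero , p0 , λ
  { zero _ → p0 , ≤-refl ; (suc y) py → contradiction (y , py) ¬ps }
... | d | yes ps with argmax {P = λ x → P (suc x)} (λ x → P? (suc x)) (λ x → f (suc x)) ps
... | x , px , best with d
...   | no ¬p0 = suc x , px , λ { zero p0 → contradiction p0 ¬p0 ; (suc y) py → best y py }
...   | yes p0 with ≤-total (f zero p0) (f (suc x) px)
...     | inj₁ le = suc x , px , λ { zero _ → p0 , le ; (suc y) py → best y py }
...     | inj₂ ge = zero , p0 , λ { zero _ → p0 , ≤-refl
    ; (suc y) py → proj₁ (best y py) , ≤-trans (proj₂ (best y py)) ge }

-- Walks

module Walks {n : ℕ} (G : Graph n) where

  V : Set
  V = Fin n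

  Adj-sym : ∀ {u v} → Adj G u v → Adj G v u
  Adj-sym {u} {v} a = trans (≡sym (Graph.sym G u v)) a

  Adj? : ∀ u v → Dec (Adj G u v)
  Adj? u v = E G u v Bool.≟ true

  -- The index k is only an upper bound on the length.
  data Walk (P : V → Set) (x : V) : V → ℕ → Set where
    stop : ∀ {k} → P x → Walk P x x k
    _▹_,_ : ∀ {y z k} → Walk P x y k → Adj G y z → P z → Walk P x z (suc k)

  private variable
    P Q : V → Set
    x y z : V
    j k : ℕ

  weaken : j ≤ k → Walk P x y j → Walk P x y k
  weaken j≤k (stop p) = stop p
  weaken (s≤s j≤k) (w ▹ a , p) = weaken j≤k w ▹ a , p

  mapW : (∀ {v} → P v → Q v) → Walk P x y k → Walk Q x y k
  mapW f (stop p) = stop (f p)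
  mapW f (w ▹ a , p) = mapW f w ▹ a , f p

  end : Walk P x y k → P y
  end (stop p) = p
  end (w ▹ a , p) = p

  start : Walk P x y k → P x
  start (stop p) = p
  start (w ▹ a , p) = start w

  _⊕_ : Walk P x y j → Walk P y z k → Walk P x z (k + j)
  _⊕_ {j = j} {k = k} w (stop p) = weaken (m≤n+m j k) w
  w ⊕ (w′ ▹ a , p) = (w ⊕ w′) ▹ a , p

  prepend : P x → Adj G x y → Walk P y z k → Walk P x z (suc k)
  prepend p a (stop q) = stop p ▹ a , q
  prepend p a (w ▹ b , q) = prepend p a w ▹ b , q

  reverse : Walk P x y k → Walk P y x k
  reverse (stop p) = stop p
  reverse (w ▹ a , p) = prepend p (Adj-sym a) (reverse w)

  -- Turns a walk of length at most t from the source into a walk inside the ball of radius t, hence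
  -- into one that avoids everything outside that ball.
  visited : Walk P x y k → Walk (λ v → Walk P x v k) x y k
  visited (stop p) = stop (stop p)
  visited (w ▹ a , p) = mapW (weaken (n≤1+n _)) (visited w) ▹ a , (w ▹ a , p)

  abstract
    walk? : (∀ v → Dec (P v)) → ∀ x y k → Dec (Walk P x y k)
    walk? P? x y k with x ≟ y | P? y
    ... | _ | no ¬py = no (¬py ∘ end)
    ... | yes refl | yes py = yes (stop py)
    walk? P? x y zero | no x≢y | yes py = no λ { (stop _) → x≢y refl }
    walk? P? x y (suc k) | no x≢y | yes py =
      map′ (λ { (u , w , a) → w ▹ a , py }) (λ { (stop _) → contradiction refl x≢y ; (w ▹ a , _) → _ , w , a })
        (any? (λ u → walk? P? x u k ×-dec Adj? u y))

  data Chain : List V → V → V → Set where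
    one  : Chain (x ∷ []) x x
    cons : ∀ {ys} → Adj G x y → Chain ys y z → Chain (x ∷ ys) x z

  SimplePath : (V → Set) → V → V → Set
  SimplePath P x y = ∃[ xs ] Chain xs x y × Unique xs × All P xs

  open DecMem (_≟_ {n}) using () renaming (_∈?_ to _∈ˡ?_)

  suffix : ∀ {xs} → Chain xs x z → Unique xs → All P xs → y ∈ˡ xs → SimplePath P y z
  suffix c u ps (here refl) with c
  ... | one = _ , one , u , ps
  ... | cons a c′ = _ , cons a c′ , u , ps
  suffix one u ps (there ())
  suffix (cons a c) (_ ∷ u) (_ ∷ ps) (there y∈) = suffix c u ps y∈

  ∉⇒All≢ : ∀ (xs : List V) → x ∉ˡ xs → All (x ≢_) xs
  ∉⇒All≢ xs x∉ = All.tabulate λ { y∈ refl → x∉ y∈ }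

  simplify′ : Walk P x y k → SimplePath P y x
  simplify′ (stop p) = _ , one , [] ∷ [] , p ∷ []
  simplify′ {y = y} (w ▹ a , p) with simplify′ w
  ... | xs , c , u , ps with y ∈ˡ? xs
  ... | yes y∈ = suffix c u ps y∈
  ... | no y∉ = y ∷ xs , cons (Adj-sym a) c , ∉⇒All≢ xs y∉ ∷ u , p ∷ ps

  simplify : Walk P x y k → SimplePath P x y
  simplify w = simplify′ (reverse w)

  fromChain : ∀ {xs} → Chain xs x y → All P xs → Walk P x y (length xs)
  fromChain one (p ∷ []) = stop p
  fromChain (cons a c) (p ∷ ps) = prepend p a (fromChain c ps)

  -- A simple path inside `q` has at most `∣ q ∣` vertices. This converts the size of a set into the
  -- time that the fire needs to cross it.
  shorten : ∀ q → (∀ {v} → P v → v ∈ q) → Walk P x y k → Walk P x y ∣ q ∣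
  shorten q f w with simplify w
  ... | xs , c , u , ps = weaken (length≤∣q∣ xs u (All.map f ps)) (fromChain c ps)

  shortenₙ : Walk P x y k → Walk P x y n
  shortenₙ w = subst (Walk _ _ _) (∣⊤∣≡n n) (shorten ⊤ (λ _ → ∈⊤) w)

-- The fire

module Fire {n : ℕ} (G : Graph n) (r : Fin n) (S : Strategy n) where
  open Walks G

  private
    B P : ℕ → Subset n
    B = burning G r S
    P = protected G r S

  spread⁻ : ∀ {X Y} {v : V} → v ∈ spread G X Y → v ∉ Y × ∃[ u ] u ∈ X × Adj G u v
  spread⁻ {X} {Y} {v} v∈ = go (trans (≡sym (lookup∘tabulate _ v)) ([]=⇒lookup v∈))
    where
    go : not (lookup Y v) ∧ any (λ u → lookup X u ∧ E G u v) (allFin n) ≡ true →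
         v ∉ Y × ∃[ u ] u ∈ X × Adj G u v
    go eq with lookup Y v in eqY
    go () | true
    go eq | false with satisfied (any⁻ (λ u → lookup X u ∧ E G u v) (allFin n) (Equivalence.from Bool.T-≡ eq))
    ... | u , t with lookup X u in eqX | E G u v in eqE
    ... | true | true = (λ v∈Y → case trans (≡sym ([]=⇒lookup v∈Y)) eqY of λ ())
                      , u , lookup⇒[]= u X eqX , eqE

  spread⁺ : ∀ {X Y} {u v : V} → v ∉ Y → u ∈ X → Adj G u v → v ∈ spread G X Y
  spread⁺ {X} {Y} {u} {v} v∉ u∈ a = lookup⇒[]= v _ (trans (lookup∘tabulate _ v) eq)
    where
    eq : not (lookup Y v) ∧ any (λ u → lookup X u ∧ E G u v) (allFin n) ≡ true
    eq with lookup Y v in eqY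
    ... | true = contradiction (lookup⇒[]= v Y eqY) v∉
    ... | false = Equivalence.to Bool.T-≡ (any⁺ (λ u → lookup X u ∧ E G u v)
          (lose {P = λ i → T (lookup X i ∧ E G i v)} (∈-allFin u)
            (subst T (≡sym (cong₂ _∧_ ([]=⇒lookup u∈) a)) tt)))
  burning-step : ∀ t {v} → v ∈ B (suc t) → v ∈ B t ⊎ (v ∉ P (suc t) × ∃[ u ] u ∈ B t × Adj G u v)
  burning-step t v∈ with x∈p∪q⁻ (B t) _ v∈
  ... | inj₁ h = inj₁ h
  ... | inj₂ h = inj₂ (spread⁻ h)

  burning-suc : ∀ t {v} → v ∈ B t → v ∈ B (suc t)
  burning-suc t v∈ = x∈p∪q⁺ (inj₁ v∈)

  protected-mono : ∀ {s t v} → s ≤ t → v ∈ P s → v ∈ P t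
  protected-mono {t = zero} z≤n v∈ = v∈
  protected-mono {s} {suc t} s≤ v∈ with m≤n⇒m<n∨m≡n s≤
  ... | inj₁ (s≤s s≤t) = x∈p∪q⁺ (inj₁ (protected-mono s≤t v∈))
  ... | inj₂ refl = v∈

  placed⇒protected : ∀ t {v} → v ∈ S t → v ∈ P (suc t)
  placed⇒protected t v∈ = x∈p∪q⁺ (inj₂ v∈)

  protected⇒placed : ∀ t {v} → v ∈ P t → ∃[ s ] s < t × v ∈ S s
  protected⇒placed zero v∈ = contradiction v∈ ∉⊥
  protected⇒placed (suc t) v∈ with x∈p∪q⁻ (P t) _ v∈
  ... | inj₁ h = let s , s< , e = protected⇒placed t h in s , m≤n⇒m≤1+n s< , e
  ... | inj₂ h = t , ≤-refl , h

  r-burns : ∀ t → r ∈ B t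
  r-burns zero = x∈⁅x⁆ r
  r-burns (suc t) = burning-suc t (r-burns t)

  burning⇒walk : ∀ {A : V → Set} → (∀ t {v} → v ∈ B t → A v) → ∀ t {v} → v ∈ B t → Walk A r v t
  burning⇒walk f zero v∈ with x∈⁅y⁆⇒x≡y r v∈
  ... | refl = stop (f 0 v∈)
  burning⇒walk f (suc t) v∈ with burning-step t v∈
  ... | inj₁ h = weaken (n≤1+n t) (burning⇒walk f t h)
  ... | inj₂ (_ , u , u∈ , a) = burning⇒walk f t u∈ ▹ a , f (suc t) v∈

  -- Protection only grows: a vertex unprotected at time t was unprotected whenever the fire passed
  -- earlier.
  walk⇒burning : ∀ {t k v} → k ≤ t → Walk (_∉ P t) r v k → v ∈ B k
  walk⇒burning {k = k} k≤t (stop p) = r-burns k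
  walk⇒burning {k = suc k} k≤t (w ▹ a , p) = x∈p∪q⁺ (inj₂ (spread⁺ (p ∘ protected-mono k≤t)
    (walk⇒burning (<⇒≤ k≤t) w) a))

  burning-mono : ∀ {s t v} → s ≤ t → v ∈ B s → v ∈ B t
  burning-mono {t = zero} z≤n v∈ = v∈
  burning-mono {s} {suc t} s≤ v∈ with m≤n⇒m<n∨m≡n s≤
  ... | inj₁ (s≤s s≤t) = burning-suc t (burning-mono s≤t v∈)
  ... | inj₂ refl = v∈

  never-burns : ∀ {s v} → v ∈ P (suc s) → v ∉ B s → ∀ t → v ∉ B t
  never-burns {s} {v} v∈ v∉ t v∈t with ≤-total t s
  ... | inj₁ t≤s = v∉ (burning-mono t≤s v∈t)
  ... | inj₂ s≤t = later t s≤t v∈t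
    where
    later : ∀ t → s ≤ t → v ∉ B t
    later t s≤t h with m≤n⇒m<n∨m≡n s≤t
    ... | inj₂ refl = v∉ h
    later (suc t) _ h | inj₁ (s≤s s≤t) with burning-step t h
    ... | inj₁ h′ = later t s≤t h′
    ... | inj₂ (v∉P , _) = v∉P (protected-mono (s≤s s≤t) v∈)

-- Cactus graphs

module CactusEdges {n : ℕ} (G : Graph n) where
  open Walks G
  private
    lookupˡ = Data.List.lookup
    variable
      P Q : V → Set
      a b x y u v : V
      xs ys : List V

  data Consec : List V → V → V → Set where
    hd : Consec (x ∷ y ∷ xs) x y
    tl : Consec xs a b → Consec (x ∷ xs) a b

  consec-lookup : ∀ x xs (i : Fin (length xs)) →
    Consec (x ∷ xs) (lookupˡ (x ∷ xs) (inject₁ i)) (lookupˡ (x ∷ xs) (suc i))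
  consec-lookup x (y ∷ ys) zero = hd
  consec-lookup x (y ∷ ys) (suc i) = tl (consec-lookup y ys i)

  consec-index : ∀ {x xs} → Consec (x ∷ xs) a b →
    ∃[ i ] a ≡ lookupˡ (x ∷ xs) (inject₁ i) × b ≡ lookupˡ (x ∷ xs) (suc i)
  consec-index hd = zero , refl , refl
  consec-index {xs = _ ∷ _} (tl c) = let i , p , q = consec-index c in suc i , p , q

  consec⇒Adj : Chain xs x y → Consec xs a b → Adj G a b
  consec⇒Adj (cons e one) (tl (tl ()))
  consec⇒Adj (cons e one) hd = e
  consec⇒Adj (cons e (cons _ _)) hd = e
  consec⇒Adj (cons e c) (tl q) = consec⇒Adj c q

  chain-last : ∀ {z zs} → Chain (z ∷ zs) x y → lookupˡ (z ∷ zs) (fromℕ (length zs)) ≡ y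
  chain-last one = refl
  chain-last (cons a one) = refl
  chain-last (cons a (cons b c)) = chain-last (cons b c)

  chain-++ : Chain xs x y → Adj G y u → Chain ys u v → Chain (xs ++ ys) x v
  chain-++ one e d = cons e d
  chain-++ (cons a c) e d = cons a (chain-++ c e d)

  consec-joint : Chain xs x y → Chain ys u v → Consec (xs ++ ys) y u
  consec-joint one one = hd
  consec-joint one (cons _ _) = hd
  consec-joint (cons a c) d = tl (consec-joint c d)

  consec-++ : Chain xs x y → Chain ys u v → All P xs → All Q ys → Consec (xs ++ ys) a b →
    (P a × P b) ⊎ (a ≡ y × b ≡ u) ⊎ (Q a × Q b)
  consec-++ one one _ _ hd = inj₂ (inj₁ (refl , refl))
  consec-++ one (cons _ _) _ _ hd = inj₂ (inj₁ (refl , refl))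
  consec-++ one d _ qs (tl c) = inj₂ (inj₂ (both d qs c))
    where
    both : Chain ys x y → All Q ys → Consec ys a b → Q a × Q b
    both (cons _ one) (q ∷ q′ ∷ _) hd = q , q′
    both (cons _ (cons _ _)) (q ∷ q′ ∷ _) hd = q , q′
    both (cons _ d) (_ ∷ qs) (tl c) = both d qs c
  consec-++ (cons _ one) d (p ∷ p′ ∷ _) _ hd = inj₁ (p , p′)
  consec-++ (cons _ (cons _ _)) d (p ∷ p′ ∷ _) _ hd = inj₁ (p , p′)
  consec-++ (cons _ c) d (_ ∷ ps) qs (tl e) = consec-++ c d ps qs e

  lookup-injective : ∀ {xs : List V} → Unique xs → ∀ i j → lookupˡ xs i ≡ lookupˡ xs j → i ≡ j
  lookup-injective (_ ∷ u) zero zero _ = refl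
  lookup-injective (x# ∷ u) zero (suc j) eq = contradiction eq (All.lookup x# (∈-lookup j))
  lookup-injective (x# ∷ u) (suc i) zero eq = contradiction (≡sym eq) (All.lookup x# (∈-lookup i))
  lookup-injective (_ ∷ u) (suc i) (suc j) eq = cong suc (lookup-injective u i j eq)

  toCycle : Chain xs x y → Unique xs → 3 ≤ length xs → Adj G y x → Cycle G
  toCycle {z ∷ zs} {x} {y} c u (s≤s l) e = record
    { m = length zs ; long = l ; vert = lookupˡ (z ∷ zs)
    ; inj = λ i j → lookup-injective u i j
    ; step = λ i → consec⇒Adj c (consec-lookup z zs i)
    ; close = subst₂ (Adj G) (≡sym (chain-last c)) (first c) e }
    where
    first : Chain (z ∷ zs) x y → x ≡ z
    first one = refl
    first (cons _ _) = refl

  edge-consec : (c : Chain xs x y) (u : Unique xs) (l : 3 ≤ length xs) (e : Adj G y x) →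
    Consec xs a b → EdgeOf (toCycle c u l e) a b
  edge-consec {z ∷ zs} c u (s≤s l) e q with consec-index q
  ... | i , p , p′ = inj₁ (i , inj₁ (p , p′))

  edge-close : (c : Chain xs x y) (u : Unique xs) (l : 3 ≤ length xs) (e : Adj G y x) →
    EdgeOf (toCycle c u l e) x y
  edge-close {z ∷ zs} c@(cons _ _) u (s≤s l) e = inj₂ (inj₂ (refl , ≡sym (chain-last c)))

  edge⇒consec : (c : Chain xs x y) (u : Unique xs) (l : 3 ≤ length xs) (e : Adj G y x) →
    EdgeOf (toCycle c u l e) a b → (Consec xs a b ⊎ Consec xs b a) ⊎ SamePair a b y x
  edge⇒consec {z ∷ zs} c u (s≤s l) e (inj₁ (i , inj₁ (refl , refl))) = inj₁ (inj₁ (consec-lookup z zs i))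
  edge⇒consec {z ∷ zs} c u (s≤s l) e (inj₁ (i , inj₂ (refl , refl))) = inj₁ (inj₂ (consec-lookup z zs i))
  edge⇒consec {z ∷ zs} c@(cons _ _) u (s≤s l) e (inj₂ s) = inj₂ (subst (λ w → SamePair _ _ w z) (chain-last c) s)

  -- Two such edges already close a cycle through both connected sets; a third
  -- edge would lie on another cycle sharing an edge with the first.
  at-most-two-crossing-edges : Cactus G → (∀ {v} → P v → ¬ Q v) →
    ∀ {a₁ a₂ a₃ c₁ c₂ c₃ i j k l} →
    Walk P a₂ a₁ i → Walk P a₃ a₁ j → Walk Q c₁ c₂ k → Walk Q c₁ c₃ l →
    Adj G a₁ c₁ → Adj G a₂ c₂ → Adj G a₃ c₃ →
    ¬ (a₁ ≡ a₂ × c₁ ≡ c₂) → ¬ (a₁ ≡ a₃ × c₁ ≡ c₃) → ¬ (a₂ ≡ a₃ × c₂ ≡ c₃) → Empty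
  at-most-two-crossing-edges {P} {Q} cactus disj {a₁} {a₂} {a₃} {c₁} {c₂} {c₃} w₂ w₃ v₂ v₃ e₁ e₂ e₃ 1≠2 1≠3 2≠3 =
    crossing (T₁₂.toConsec (proj₂ (cactus T₁₂.C T₁₃.C a₁ c₁ T₁₂.shared T₁₃.shared a₃ c₃) T₁₃.closing))
    where
    module Through {a c : V} {i j} (w : Walk P a a₁ i) (v : Walk Q c₁ c j) (e : Adj G a c)
        (ne : ¬ (a₁ ≡ a × c₁ ≡ c)) where
      as = proj₁ (simplify w)
      cs = proj₁ (simplify v)
      asC = proj₁ (proj₂ (simplify w))
      csC = proj₁ (proj₂ (simplify v))
      asP = proj₂ (proj₂ (proj₂ (simplify w)))
      csQ = proj₂ (proj₂ (proj₂ (simplify v)))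
      chain : Chain (as ++ cs) a c
      chain = chain-++ asC e₁ csC
      unique : Unique (as ++ cs)
      unique = ++⁺ (proj₁ (proj₂ (proj₂ (simplify w)))) (proj₁ (proj₂ (proj₂ (simplify v))))
        λ (p , q) → disj (All.lookup asP p) (All.lookup csQ q)
      long′ : ∀ {xs ys} → Chain xs a a₁ → Chain ys c₁ c → 3 ≤ length (xs ++ ys)
      long′ one one = contradiction (refl , refl) ne
      long′ one (cons _ one) = s≤s (s≤s (s≤s z≤n))
      long′ one (cons _ (cons _ _)) = s≤s (s≤s (s≤s z≤n))
      long′ (cons _ one) one = s≤s (s≤s (s≤s z≤n))
      long′ (cons _ one) (cons _ _) = s≤s (s≤s (s≤s z≤n))
      long′ (cons _ (cons _ one)) _ = s≤s (s≤s (s≤s z≤n))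
      long′ (cons _ (cons _ (cons _ _))) _ = s≤s (s≤s (s≤s z≤n))
      C : Cycle G
      C = toCycle chain unique (long′ asC csC) (Adj-sym e)
      shared : EdgeOf C a₁ c₁
      shared = edge-consec chain unique (long′ asC csC) (Adj-sym e) (consec-joint asC csC)
      closing : EdgeOf C a c
      closing = edge-close chain unique (long′ asC csC) (Adj-sym e)
      toConsec : ∀ {x y} → EdgeOf C x y → (Consec (as ++ cs) x y ⊎ Consec (as ++ cs) y x) ⊎ SamePair x y c a
      toConsec = edge⇒consec chain unique (long′ asC csC) (Adj-sym e)
    module T₁₂ = Through w₂ v₂ e₂ 1≠2
    module T₁₃ = Through w₃ v₃ e₃ 1≠3
    pa₁ = end w₂
    pa₃ = start w₃
    qc₃ = end v₃
    -- Both cycles contain a₁c₁, so the cactus property puts a₃c₃ on the first one. Its only edges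
    -- between `P` and `Q` are the joint a₁c₁ and the closing edge a₂c₂, and a₃c₃ is neither.
    crossing : (Consec (T₁₂.as ++ T₁₂.cs) a₃ c₃ ⊎ Consec (T₁₂.as ++ T₁₂.cs) c₃ a₃) ⊎ SamePair a₃ c₃ c₂ a₂ → Empty
    crossing (inj₂ (inj₁ (refl , _))) = disj pa₃ (end v₂)
    crossing (inj₂ (inj₂ (p , q))) = 2≠3 (≡sym p , ≡sym q)
    crossing (inj₁ (inj₁ c)) with consec-++ T₁₂.asC T₁₂.csC T₁₂.asP T₁₂.csQ c
    ... | inj₁ (_ , p) = disj p qc₃
    ... | inj₂ (inj₁ (p , q)) = 1≠3 (≡sym p , ≡sym q)
    ... | inj₂ (inj₂ (q , _)) = disj pa₃ q
    crossing (inj₁ (inj₂ c)) with consec-++ T₁₂.asC T₁₂.csC T₁₂.asP T₁₂.csQ c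
    ... | inj₁ (p , _) = disj p qc₃
    ... | inj₂ (inj₁ (refl , _)) = disj pa₁ qc₃
    ... | inj₂ (inj₂ (_ , q)) = disj pa₃ q

-- Components outside a ball around the source

module Regions {n : ℕ} (G : Graph n) (r : Fin n) where
  open Walks G

  Near : ℕ → V → Set
  Near t v = Walk (λ _ → Unit) r v t

  Far : ℕ → V → Set
  Far t v = ¬ Near t v

  Reachable : V → Set
  Reachable v = Near n v

  Ball : V → ℕ → V → Set
  Ball z t v = Walk (_≢ z) r v t

  Comp : ℕ → V → V → Set
  Comp t p v = Walk (Far t) p v n

  Avoid : V → V → V → Set
  Avoid z q v = v ≢ z × v ≢ q

  Cut : V → V → V → Set
  Cut z q v = Reachable v × ¬ Walk (Avoid z q) r v n

  Late : ℕ → V → ℕ → V → Set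
  Late t p T v = Comp t p v × ¬ Ball p T v

  near? : ∀ t v → Dec (Near t v)
  near? t v = walk? (λ _ → yes tt) r v t

  comp? : ∀ t p v → Dec (Comp t p v)
  comp? t p v = walk? (λ y → ¬? (near? t y)) p v n

  ball? : ∀ z t v → Dec (Ball z t v)
  ball? z t v = walk? (λ y → ¬? (y ≟ z)) r v t

  cut? : ∀ z q v → Dec (Cut z q v)
  cut? z q v = near? n v ×-dec ¬? (walk? (λ y → ¬? (y ≟ z) ×-dec ¬? (y ≟ q)) r v n)

  late? : ∀ t p T v → Dec (Late t p T v)
  late? t p T v = comp? t p v ×-dec ¬? (ball? p T v)

  near-source : ∀ t → Near t r
  near-source t = stop tt

  forget : ∀ {P x y k} → Walk P x y k → Walk (λ _ → Unit) x y k
  forget = mapW (λ _ → tt)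

  far-anti : ∀ {s t v} → s ≤ t → Far t v → Far s v
  far-anti s≤t f w = f (weaken s≤t w)

  near⇒reachable : ∀ {t v} → Near t v → Reachable v
  near⇒reachable = shortenₙ

  comp-refl : ∀ {t p} → Far t p → Comp t p p
  comp-refl f = stop f

  comp-sym : ∀ {t p v} → Comp t p v → Comp t v p
  comp-sym w = shortenₙ (reverse w)

  comp-trans : ∀ {t p q v} → Comp t p q → Comp t q v → Comp t p v
  comp-trans w w′ = shortenₙ (w ⊕ w′)

  comp-step : ∀ {t p y z} → Comp t p y → Adj G y z → Far t z → Comp t p z
  comp-step w a f = shortenₙ (w ▹ a , f)

  comp-anti : ∀ {s t p v} → s ≤ t → Comp t p v → Comp s p v
  comp-anti s≤t = mapW (far-anti s≤t)

  comp-reachable : ∀ {t p v} → Reachable p → Comp t p v → Reachable v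
  comp-reachable R w = shortenₙ (R ⊕ forget w)

  entry : ∀ {t y k} → Walk (λ _ → Unit) r y k → Far t y →
    ∃[ b ] ∃[ u ] Near t b × Adj G b u × Comp t u y
  entry (stop _) f = contradiction (near-source _) f
  entry {t} (_▹_,_ {y = y} w a _) f with near? t y
  ... | yes N = y , _ , N , a , stop f
  ... | no ¬N = let b , u , Nb , e , c = entry w ¬N in b , u , Nb , e , comp-step c a f

  -- `idx y` is the position on the spine at which y hangs; its fibres are the classes, joined in a
  -- row by the spine edges alone. `left` and `right` may be the same edge: a component with one
  -- attachment edge is a single class with `L` = 0.
  record Spine (t : ℕ) (p : V) : Set where
    field
      L : ℕ
      x : ℕ → V
      idx : V → ℕ
      x-comp : ∀ {i} → i ≤ L → Comp t p (x i)
      idx-x : ∀ {i} → i ≤ L → idx (x i) ≡ i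
      idx≤ : ∀ {y} → Comp t p y → idx y ≤ L
      x-adj : ∀ {i} → i < L → Adj G (x i) (x (suc i))
      left : ∃[ b ] Near t b × Adj G b (x 0)
      right : ∃[ b ] Near t b × Adj G b (x L)
      edges : ∀ {y z} → Comp t p y → Comp t p z → Adj G y z → idx y ≡ idx z ⊎
        ∃[ i ] i < L × ((y ≡ x i × z ≡ x (suc i)) ⊎ (y ≡ x (suc i) × z ≡ x i))
      ends : ∀ {b y} → Near t b → Comp t p y → Adj G b y → y ≡ x 0 ⊎ y ≡ x L

  spine-walk : ∀ (x : ℕ → V) L → (∀ {i} → i < L → Adj G (x i) (x (suc i))) → ∀ {P : V → Set} d i →
    d + i ≤ L → (∀ l → i ≤ l → l ≤ d + i → P (x l)) → Walk P (x i) (x (d + i)) d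
  spine-walk x L adj zero i _ f = stop (f i ≤-refl ≤-refl)
  spine-walk x L adj (suc d) i le f =
    spine-walk x L adj d i (<⇒≤ le) (λ l a b → f l a (m≤n⇒m≤1+n b)) ▹ adj le
      , f (suc (d + i)) (m≤n⇒m≤1+n (m≤n+m i d)) ≤-refl

  spine-walk′ : ∀ (x : ℕ → V) L → (∀ {i} → i < L → Adj G (x i) (x (suc i))) → ∀ {P : V → Set} i j →
    i ≤ j → j ≤ L → (∀ l → i ≤ l → l ≤ j → P (x l)) → ∃[ k ] Walk P (x i) (x j) k
  spine-walk′ x L adj {P} i j i≤j j≤L f =
    j ∸ i , subst (λ m → Walk P (x i) (x m) (j ∸ i)) eq
      (spine-walk x L adj (j ∸ i) i (≤-trans (≤-reflexive eq) j≤L) (λ l a b → f l a (≤-trans b (≤-reflexive eq))))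
    where
    eq : j ∸ i + i ≡ j
    eq = m∸n+n≡m i≤j

  -- Total indexing, because `Spine.x` is a function on all of ℕ. The default is returned beyond the
  -- end of the path, where no field of `Spine` says anything about `x`.
  nth : V → List V → ℕ → V
  nth d [] i = d
  nth d (y ∷ ys) zero = y
  nth d (y ∷ ys) (suc i) = nth d ys i

  module NthChain (d : V) where
    open CactusEdges G

    nth-All : ∀ {P : V → Set} {xs} → All P xs → ∀ {i} → i < length xs → P (nth d xs i)
    nth-All (p ∷ ps) {zero} _ = p
    nth-All (p ∷ ps) {suc i} (s≤s l) = nth-All ps l

    nth-∈ : ∀ {xs} i → i < length xs → nth d xs i ∈ˡ xs
    nth-∈ {_ ∷ _} zero _ = here refl
    nth-∈ {_ ∷ _} (suc i) (s≤s l) = there (nth-∈ i l)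

    ∈-nth : ∀ {xs y} → y ∈ˡ xs → ∃[ i ] i < length xs × y ≡ nth d xs i
    ∈-nth (here refl) = 0 , s≤s z≤n , refl
    ∈-nth (there y∈) = let i , l , eq = ∈-nth y∈ in suc i , s≤s l , eq

    nth-injective : ∀ {xs} → Unique xs → ∀ {i j} → i < length xs → j < length xs →
      nth d xs i ≡ nth d xs j → i ≡ j
    nth-injective (_ ∷ u) {zero} {zero} _ _ _ = refl
    nth-injective (x# ∷ u) {zero} {suc j} _ (s≤s l) eq = contradiction eq (All.lookup x# (nth-∈ j l))
    nth-injective (x# ∷ u) {suc i} {zero} (s≤s l) _ eq = contradiction (≡sym eq) (All.lookup x# (nth-∈ i l))
    nth-injective (_ ∷ u) {suc i} {suc j} (s≤s l) (s≤s l′) eq = cong suc (nth-injective u l l′ eq)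

    nth-first : ∀ {xs a b} → Chain xs a b → nth d xs 0 ≡ a
    nth-first one = refl
    nth-first (cons _ _) = refl

    nth-last : ∀ {y ys a b} → Chain (y ∷ ys) a b → nth d (y ∷ ys) (length ys) ≡ b
    nth-last one = refl
    nth-last (cons _ one) = refl
    nth-last (cons _ (cons a c)) = nth-last (cons a c)

    nth-adj : ∀ {xs a b} → Chain xs a b → ∀ {i} → suc i < length xs → Adj G (nth d xs i) (nth d xs (suc i))
    nth-adj one (s≤s ())
    nth-adj (cons a one) {zero} _ = a
    nth-adj (cons a (cons _ _)) {zero} _ = a
    nth-adj (cons a c) {suc i} (s≤s l) = nth-adj c l

  -- The component of p outside the ball is attached to the ball by at most two
  -- edges, and a path between their ends consists of bridges of the component.
  module SpineConstruction (cactus : Cactus G) (t : ℕ) (p : V) {b₀ u₀ : V}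
      (Nb₀ : Near t b₀) (e₀ : Adj G b₀ u₀) (c₀ : Comp t p u₀) where
    open CactusEdges G
    open DecMem (_≟_ {n}) using () renaming (_∈?_ to _∈ˡ?_)

    in-ball : ∀ {b} → Near t b → Walk (Near t) r b t
    in-ball N = visited N

    between : ∀ {b b′} → Near t b → Near t b′ → ∃[ k ] Walk (Near t) b b′ k
    between N N′ = _ , reverse (in-ball N) ⊕ in-ball N′

    SecondEdge : V → V → Set
    SecondEdge b v = Near t b × Comp t p v × Adj G b v × ¬ (b₀ ≡ b × u₀ ≡ v)

    second? : Dec (∃[ b ] ∃[ v ] SecondEdge b v)
    second? = any? λ b → any? λ v → near? t b ×-dec comp? t p v ×-dec Adj? b v ×-dec ¬? ((b₀ ≟ b) ×-dec (u₀ ≟ v))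

    single : ¬ (∃[ b ] ∃[ v ] SecondEdge b v) → Spine t p
    single none = record
      { L = 0 ; x = λ _ → u₀ ; idx = λ _ → 0 ; x-comp = λ _ → c₀ ; idx-x = λ { z≤n → refl } ; idx≤ = λ _ → z≤n
      ; x-adj = λ () ; left = b₀ , Nb₀ , e₀ ; right = b₀ , Nb₀ , e₀ ; edges = λ _ _ _ → inj₁ refl
      ; ends = ends′ }
      where
      ends′ : ∀ {b y} → Near t b → Comp t p y → Adj G b y → y ≡ u₀ ⊎ y ≡ u₀
      ends′ {b} {y} N c a with b₀ ≟ b | u₀ ≟ y
      ... | _ | yes refl = inj₁ refl
      ... | _ | no u≢ = contradiction (b , y , N , c , a , u≢ ∘ proj₂) none

    module Double {b₁ v₁ : V} (second : SecondEdge b₁ v₁) (path : SimplePath (Far t) u₀ v₁) where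
      Nb₁ = proj₁ second
      c₁ = proj₁ (proj₂ second)
      e₁ = proj₁ (proj₂ (proj₂ second))
      xs : List V
      xs = proj₁ path
      chain : Chain xs u₀ v₁
      chain = proj₁ (proj₂ path)
      unique : Unique xs
      unique = proj₁ (proj₂ (proj₂ path))
      far : All (Far t) xs
      far = proj₂ (proj₂ (proj₂ path))
      open NthChain u₀
      x : ℕ → V
      x = nth u₀ xs
      L : ℕ
      L = pred (length xs)
      sucL : length xs ≡ suc L
      sucL = nonempty chain
        where
        nonempty : ∀ {ys a b} → Chain ys a b → length ys ≡ suc (pred (length ys))
        nonempty one = refl
        nonempty (cons _ _) = refl
      ≤L⇒< : ∀ {i} → i ≤ L → i < length xs
      ≤L⇒< i≤ = ≤-trans (s≤s i≤) (≤-reflexive (≡sym sucL))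
      <⇒≤L : ∀ {i} → i < length xs → i ≤ L
      <⇒≤L i< = ≤-pred (≤-trans i< (≤-reflexive sucL))
      x0 : x 0 ≡ u₀
      x0 = nth-first chain
      xL : x L ≡ v₁
      xL = last chain
        where
        last : ∀ {ys a b} → Chain ys a b → nth u₀ ys (pred (length ys)) ≡ b
        last c@one = refl
        last c@(cons _ _) = nth-last c
      x-far : ∀ {i} → i ≤ L → Far t (x i)
      x-far i≤ = nth-All far (≤L⇒< i≤)
      x-adj : ∀ {i} → i < L → Adj G (x i) (x (suc i))
      x-adj i< = nth-adj chain (≤L⇒< i<)
      x-injective : ∀ {i j} → i ≤ L → j ≤ L → x i ≡ x j → i ≡ j
      x-injective i≤ j≤ = nth-injective unique (≤L⇒< i≤) (≤L⇒< j≤)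

      OffSpine : V → Set
      OffSpine w = Far t w × w ∉ˡ xs

      Hangs : ℕ → V → Set
      Hangs i y = y ≡ x i ⊎ (y ∉ˡ xs × ∃[ h ] Adj G (x i) h × Walk OffSpine h y n)

      abstract
        hit : ∀ {y k} → Walk (Far t) u₀ y k → ∃[ i ] i ≤ L × Hangs i y
        hit {y} w with y ∈ˡ? xs
        ... | yes y∈ = let i , l , eq = ∈-nth y∈ in i , <⇒≤L l , inj₁ eq
        hit (stop f) | no y∉ = contradiction (subst (_∈ˡ xs) x0 (nth-∈ 0 (≤L⇒< z≤n))) y∉
        hit (w ▹ a , f) | no y∉ with hit w
        ... | i , l , inj₁ refl = i , l , inj₂ (y∉ , _ , a , stop (f , y∉))
        ... | i , l , inj₂ (_ , h , e , w′) = i , l , inj₂ (y∉ , h , e , shortenₙ (w′ ▹ a , (f , y∉)))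

      After : ℕ → V → Set
      After i w = OffSpine w ⊎ ∃[ l ] i < l × l ≤ L × w ≡ x l

      -- Cut the spine after x i: `Before` is the ball with the initial part, `After` the final part
      -- with everything off the spine. The spine edge at i and the second attachment edge b₁v₁
      -- already cross this cut, so an edge from x i to h would be a third.
      no-third-edge : ∀ {i h k} → i < L → Walk (After i) (x (suc i)) h k → Adj G (x i) h → h ≢ x (suc i) → Empty
      no-third-edge {i} {h} i<L w a h≢ = at-most-two-crossing-edges {P = Before} {Q = After i} cactus disj
          (proj₂ toxi) (stop {k = 0} (inj₂ (i , ≤-refl , refl))) (proj₂ tov) w (x-adj i<L) e₁ a
          (λ (eq , _) → x-far (<⇒≤ i<L) (subst (Near t) (≡sym eq) Nb₁))
          (λ (_ , eq) → h≢ (≡sym eq))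
          (λ (eq , _) → x-far (<⇒≤ i<L) (subst (Near t) eq Nb₁))
        where
        Before : V → Set
        Before w = Near t w ⊎ ∃[ l ] l ≤ i × w ≡ x l
        disj : ∀ {v} → Before v → ¬ After i v
        disj (inj₁ N) (inj₁ (F , _)) = F N
        disj (inj₁ N) (inj₂ (l , _ , l≤ , refl)) = x-far l≤ N
        disj (inj₂ (l , l≤ , refl)) (inj₁ (_ , ∉)) = ∉ (nth-∈ l (≤L⇒< (≤-trans l≤ (<⇒≤ i<L))))
        disj (inj₂ (l , l≤ , refl)) (inj₂ (m , i<m , m≤ , eq)) =
          <⇒≢ (≤-<-trans l≤ i<m) (x-injective (≤-trans l≤ (<⇒≤ i<L)) m≤ eq)
        toxi : ∃[ k ] Walk Before b₁ (x i) k
        toxi = _ , (mapW inj₁ (proj₂ (between Nb₁ Nb₀)) ▹ subst (Adj G b₀) (≡sym x0) e₀ , inj₂ (0 , z≤n , refl))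
          ⊕ proj₂ (spine-walk′ x L x-adj 0 i z≤n (<⇒≤ i<L) (λ l _ l≤ → inj₂ (l , l≤ , refl)))
        tov : ∃[ k ] Walk (After i) (x (suc i)) v₁ k
        tov = _ , subst (λ v → Walk (After i) (x (suc i)) v _) xL
          (proj₂ (spine-walk′ x L x-adj (suc i) L i<L ≤-refl (λ l i< l≤ → inj₂ (l , i< , l≤ , refl))))

      along : ∀ {i j} → i < j → j ≤ L → ∃[ k ] Walk (After i) (x (suc i)) (x j) k
      along i<j j≤L = spine-walk′ x L x-adj _ _ i<j j≤L (λ l i< l≤ → inj₂ (l , i< , ≤-trans l≤ j≤L , refl))

      -- If y hung at both i < j, one could run from x (suc i) along the spine to x j and through y
      -- to a neighbour h of x i off the spine, which `no-third-edge` forbids.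
      hangs-< : ∀ {i j y} → i < j → j ≤ L → Hangs i y → Hangs j y → Empty
      hangs-< i<j j≤L (inj₁ refl) (inj₁ eq) = <⇒≢ i<j (x-injective (≤-trans (<⇒≤ i<j) j≤L) j≤L eq)
      hangs-< i<j j≤L (inj₁ refl) (inj₂ (∉ , _)) = ∉ (nth-∈ _ (≤L⇒< (≤-trans (<⇒≤ i<j) j≤L)))
      hangs-< i<j j≤L (inj₂ (∉ , _)) (inj₁ refl) = ∉ (nth-∈ _ (≤L⇒< j≤L))
      hangs-< i<j j≤L (inj₂ (_ , h , e , w)) (inj₂ (_ , h′ , e′ , w′)) =
        no-third-edge (<-≤-trans i<j j≤L)
          ((proj₂ (along i<j j≤L) ▹ e′ , inj₁ (start w′)) ⊕ mapW inj₁ (w′ ⊕ reverse w)) e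
          (λ { refl → proj₂ (start w) (nth-∈ _ (≤L⇒< (≤-trans i<j j≤L))) })

      hangs-unique : ∀ {i j y} → i ≤ L → j ≤ L → Hangs i y → Hangs j y → i ≡ j
      hangs-unique {i} {j} i≤ j≤ H H′ with <-cmp i j
      ... | tri< lt _ _ = ⊥-elim (hangs-< lt j≤ H H′)
      ... | tri≈ _ eq _ = eq
      ... | tri> _ _ gt = ⊥-elim (hangs-< gt i≤ H′ H)

      -- Computed through the decision `comp?`, so that the index does not depend on a proof of
      -- membership; 0 is a dummy value outside the component.
      idx : V → ℕ
      idx y with comp? t p y
      ... | yes c = proj₁ (hit (comp-trans (comp-sym c₀) c))
      ... | no _ = 0

      idx-spec : ∀ {y} → Comp t p y → idx y ≤ L × Hangs (idx y) y
      idx-spec {y} c with comp? t p y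
      ... | yes c = proj₂ (hit (comp-trans (comp-sym c₀) c))
      ... | no ¬c = contradiction c ¬c

      x-comp : ∀ {i} → i ≤ L → Comp t p (x i)
      x-comp {i} i≤ = comp-trans c₀ (shortenₙ (subst (λ v → Walk (Far t) v (x i) _) x0
        (proj₂ (spine-walk′ x L x-adj 0 i z≤n i≤ (λ l _ l≤ → x-far (≤-trans l≤ i≤))))))

      chord : ∀ {i j} → i < j → j ≤ L → Adj G (x i) (x j) → j ≡ suc i
      chord {i} {j} i<j j≤L a with j ≟ℕ suc i
      ... | yes eq = eq
      ... | no ne = ⊥-elim (no-third-edge (<-≤-trans i<j j≤L) (proj₂ (along i<j j≤L)) a
              (λ eq → ne (x-injective j≤L (≤-trans i<j j≤L) eq)))

      edges : ∀ {y z} → Comp t p y → Comp t p z → Adj G y z → idx y ≡ idx z ⊎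
        ∃[ i ] i < L × ((y ≡ x i × z ≡ x (suc i)) ⊎ (y ≡ x (suc i) × z ≡ x i))
      edges {y} {z} cy cz a with idx y | idx z | idx-spec cy | idx-spec cz
      ... | i | j | i≤ , inj₁ refl | j≤ , inj₁ refl with <-cmp i j
      ...   | tri≈ _ eq _ = inj₁ eq
      ...   | tri< lt _ _ with chord lt j≤ a
      ...     | refl = inj₂ (i , j≤ , inj₁ (refl , refl))
      edges cy cz a | i | j | i≤ , inj₁ refl | j≤ , inj₁ refl | tri> _ _ gt with chord gt i≤ (Adj-sym a)
      ...     | refl = inj₂ (j , i≤ , inj₂ (refl , refl))
      -- An edge with an end off the spine makes that end hang at the index of the other end as
      -- well, and `hangs-unique` identifies the two.
      edges cy cz a | i | j | i≤ , inj₁ refl | j≤ , Hz@(inj₂ (∉ , _)) =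
        inj₁ (hangs-unique i≤ j≤ (inj₂ (∉ , _ , a , stop (end cz , ∉))) Hz)
      edges cy cz a | i | j | i≤ , Hy@(inj₂ (∉ , _)) | j≤ , inj₁ refl =
        inj₁ (hangs-unique i≤ j≤ Hy (inj₂ (∉ , _ , Adj-sym a , stop (end cy , ∉))))
      edges cy cz a | i | j | i≤ , inj₂ (_ , h , e , w) | j≤ , Hz@(inj₂ (∉ , _)) =
        inj₁ (hangs-unique i≤ j≤ (inj₂ (∉ , h , e , shortenₙ (w ▹ a , (end cz , ∉)))) Hz)

      -- Any other end would give a third edge between the ball and the component, both of which are
      -- connected.
      ends : ∀ {b y} → Near t b → Comp t p y → Adj G b y → y ≡ x 0 ⊎ y ≡ x L
      ends {b} {y} N c a with y ≟ u₀ | y ≟ v₁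
      ... | yes eq | _ = inj₁ (trans eq (≡sym x0))
      ... | no _ | yes eq = inj₂ (trans eq (≡sym xL))
      ... | no ≢u | no ≢v = ⊥-elim (at-most-two-crossing-edges cactus (λ N F → F N)
            (proj₂ (between Nb₁ Nb₀)) (proj₂ (between N Nb₀)) (comp-trans (comp-sym c₀) c₁) (comp-trans (comp-sym c₀) c)
            e₀ e₁ a (proj₂ (proj₂ (proj₂ second))) (λ (_ , eq) → ≢u (≡sym eq)) (λ (_ , eq) → ≢v (≡sym eq)))

      double : Spine t p
      double = record
        { L = L ; x = x ; idx = idx ; x-comp = x-comp
        ; idx-x = λ i≤ → let l , H = idx-spec (x-comp i≤) in hangs-unique l i≤ H (inj₁ refl)
        ; idx≤ = λ c → proj₁ (idx-spec c) ; x-adj = x-adj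
        ; left = b₀ , Nb₀ , subst (Adj G b₀) (≡sym x0) e₀
        ; right = b₁ , Nb₁ , subst (Adj G b₁) (≡sym xL) e₁
        ; edges = edges ; ends = ends }

    spine : Spine t p
    spine with second?
    ... | no none = single none
    ... | yes (b , v , s@(_ , c , _)) = Double.double s (simplify (comp-trans (comp-sym c₀) c))

  spine : Cactus G → ∀ {t p} → Reachable p → Far t p → Spine t p
  spine cactus {t} {p} R F =
    let b , u , N , e , c = entry R F in SpineConstruction.spine cactus t p N e (comp-sym c)

-- Fire along a spine

module SpineFire {n : ℕ} (G : Graph n) (r : Fin n) where
  open Walks G
  open Regions G r

  weight : V → ℕ
  weight v = ∣ subset (cut? v v) ∣

  -- With it, arguments are written only for a fire that arrives from `x 0`.
  reverse-spine : ∀ {t p} → Spine t p → Spine t p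
  reverse-spine {t} {p} σ = record
    { L = L ; x = λ i → x (L ∸ i) ; idx = λ y → L ∸ idx y
    ; x-comp = λ {i} _ → x-comp (m∸n≤m L i)
    ; idx-x = λ {i} i≤ → trans (cong (L ∸_) (idx-x (m∸n≤m L i))) (m∸[m∸n]≡n i≤)
    ; idx≤ = λ {y} _ → m∸n≤m L (idx y)
    ; x-adj = λ {i} i< → Adj-sym (subst (λ m → Adj G (x (L ∸ suc i)) (x m)) (≡sym (+-∸-assoc 1 i<))
        (x-adj (subst (_≤ L) (+-∸-assoc 1 i<) (m∸n≤m L i))))
    ; left = right
    ; right = subst (λ m → ∃[ b ] Near t b × Adj G b (x m)) (≡sym (n∸n≡0 L)) left
    ; edges = λ cy cz a → edges′ (edges cy cz a)
    ; ends = λ N c a → [ (λ eq → inj₂ (trans eq (cong x (≡sym (n∸n≡0 L))))) , inj₁ ]′ (ends N c a) }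
    where
    open Spine σ
    x′ : ℕ → V
    x′ i = x (L ∸ i)
    back : ∀ {i} → i ≤ L → x i ≡ x′ (L ∸ i)
    back i≤ = cong x (≡sym (m∸[m∸n]≡n i≤))
    back′ : ∀ {i} → i < L → x i ≡ x′ (suc (L ∸ suc i))
    back′ {i} i< = trans (back (<⇒≤ i<)) (cong x′ (+-∸-assoc 1 i<))
    edges′ : ∀ {y z} → idx y ≡ idx z ⊎ (∃[ i ] i < L × ((y ≡ x i × z ≡ x (suc i)) ⊎ (y ≡ x (suc i) × z ≡ x i))) →
      L ∸ idx y ≡ L ∸ idx z ⊎
      (∃[ i ] i < L × ((y ≡ x′ i × z ≡ x′ (suc i)) ⊎ (y ≡ x′ (suc i) × z ≡ x′ i)))
    edges′ (inj₁ eq) = inj₁ (cong (L ∸_) eq)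
    edges′ (inj₂ (i , i< , e)) = inj₂ (L ∸ suc i , subst (_≤ L) (+-∸-assoc 1 i<) (m∸n≤m L i) , flip e)
      where
      flip : ∀ {y z} → (y ≡ x i × z ≡ x (suc i)) ⊎ (y ≡ x (suc i) × z ≡ x i) →
        (y ≡ x′ (L ∸ suc i) × z ≡ x′ (suc (L ∸ suc i))) ⊎ (y ≡ x′ (suc (L ∸ suc i)) × z ≡ x′ (L ∸ suc i))
      flip (inj₁ (p , q)) = inj₂ (trans p (back′ i<) , trans q (back i<))
      flip (inj₂ (p , q)) = inj₁ (trans p (back i<) , trans q (back′ i<))

  module OnSpine {t p} (σ : Spine t p) where
    open Spine σ

    -- Follow the fire backwards from y. It can leave the classes j, ..., k only along a spine edge
    -- at x j or x k, or into the ball from x 0 or x L; in the latter case that end lies in the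
    -- interval only if it is x j or x k itself.
    sandwich : ∀ {j k} → j ≤ k → k ≤ L → ∀ {y m} → Walk (Avoid (x k) (x j)) r y m → Comp t p y →
      j ≤ idx y → idx y ≤ k → Empty
    sandwich j≤k k≤L (stop _) c _ _ = end c (near-source t)
    sandwich {j} {k} j≤k k≤L (_▹_,_ {y = y′} w a (≢k , ≢j)) c j≤ ≤k with near? t y′
    ... | yes N with ends N c a
    ...   | inj₁ refl = ≢j (cong x (≡sym (n≤0⇒n≡0 (subst (j ≤_) (idx-x z≤n) j≤))))
    ...   | inj₂ refl = ≢k (cong x (≤-antisym (subst (_≤ k) (idx-x ≤-refl) ≤k) k≤L))
    sandwich {j} {k} j≤k k≤L (w ▹ a , (≢k , ≢j)) c j≤ ≤k | no F
      with edges (comp-step c (Adj-sym a) F) c a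
    ... | inj₁ eq = sandwich j≤k k≤L w (comp-step c (Adj-sym a) F) (subst (j ≤_) (≡sym eq) j≤) (subst (_≤ k) (≡sym eq) ≤k)
    ... | inj₂ (i , i< , inj₁ (refl , refl)) with m≤n⇒m<n∨m≡n (subst (j ≤_) (idx-x i<) j≤)
    ...   | inj₂ refl = ≢j refl
    ...   | inj₁ (s≤s j≤i) = sandwich j≤k k≤L w (comp-step c (Adj-sym a) F)
              (subst (j ≤_) (≡sym (idx-x (<⇒≤ i<))) j≤i)
              (≤-trans (≤-reflexive (idx-x (<⇒≤ i<))) (≤-trans (n≤1+n i) (subst (_≤ k) (idx-x i<) ≤k)))
    sandwich {j} {k} j≤k k≤L (w ▹ a , (≢k , ≢j)) c j≤ ≤k | no F | inj₂ (i , i< , inj₂ (refl , refl))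
      with m≤n⇒m<n∨m≡n (subst (_≤ k) (idx-x (<⇒≤ i<)) ≤k)
    ...   | inj₂ refl = ≢k refl
    ...   | inj₁ i<k = sandwich j≤k k≤L w (comp-step c (Adj-sym a) F)
              (≤-trans (subst (j ≤_) (idx-x (<⇒≤ i<)) j≤) (≤-trans (n≤1+n i) (≤-reflexive (≡sym (idx-x i<)))))
              (≤-trans (≤-reflexive (idx-x i<)) i<k)

    interval-cut : Reachable p → ∀ {j k} → j ≤ k → k ≤ L → ∀ {y} → Comp t p y → j ≤ idx y → idx y ≤ k →
      Cut (x k) (x j) y
    interval-cut R j≤k k≤L c j≤ ≤k = comp-reachable R c , λ w → sandwich j≤k k≤L w c j≤ ≤k

    class-cut : Reachable p → ∀ {y} → Comp t p y → Cut (x (idx y)) (x (idx y)) y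
    class-cut R c = interval-cut R ≤-refl (idx≤ c) c ≤-refl ≤-refl

    -- With x k protected, the fire can only arrive from the end x 0.
    arrival-≥ : ∀ {k} → k ≤ L → ∀ {y m} → Walk (_≢ x k) r y m → Comp t p y → idx y < k → t + suc (idx y) ≤ m
    arrival-≥ k≤L (stop _) c _ = ⊥-elim (end c (near-source t))
    arrival-≥ {k} k≤L (_▹_,_ {y = y′} {k = m} w a ≢k) c <k with near? t y′
    ... | yes N with ends N c a
    ...   | inj₁ refl = subst (λ i → t + suc i ≤ suc m) (≡sym (idx-x z≤n))
              (≤-trans (≤-reflexive (+-comm t 1)) (≰⇒> λ sm≤t → end c (weaken sm≤t (forget (w ▹ a , ≢k)))))
    ...   | inj₂ refl = ⊥-elim (<⇒≱ <k (≤-trans k≤L (≤-reflexive (≡sym (idx-x ≤-refl)))))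
    arrival-≥ {k} k≤L (_▹_,_ {k = m} w a ≢k) c <k | no F with edges (comp-step c (Adj-sym a) F) c a
    ... | inj₁ eq = m≤n⇒m≤1+n (subst (λ i → t + suc i ≤ m) eq
            (arrival-≥ k≤L w (comp-step c (Adj-sym a) F) (subst (_< k) (≡sym eq) <k)))
    ... | inj₂ (i , i< , inj₁ (refl , refl)) = subst (λ i → t + suc i ≤ suc m) (≡sym (idx-x i<))
            (≤-trans (≤-reflexive (+-suc t (suc i))) (s≤s (subst (λ i → t + suc i ≤ m) (idx-x (<⇒≤ i<))
              (arrival-≥ k≤L w (comp-step c (Adj-sym a) F)
                (≤-<-trans (≤-reflexive (idx-x (<⇒≤ i<))) (<⇒≤ (subst (_< k) (idx-x i<) <k)))))))
    ... | inj₂ (i , i< , inj₂ (refl , refl)) with m≤n⇒m<n∨m≡n (subst (_< k) (idx-x (<⇒≤ i<)) <k)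
    ...   | inj₂ refl = ⊥-elim (end w refl)
    ...   | inj₁ si<k = m≤n⇒m≤1+n (≤-trans (+-monoʳ-≤ t (s≤s (≤-trans (≤-reflexive (idx-x (<⇒≤ i<)))
              (≤-trans (n≤1+n i) (≤-reflexive (≡sym (idx-x i<)))))))
              (arrival-≥ k≤L w (comp-step c (Adj-sym a) F) (subst (_< k) (≡sym (idx-x i<)) si<k)))

    arrival-≤ : ∀ {q i} → i ≤ L → Far t q → (∀ {l} → l ≤ i → x l ≢ q) → Ball q (suc i + t) (x i)
    arrival-≤ {q} {i} i≤L F ≢q =
      subst₂ (λ v m → Walk (_≢ q) r v m) (cong x (+-identityʳ i)) (+-suc i t)
        ((mapW (λ { N refl → F N }) (visited (proj₁ (proj₂ left))) ▹ proj₂ (proj₂ left) , ≢q z≤n)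
         ⊕ spine-walk x L x-adj i 0 (subst (_≤ L) (≡sym (+-identityʳ i)) i≤L)
             (λ l _ l≤ → ≢q (subst (l ≤_) (+-identityʳ i) l≤)))

    -- A class is entered and left only through its spine vertex, so the part of the walk after its
    -- last visit to x i stays in the class.
    class-walk : ∀ {i y m} → i ≤ L → Walk (Comp t p) (x i) y m → idx y ≡ i →
      ∃[ k ] Walk (λ w → Comp t p w × idx w ≡ i) (x i) y k
    class-walk i≤ (stop c) eq = 0 , stop (c , eq)
    class-walk i≤ (w ▹ a , c) eq with edges (end w) c a
    ... | inj₁ e = _ , proj₂ (class-walk i≤ w (trans e eq)) ▹ a , (c , eq)
    ... | inj₂ (l , l< , inj₁ (_ , refl)) with trans (≡sym (idx-x l<)) eq
    ...   | refl = 0 , stop (c , eq)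
    class-walk i≤ (w ▹ a , c) eq | inj₂ (l , l< , inj₂ (_ , refl)) with trans (≡sym (idx-x (<⇒≤ l<))) eq
    ...   | refl = 0 , stop (c , eq)

  -- p lies in a class on one side of that of y, so the fire comes along the spine from the other
  -- side. Which side is unknown, hence the maximum of the two distances. From the spine vertex it
  -- fills the class in at most as many rounds as the class has vertices, and these are counted by
  -- the weight.
  late-bound : ∀ {t p} (σ : Spine t p) → Reachable p → let open Spine σ in
    ∀ {T y} → Late t p T y → idx y ≢ idx p →
    T < suc (idx y ⊔ (L ∸ idx y)) + t + weight (x (idx y))
  late-bound {t} {p} σ R {T} {y} (c , ¬B) ne = ≰⇒> λ le → ¬B (weaken le
      (weaken (≤-reflexive (+-comm (weight (x i)) _)) (arrive ⊕ within)))
    where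
    open Spine σ
    open OnSpine σ
    i = idx y
    i≤ : i ≤ L
    i≤ = idx≤ c
    arrive : Ball p (suc (i ⊔ (L ∸ i)) + t) (x i)
    arrive with <-cmp i (idx p)
    ... | tri≈ _ eq _ = contradiction eq ne
    ... | tri< lt _ _ = weaken (s≤s (+-monoˡ-≤ t (m≤m⊔n i (L ∸ i))))
      (arrival-≤ i≤ (start c) λ l≤ eq → <⇒≱ lt (subst (_≤ i) (trans (≡sym (idx-x (≤-trans l≤ i≤))) (cong idx eq)) l≤))
    ... | tri> _ _ gt = weaken (s≤s (+-monoˡ-≤ t (m≤n⊔m i (L ∸ i))))
      (subst (λ m → Ball p (suc (L ∸ i) + t) (x m)) (m∸[m∸n]≡n i≤)
        (OnSpine.arrival-≤ (reverse-spine σ) (m∸n≤m L i) (start c) λ {l} l≤ eq →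
          <⇒≱ gt (≤-trans (≤-reflexive (≡sym (m∸[m∸n]≡n i≤)))
            (≤-trans (∸-monoʳ-≤ L l≤) (≤-reflexive (trans (≡sym (idx-x (m∸n≤m L l))) (cong idx eq)))))))
    within : Walk (_≢ p) (x i) y (weight (x i))
    within = mapW (λ (_ , eq) v≡p → ne (trans (≡sym eq) (cong idx v≡p)))
      (shorten (subset (cut? (x i) (x i)))
        (λ { {v} (cv , eq) → ∈-subset⁺ (cut? (x i) (x i)) (subst (λ m → Cut (x m) (x m) v) eq (class-cut R cv)) })
        (proj₂ (class-walk i≤ (mapW (λ w → comp-trans (x-comp i≤) (shortenₙ w))
          (visited (comp-trans (comp-sym (x-comp i≤)) c))) refl)))

-- One phase of the algorithm

module Phase {n : ℕ} (G : Graph n) (r : Fin n) (s : ℕ) where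
  open Walks G
  open Regions G r
  open SpineFire G r

  ≤∸ : ∀ a {b c} → a + b ≤ c → b ≤ c ∸ a
  ≤∸ a {b} le = m+n≤o⇒m≤o∸n b (≤-trans (≤-reflexive (+-comm b a)) le)

  -- A gain g above s ≈ √n/15 is enough on its own, since nobody saves more than n vertices.
  Bound : ℕ → ℕ → ℕ → Set
  Bound c m g = s < g ⊎ m ≤ c * (s * g)

  Live : ℕ → Subset n → V → Set
  Live t dead v = Reachable v × Far t v × v ∉ dead

  live? : ∀ t dead v → Dec (Live t dead v)
  live? t dead v = near? n v ×-dec ¬? (near? t v) ×-dec ¬? (v ∈? dead)

  -- Outside the ball the dead set is a union of components. This survives the growth of the ball,
  -- as it only cuts components into smaller ones.
  Closed : ℕ → Subset n → Set
  Closed t dead = ∀ {x y} → Adj G x y → Far t x → Far t y → x ∈ dead → y ∈ dead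

  closed-comp : ∀ {t dead p y k} → Closed t dead → Walk (Far t) p y k → y ∈ dead → p ∈ dead
  closed-comp cl (stop _) y∈ = y∈
  closed-comp cl (w ▹ a , f) y∈ = closed-comp cl w (cl (Adj-sym a) f (end w) y∈)

  live-comp : ∀ {t dead p y} → Closed t dead → Live t dead p → Comp t p y → Live t dead y
  live-comp cl (R , F , ∉) c = comp-reachable R c , end c , λ y∈ → ∉ (closed-comp cl c y∈)

  lateSet : ℕ → V → ℕ → Subset n
  lateSet t p T = subset (late? t p T)

  cutSet : V → V → Subset n
  cutSet z q = subset (cut? z q)

  -- Protecting z in round t and q in round T saves enough to pay for whatever
  -- a single vertex p, protected in round t, can keep unburnt until round T.
  Answer : ℕ → Subset n → V → ℕ → V → Set
  Answer t dead z T q = Comp t z q × ¬ Ball z T q ×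
    (∀ p → Live t dead p → Bound 13 ∣ lateSet t p T ∣ ∣ cutSet z q ∣)

  -- T ranges over `Fin (suc n)` to make the property decidable. Round n is late enough, since
  -- everything that ever burns burns by then.
  Good : ℕ → Subset n → V → Set
  Good t dead z = ∀ (T : Fin (suc n)) → t ≤ toℕ T → ∃ (Answer t dead z (toℕ T))

  bound? : ∀ c m g → Dec (Bound c m g)
  bound? c m g = (s <? g) ⊎-dec (m ≤? c * (s * g))

  good? : ∀ t dead z → Dec (Good t dead z)
  good? t dead z = all? λ T → (t ≤? toℕ T) →-dec any? λ q →
    comp? t z q ×-dec ¬? (ball? z (toℕ T) q) ×-dec all? λ p → live? t dead p →-dec bound? 13 _ _

  argmax≤ : ∀ (f : ℕ → ℕ) L → ∃[ k ] k ≤ L × (∀ {i} → i ≤ L → f i ≤ f k)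
  argmax≤ f zero = 0 , z≤n , λ { z≤n → ≤-refl }
  argmax≤ f (suc L) with argmax≤ f L
  ... | k , k≤ , best with ≤-total (f k) (f (suc L))
  ... | inj₁ le = suc L , ≤-refl , λ i≤ → case m≤n⇒m<n∨m≡n i≤ of λ
    { (inj₁ (s≤s i≤L)) → ≤-trans (best i≤L) le ; (inj₂ refl) → ≤-refl }
  ... | inj₂ ge = k , m≤n⇒m≤1+n k≤ , λ i≤ → case m≤n⇒m<n∨m≡n i≤ of λ
    { (inj₁ (s≤s i≤L)) → best i≤L ; (inj₂ refl) → ge }

  -- The latest arrival of the fire at x k, plus twice the weight of x k. The
  -- factor 2 makes a maximiser beat all late vertices of any component.
  potential : ∀ {t p} → Spine t p → ℕ → ℕ
  potential σ k = suc (k ⊔ (L ∸ k)) + 2 * weight (x k) where open Spine σ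

  module Gain {t p} (σ : Spine t p) (R : Reachable p) where
    open Spine σ
    open OnSpine σ

    x-≢ : ∀ {i j} → i < j → j ≤ L → x i ≢ x j
    x-≢ i<j j≤ eq = <⇒≢ i<j (trans (≡sym (idx-x (≤-trans (<⇒≤ i<j) j≤))) (trans (cong idx eq) (idx-x j≤)))

    weight-positive : ∀ {k} → k ≤ L → 1 ≤ weight (x k)
    weight-positive {k} k≤ = length≤∣q∣ (x k ∷ []) ([] ∷ []) (∈-subset⁺ (cut? (x k) (x k))
      (interval-cut R ≤-refl k≤ (x-comp k≤) (≤-reflexive (≡sym (idx-x k≤))) (≤-reflexive (idx-x k≤))) ∷ [])

    cut-mono : ∀ {z q v} → Cut z z v → Cut z q v
    cut-mono (R , ¬w) = R , λ w → ¬w (mapW (λ (≢z , _) → ≢z , ≢z) w)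

    -- The spine vertices x j, ..., x (k - 1) come on top of the weight: with x k alone protected,
    -- the fire still reaches them from the end x 0.
    interval-gain : ∀ {j k} → j ≤ k → k ≤ L → (k ∸ j) + weight (x k) ≤ ∣ cutSet (x k) (x j) ∣
    interval-gain {j} {k} j≤k k≤L = subst (λ m → m + weight (x k) ≤ ∣ cutSet (x k) (x j) ∣) (length-applyUpTo seg (k ∸ j))
      (length+∣p∣≤∣q∣ (applyUpTo seg (k ∸ j))
        (applyUpTo⁺₁ seg (k ∸ j) λ i<i′ i′< → x-≢ (+-monoʳ-< j i<i′) (≤-trans (<⇒≤ (bound i′<)) k≤L))
        (λ v∈ → ∈-subset⁺ (cut? (x k) (x j)) (cut-mono (∈-subset⁻ (cut? (x k) (x k)) v∈)))
        (All.applyUpTo⁺₁ seg (k ∸ j) λ i< → ∈-subset⁺ (cut? (x k) (x j))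
          (interval-cut R j≤k k≤L (x-comp (≤-trans (<⇒≤ (bound i<)) k≤L))
            (≤-trans (m≤m+n j _) (≤-reflexive (≡sym (idx-x (≤-trans (<⇒≤ (bound i<)) k≤L)))))
            (≤-trans (≤-reflexive (idx-x (≤-trans (<⇒≤ (bound i<)) k≤L))) (<⇒≤ (bound i<)))))
        (All.applyUpTo⁺₁ seg (k ∸ j) λ i< v∈ → proj₂ (∈-subset⁻ (cut? (x k) (x k)) v∈)
          (shortenₙ (mapW (λ ≢z → ≢z , ≢z)
            (arrival-≤ (≤-trans (<⇒≤ (bound i<)) k≤L) (end (x-comp k≤L)) λ l≤ → x-≢ (≤-<-trans l≤ (bound i<)) k≤L)))))
      where
      seg : ℕ → V
      seg i = x (j + i)
      bound : ∀ {i} → i < k ∸ j → j + i < k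
      bound {i} i< = subst (j + i <_) (m+[n∸m]≡n j≤k) (+-monoʳ-< j i<)

    -- By `arrival-≥` the fire reaches x i no earlier than round t + i + 1, so x (T - t) is still
    -- unburnt at time T and serves as q. If the fire may have reached x k already, q is x k itself
    -- and the gain is its weight.
    closing : ∀ {k A T} → k ≤ L → A ≤ suc k + 2 * weight (x k) → t ≤ T →
      ∃[ q ] Comp t (x k) q × ¬ Ball (x k) T q × A ∸ (T ∸ t) ≤ suc (2 * ∣ cutSet (x k) q ∣) × 1 ≤ ∣ cutSet (x k) q ∣
    closing {k} {A} {T} k≤ A≤ t≤T with T ∸ t <? k
    ... | yes T<k = x (T ∸ t) , comp-trans (comp-sym (x-comp k≤)) (x-comp j≤L) ,
          (λ w → <⇒≱ (subst (_< t + suc (T ∸ t)) (m+[n∸m]≡n t≤T) (+-monoʳ-< t (n<1+n (T ∸ t))))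
             (subst (λ i → t + suc i ≤ T) (idx-x j≤L)
               (arrival-≥ k≤ w (x-comp j≤L) (≤-<-trans (≤-reflexive (idx-x j≤L)) T<k)))) ,
          gain , ≤-trans (weight-positive k≤) (≤-trans (m≤n+m _ (k ∸ (T ∸ t))) (interval-gain (<⇒≤ T<k) k≤))
      where
      j≤L : T ∸ t ≤ L
      j≤L = ≤-trans (<⇒≤ T<k) k≤
      gain : A ∸ (T ∸ t) ≤ suc (2 * ∣ cutSet (x k) (x (T ∸ t)) ∣)
      gain = begin
        A ∸ (T ∸ t)                                   ≤⟨ ∸-monoˡ-≤ (T ∸ t) A≤ ⟩
        suc k + 2 * weight (x k) ∸ (T ∸ t)            ≡⟨ +-∸-comm (2 * weight (x k)) (m≤n⇒m≤1+n (<⇒≤ T<k)) ⟩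
        (suc k ∸ (T ∸ t)) + 2 * weight (x k)          ≡⟨ cong (_+ 2 * weight (x k)) (+-∸-assoc 1 (<⇒≤ T<k)) ⟩
        suc (k ∸ (T ∸ t)) + 2 * weight (x k)          ≤⟨ s≤s (+-monoˡ-≤ (2 * weight (x k)) (m≤m+n (k ∸ (T ∸ t)) _)) ⟩
        suc (2 * (k ∸ (T ∸ t)) + 2 * weight (x k))    ≡⟨ cong suc (≡sym (*-distribˡ-+ 2 (k ∸ (T ∸ t)) (weight (x k)))) ⟩
        suc (2 * (k ∸ (T ∸ t) + weight (x k)))        ≤⟨ s≤s (*-monoʳ-≤ 2 (interval-gain (<⇒≤ T<k) k≤)) ⟩
        suc (2 * ∣ cutSet (x k) (x (T ∸ t)) ∣) ∎
        where open ≤-Reasoning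
    ... | no T≮k = x k , comp-refl (end (x-comp k≤)) , (λ w → end w refl) ,
          (begin
            A ∸ (T ∸ t)                         ≤⟨ ∸-mono A≤ (≮⇒≥ T≮k) ⟩
            suc k + 2 * weight (x k) ∸ k        ≡⟨ cong (_∸ k) (≡sym (+-suc k (2 * weight (x k)))) ⟩
            k + suc (2 * weight (x k)) ∸ k      ≡⟨ m+n∸m≡n k (suc (2 * weight (x k))) ⟩
            suc (2 * weight (x k)) ∎) , weight-positive k≤
      where open ≤-Reasoning

    -- Put v = A - (T - t). A late class other than that of p has a latest arrival less than 2v
    -- below A, and each latest arrival belongs to at most two indices, one counted from each end.
    -- With the class of p these are 1 + 4v classes of at most s vertices.
    late-count : ∀ {A T} → (∀ {i} → i ≤ L → weight (x i) ≤ s) → (∀ {i} → i ≤ L → potential σ i ≤ A) → t ≤ T →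
      ∣ lateSet t p T ∣ ≤ suc (4 * (A ∸ (T ∸ t))) * s
    late-count {A} {T} light top t≤T = subst (λ m → ∣ lateSet t p T ∣ ≤ m * s) count
        (union-bound class is class-bound (lateSet t p T) λ y∈ → covered (∈-subset⁻ (late? t p T) y∈))
      where
      v = A ∸ (T ∸ t)
      in-class? : ∀ i y → Dec (Comp t p y × idx y ≡ i)
      in-class? i y = comp? t p y ×-dec (idx y ≟ℕ i)
      class : ℕ → Subset n
      class i = subset (in-class? i)
      class-bound : ∀ i → ∣ class i ∣ ≤ s
      class-bound i with i ≤? L
      ... | yes i≤ = ≤-trans (p⊆q⇒∣p∣≤∣q∣ λ {y} y∈ → let c , eq = ∈-subset⁻ (in-class? i) y∈ in
              ∈-subset⁺ (cut? (x i) (x i)) (subst (λ m → Cut (x m) (x m) y) eq (class-cut R c))) (light i≤)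
      ... | no i≰ = ≤-trans (p⊆q⇒∣p∣≤∣q∣ {q = ⊥} λ y∈ → let c , eq = ∈-subset⁻ (in-class? i) y∈ in
              contradiction (subst (_≤ L) eq (idx≤ c)) i≰) (≤-trans (≤-reflexive (∣⊥∣≡0 n)) z≤n)
      -- d is the deficit A - (1 + top) of the latest arrival; the two functions recover from it the
      -- index as top or as L - top.
      near-end far-end : ℕ → ℕ
      near-end d = pred (A ∸ d)
      far-end d = L ∸ pred (A ∸ d)
      is : List ℕ
      is = idx p ∷ (map near-end (upTo (2 * v)) ++ map far-end (upTo (2 * v)))
      count : length is ≡ suc (4 * v)
      count = cong suc (trans (length-++ (map near-end (upTo (2 * v))))
        (trans (cong₂ _+_ (trans (length-map near-end (upTo (2 * v))) (length-upTo (2 * v)))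
                          (trans (length-map far-end (upTo (2 * v))) (length-upTo (2 * v)))) (solve-2v v)))
        where
        solve-2v : ∀ v → 2 * v + 2 * v ≡ 4 * v
        solve-2v = solve-∀
      indexed : ∀ {y} → Comp t p y → idx y ∈ˡ is → Any (λ i → y ∈ class i) is
      indexed {y} c i∈ = lose i∈ (∈-subset⁺ (in-class? (idx y)) (c , refl))
      covered : ∀ {y} → Late t p T y → Any (λ i → y ∈ class i) is
      covered {y} l@(c , _) with idx y ≟ℕ idx p
      ... | yes eq = here (∈-subset⁺ (in-class? (idx p)) (c , eq))
      ... | no ne = indexed c (there (position (⊔-sel i (L ∸ i))))
        where
        i = idx y
        top-i = i ⊔ (L ∸ i)
        w = weight (x i)
        pot : suc top-i + 2 * w ≤ A
        pot = top (idx≤ c)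
        m<A : suc top-i ≤ A
        m<A = ≤-trans (m≤m+n (suc top-i) _) pot
        mw≤A : suc top-i + w ≤ A
        mw≤A = ≤-trans (+-monoʳ-≤ (suc top-i) (m≤m+n w _)) pot
        T< : T ∸ t < suc top-i + w
        T< = +-cancelˡ-< t _ _ (begin-strict
          t + (T ∸ t)        ≡⟨ m+[n∸m]≡n t≤T ⟩
          T                  <⟨ late-bound σ R l ne ⟩
          suc top-i + t + w      ≡⟨ rearrange (suc top-i) t w ⟩
          t + (suc top-i + w) ∎)
          where
          open ≤-Reasoning
          rearrange : ∀ a b c → a + b + c ≡ b + (a + c)
          rearrange = solve-∀
        -- Here the factor 2 of the potential is used: one copy of w accounts for the time spent
        -- inside the class, the other bounds w by the remaining deficit.
        rest : w ≤ A ∸ (suc top-i + w)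
        rest = ≤∸ (suc top-i + w) (≤-trans (≤-reflexive (double (suc top-i) w)) pot)
          where
          double : ∀ a w → a + w + w ≡ a + 2 * w
          double = solve-∀
        d< : A ∸ suc top-i < 2 * v
        d< = begin-strict
          A ∸ suc top-i                                     ≡⟨ ≡sym (m∸n+n≡m w≤) ⟩
          A ∸ suc top-i ∸ w + w                             ≡⟨ cong (_+ w) (∸-+-assoc A (suc top-i) w) ⟩
          A ∸ (suc top-i + w) + w                           ≤⟨ +-monoʳ-≤ _ rest ⟩
          A ∸ (suc top-i + w) + (A ∸ (suc top-i + w))           <⟨ +-mono-< less-v less-v ⟩
          v + v                                         ≡⟨ cong (v +_) (≡sym (+-identityʳ v)) ⟩
          2 * v ∎
          where
          open ≤-Reasoning
          w≤ : w ≤ A ∸ suc top-i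
          w≤ = ≤∸ (suc top-i) mw≤A
          less-v : A ∸ (suc top-i + w) < v
          less-v = ∸-monoʳ-< T< mw≤A
        recover : pred (A ∸ (A ∸ suc top-i)) ≡ top-i
        recover = cong pred (m∸[m∸n]≡n m<A)
        position : top-i ≡ i ⊎ top-i ≡ L ∸ i → i ∈ˡ (map near-end (upTo (2 * v)) ++ map far-end (upTo (2 * v)))
        position (inj₁ eq) = ∈-++⁺ˡ (subst (_∈ˡ map near-end (upTo (2 * v))) (trans recover eq) (∈-map⁺ near-end (∈-upTo⁺ d<)))
        position (inj₂ eq) = ∈-++⁺ʳ (map near-end (upTo (2 * v)))
          (subst (_∈ˡ map far-end (upTo (2 * v))) (trans (cong (L ∸_) (trans recover eq)) (m∸[m∸n]≡n (idx≤ c))) (∈-map⁺ far-end (∈-upTo⁺ d<)))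

  -- 13 = 5 + 8: from 1 + 4(1 + 2g) = 5 + 8g, where the 5 is absorbed by g ≥ 1.
  phase-bound : ∀ {m v g} → m ≤ suc (4 * v) * s → v ≤ suc (2 * g) → 1 ≤ g → m ≤ 13 * (s * g)
  phase-bound {m} {v} {g} m≤ v≤ 1≤g = begin
    m                            ≤⟨ m≤ ⟩
    suc (4 * v) * s              ≤⟨ *-monoˡ-≤ s (s≤s (*-monoʳ-≤ 4 v≤)) ⟩
    suc (4 * suc (2 * g)) * s    ≡⟨ expand g s ⟩
    (5 * 1 + 8 * g) * s          ≤⟨ *-monoˡ-≤ s (+-monoˡ-≤ (8 * g) (*-monoʳ-≤ 5 1≤g)) ⟩
    (5 * g + 8 * g) * s          ≡⟨ collect g s ⟩
    13 * (s * g) ∎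
    where
    open ≤-Reasoning
    expand : ∀ g s → suc (4 * suc (2 * g)) * s ≡ (5 * 1 + 8 * g) * s
    expand = solve-∀
    collect : ∀ g s → (5 * g + 8 * g) * s ≡ 13 * (s * g)
    collect = solve-∀

  record Peak (t : ℕ) (v : V) : Set where
    field
      σ : Spine t v
    open Spine σ public
    field
      k : ℕ
      k≤L : k ≤ L
      highest : ∀ {i} → i ≤ L → potential σ i ≤ potential σ k
    height : ℕ
    height = potential σ k

  peak : Cactus G → ∀ {t v} → Reachable v → Far t v → Peak t v
  peak cactus R F = let k , k≤ , best = argmax≤ (potential σ) (Spine.L σ) in
    record { σ = σ ; k = k ; k≤L = k≤ ; highest = best }
    where σ = spine cactus R F

  module Choose {t dead} (cl : Closed t dead) (P : ∀ v → Live t dead v → Peak t v)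
      (light : ∀ {v} → Live t dead v → weight v ≤ s) where

    Highest : ℕ → Set
    Highest A = ∀ y → Live t dead y → Σ (Live t dead y) λ l → Peak.height (P y l) ≤ A

    good : ∀ {u} → Live t dead u → (τ : Spine t u) → ∀ {k A} → k ≤ Spine.L τ →
      A ≤ suc k + 2 * weight (Spine.x τ k) → Highest A → ∃[ z ] Live t dead z × Good t dead z
    good lu τ {k} {A} k≤ A≤ top = Spine.x τ k , live-comp cl lu (Spine.x-comp τ k≤) , answer
      where
      answer : Good t dead (Spine.x τ k)
      answer T t≤T with Gain.closing τ (proj₁ lu) k≤ A≤ t≤T
      ... | q , c , ¬B , v≤ , 1≤ = q , c , ¬B , λ p lp → inj₂ (pay p lp)
        where
        pay : ∀ p → Live t dead p → ∣ lateSet t p (toℕ T) ∣ ≤ 13 * (s * ∣ cutSet (Spine.x τ k) q ∣)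
        pay p lp with top p lp
        ... | l , le = phase-bound (Gain.late-count (Peak.σ (P p l)) (proj₁ l)
            (λ i≤ → light (live-comp cl l (Peak.x-comp (P p l) i≤)))
            (λ i≤ → ≤-trans (Peak.highest (P p l) i≤) le) t≤T) v≤ 1≤

    -- The height contains the larger of the distances to the two ends. After reversing the spine if
    -- necessary, this is the distance k to `x 0`, as `Gain.closing` expects.
    from-peak : ∀ {u} → Live t dead u → (τ : Peak t u) → Highest (Peak.height τ) →
      ∃[ z ] Live t dead z × Good t dead z
    from-peak lu τ top with ⊔-sel (Peak.k τ) (Peak.L τ ∸ Peak.k τ)
    ... | inj₁ eq = good lu (Peak.σ τ) (Peak.k≤L τ) (≤-reflexive
            (cong (λ h → suc h + 2 * weight (Peak.x τ (Peak.k τ))) eq)) top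
    ... | inj₂ eq = good lu (reverse-spine (Peak.σ τ)) (m∸n≤m (Peak.L τ) (Peak.k τ)) (≤-reflexive
            (cong₂ (λ h j → suc h + 2 * weight (Peak.x τ j)) eq (≡sym (m∸[m∸n]≡n (Peak.k≤L τ))))) top

    choose : ∃ (Live t dead) → ∃[ z ] Live t dead z × Good t dead z
    choose lp with argmax (live? t dead) (λ v l → Peak.height (P v l)) lp
    ... | u , lu , top = from-peak lu (P u lu) top

  phase : Cactus G → ∀ {t dead} → Closed t dead → ∃ (Live t dead) → ∃[ z ] Live t dead z × Good t dead z
  phase cactus {t} {dead} cl lp with any? (λ v → live? t dead v ×-dec (s <? weight v))
  -- A heavy vertex is its own partner: it alone gains more than s, whatever T is.
  ... | yes (z , lz , heavy) = z , lz , λ T t≤T → z , comp-refl (proj₁ (proj₂ lz)) , (λ w → end w refl) ,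
        λ p _ → inj₁ heavy
  ... | no light = Choose.choose cl (λ v (R , F , _) → peak cactus R F)
        (λ l → ≮⇒≥ λ heavy → light (_ , l , heavy)) lp

-- The algorithm

-- root n is √n/15, rounded down.
root : ∀ n → ∃[ s ] 225 * (s * s) ≤ n × n < 225 * (suc s * suc s)
root zero = 0 , z≤n , s≤s z≤n
root (suc n) with root n
... | s , lo , hi with suc n <? 225 * (suc s * suc s)
... | yes lt = s , m≤n⇒m≤1+n lo , lt
... | no ≮ = suc s , ≮⇒≥ ≮ , ≤-<-trans hi (*-monoʳ-< 225 (*-mono-< (n<1+n (suc s)) (n<1+n (suc s))))

toSet : List (Fin n) → Subset n
toSet = foldr (λ v p → ⁅ v ⁆ ∪ p) ⊥

∈-toSet⁺ : ∀ {v} {vs : List (Fin n)} → v ∈ˡ vs → v ∈ toSet vs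
∈-toSet⁺ {vs = v ∷ vs} (here refl) = x∈p∪q⁺ (inj₁ (x∈⁅x⁆ v))
∈-toSet⁺ {vs = v ∷ vs} (there v∈) = x∈p∪q⁺ {p = ⁅ v ⁆} (inj₂ (∈-toSet⁺ v∈))

∈-toSet⁻ : ∀ {v} (vs : List (Fin n)) → v ∈ toSet vs → v ∈ˡ vs
∈-toSet⁻ [] v∈ = contradiction v∈ ∉⊥
∈-toSet⁻ (w ∷ vs) v∈ with x∈p∪q⁻ ⁅ w ⁆ _ v∈
... | inj₁ v∈w = here (x∈⁅y⁆⇒x≡y w v∈w)
... | inj₂ v∈vs = there (∈-toSet⁻ vs v∈vs)

∣toSet∣≤ : ∀ (vs : List (Fin n)) → ∣ toSet vs ∣ ≤ length vs
∣toSet∣≤ {n} [] = ≤-reflexive (∣⊥∣≡0 n)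
∣toSet∣≤ (v ∷ vs) = ≤-trans (∣p∪q∣≤∣p∣+∣q∣ ⁅ v ⁆ _) (+-mono-≤ (≤-reflexive (∣⁅x⁆∣≡1 v)) (∣toSet∣≤ vs))

module Algorithm {n : ℕ} (G : Graph n) (r : Fin n) where
  open Walks G
  open Regions G r
  open SpineFire G r

  s : ℕ
  s = proj₁ (root n)

  open Phase G r s

  compSet : ℕ → V → Subset n
  compSet t p = subset (comp? t p)

  -- In a pending state z was protected in round t₀ and waits for the partner q
  -- that the next firefighter will protect. Components in dead are never used again.
  data State : Set where
    idle : Subset n → State
    pending : (z : V) (t₀ : ℕ) (dead : Subset n) → Live t₀ dead z → Good t₀ dead z → State

  abstract
    search : ∀ t d → Dec (∃[ z ] Live t d z × Good t d z)
    search t d = any? λ z → live? t d z ×-dec good? t d z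

  unless-equal : V → V → List V
  unless-equal z q with q ≟ z
  ... | yes _ = []
  ... | no _ = q ∷ []

  -- One slot handles one firefighter. The test `t₀ ≤? t` supplies the proof that `g` asks for;
  -- after round n, where `Good` gives no answer, an open phase is left open.
  slot : ℕ → State → State × List V
  slot t (idle d) with search t d
  ... | yes (z , l , g) = pending z t d l g , z ∷ []
  ... | no _ = idle d , []
  slot t (pending z t₀ d l g) with t₀ ≤? t | t <? suc n
  ... | yes t₀≤t | yes t≤n = idle (d ∪ compSet t₀ z) ,
        unless-equal z (proj₁ (g (fromℕ< t≤n) (subst (t₀ ≤_) (≡sym (toℕ-fromℕ< t≤n)) t₀≤t)))
  ... | yes _ | no _ = pending z t₀ d l g , []
  ... | no _ | _ = pending z t₀ d l g , []

  slots : ℕ → ℕ → State → State × List V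
  slots t zero st = st , []
  slots t (suc F) st = proj₁ (slots t F (proj₁ (slot t st))) , proj₂ (slot t st) ++ proj₂ (slots t F (proj₁ (slot t st)))

  -- An online algorithm is a function of the revealed budgets and keeps no memory, so the state is
  -- replayed from the first round.
  decide : State → ℕ → ∀ {k} → Vec ℕ (suc k) → Subset n
  decide st i (F ∷ []) = toSet (proj₂ (slots i F st))
  decide st i (F ∷ h@(_ ∷ _)) = decide (proj₁ (slots i F st)) (suc i) h

  module Run (f : ℕ → ℕ) where

    states : ℕ → State
    states zero = idle ⊥
    states (suc t) = proj₁ (slots t (f t) (states t))

    placed : ℕ → List V
    placed t = proj₂ (slots t (f t) (states t))

    decide-placed : ∀ k i (g : Fin (suc k) → ℕ) → (∀ j → g j ≡ f (i + toℕ j)) →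
      decide (states i) i (tabulate g) ≡ toSet (placed (i + k))
    decide-placed zero i g eq rewrite eq zero | +-identityʳ i = refl
    decide-placed (suc k) i g eq rewrite +-suc i k =
      trans (cong (λ F → decide (proj₁ (slots i F (states i))) (suc i) (tabulate (λ j → g (suc j))))
              (trans (eq zero) (cong f (+-identityʳ i))))
        (decide-placed k (suc i) (λ j → g (suc j)) (λ j → trans (eq (suc j)) (cong f (+-suc i (toℕ j)))))

pairing : OnlineAlg
pairing n G r t h = decide (idle ⊥) 0 h where open Algorithm G r

-- Legality of the moves

module Validity {n : ℕ} (G : Graph n) (r : Fin n) (f : ℕ → ℕ) where
  open Walks G
  open Regions G r
  open Algorithm G r
  open Phase G r s
  open Run f

  S : Strategy n
  S = run pairing G r f

  open Fire G r S

  S-placed : ∀ t → S t ≡ toSet (placed t)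
  S-placed t = decide-placed t 0 (λ i → f (toℕ i)) (λ _ → refl)

  placed⇒S : ∀ {t v} → v ∈ˡ placed t → v ∈ S t
  placed⇒S {t} v∈ = subst (_ ∈_) (≡sym (S-placed t)) (∈-toSet⁺ v∈)

  S⇒placed : ∀ {t v} → v ∈ S t → v ∈ˡ placed t
  S⇒placed {t} v∈ = ∈-toSet⁻ (placed t) (subst (_ ∈_) (S-placed t) v∈)

  burning⇒near : ∀ t {v} → v ∈ burning G r S t → Near t v
  burning⇒near = burning⇒walk (λ _ _ → tt)

  closed-later : ∀ {t t′ d} → t ≤ t′ → Closed t d → Closed t′ d
  closed-later le cl a fx fy = cl a (far-anti le fx) (far-anti le fy)

  closed-∪ : ∀ {t d d′} → Closed t d → Closed t d′ → Closed t (d ∪ d′)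
  closed-∪ {d = d} {d′} cl cl′ a fx fy x∈ with x∈p∪q⁻ d d′ x∈
  ... | inj₁ x∈d = x∈p∪q⁺ (inj₁ (cl a fx fy x∈d))
  ... | inj₂ x∈d′ = x∈p∪q⁺ (inj₂ (cl′ a fx fy x∈d′))

  closed-compSet : ∀ {t₀ t p} → t₀ ≤ t → Closed t (compSet t₀ p)
  closed-compSet {t₀} {t} {p} le a fx fy x∈ =
    ∈-subset⁺ (comp? t₀ p) (comp-step (∈-subset⁻ (comp? t₀ p) x∈) a (far-anti le fy))

  -- `Pr` stands for the vertices protected so far, including those of earlier slots of the same
  -- round. They lie in the dead set, apart from the z of an open phase, so a live vertex is never
  -- protected.
  Inv : ℕ → State → (V → Set) → Set
  Inv t (idle d) Pr = Closed t d × (∀ {v} → Pr v → v ∈ d)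
  Inv t (pending z t₀ d l g) Pr = t₀ ≤ t × Closed t₀ d × (∀ {v} → Pr v → v ∈ d ⊎ v ≡ z) ×
    (∀ τ → z ∉ burning G r S τ)

  inv-mono : ∀ {t st Pr Pr′} → (∀ {v} → Pr′ v → Pr v) → Inv t st Pr → Inv t st Pr′
  inv-mono {st = idle d} h (cl , p) = cl , p ∘ h
  inv-mono {st = pending z t₀ d l g} h (le , cl , p , nb) = le , cl , p ∘ h , nb

  inv-suc : ∀ {t} st {Pr} → Inv t st Pr → Inv (suc t) st Pr
  inv-suc (idle d) (cl , p) = closed-later (n≤1+n _) cl , p
  inv-suc (pending z t₀ d l g) (le , rest) = m≤n⇒m≤1+n le , rest

  unless-equal⁻ : ∀ z q {v} → v ∈ˡ unless-equal z q → v ≡ q × q ≢ z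
  unless-equal⁻ z q v∈ with q ≟ z
  unless-equal⁻ z q (here eq) | no ne = eq , ne

  slot-valid : ∀ t st {Pr} → Inv t st Pr → (∀ {v} → v ∈ˡ proj₂ (slot t st) → v ∈ S t) →
    (∀ {v} → v ∈ˡ proj₂ (slot t st) → v ∉ burning G r S t × ¬ Pr v) ×
    Inv t (proj₁ (slot t st)) (λ v → Pr v ⊎ v ∈ˡ proj₂ (slot t st))
  slot-valid t (idle d) (cl , p) out with search t d
  ... | no _ = (λ ()) , cl , [ p , (λ ()) ]′
  ... | yes (z , l@(R , F , ∉) , g) = (λ { (here refl) → F ∘ burning⇒near t , ∉ ∘ p }) ,
        ≤-refl , cl , (λ { (inj₁ x) → inj₁ (p x) ; (inj₂ (here eq)) → inj₂ eq }) ,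
        never-burns {s = t} (placed⇒protected t (out (here refl))) (F ∘ burning⇒near t)
  slot-valid t (pending z t₀ d l g) inv@(le , cl , p , nb) out with t₀ ≤? t | t <? suc n
  ... | yes _ | no _ = (λ ()) , le , cl , [ p , (λ ()) ]′ , nb
  ... | no _ | _ = (λ ()) , le , cl , [ p , (λ ()) ]′ , nb
  ... | yes t₀≤t | yes t≤n = fresh , closed-∪ (closed-later le cl) (closed-compSet le) , covered
    where
    ans = g (fromℕ< t≤n) (subst (t₀ ≤_) (≡sym (toℕ-fromℕ< t≤n)) t₀≤t)
    q = proj₁ ans
    z-comp : Comp t₀ z z
    z-comp = comp-refl (proj₁ (proj₂ l))
    q-comp : Comp t₀ z q
    q-comp = proj₁ (proj₂ ans)
    fresh : ∀ {v} → v ∈ˡ unless-equal z q → v ∉ burning G r S t × ¬ _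
    fresh v∈ with unless-equal⁻ z q v∈
    -- z never burns, so the fire up to round t stays within `Ball z t`, which q avoids by the
    -- definition of an answer.
    ... | refl , q≢z = (λ b → proj₁ (proj₂ (proj₂ ans)) (subst (λ τ → Ball z τ q) (≡sym (toℕ-fromℕ< t≤n))
              (burning⇒walk (λ τ b eq → nb τ (subst (_∈ burning G r S τ) eq b)) t b))) ,
          λ pr → case p pr of λ
            { (inj₁ q∈d) → proj₂ (proj₂ l) (closed-comp cl q-comp q∈d) ; (inj₂ eq) → q≢z eq }
    covered : ∀ {v} → _ ⊎ v ∈ˡ unless-equal z q → v ∈ d ∪ compSet t₀ z
    covered (inj₁ pr) with p pr
    ... | inj₁ v∈d = x∈p∪q⁺ (inj₁ v∈d)
    ... | inj₂ refl = x∈p∪q⁺ (inj₂ (∈-subset⁺ (comp? t₀ z) z-comp))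
    covered (inj₂ v∈) with unless-equal⁻ z q v∈
    ... | refl , _ = x∈p∪q⁺ (inj₂ (∈-subset⁺ (comp? t₀ z) q-comp))

  slots-valid : ∀ t F st {Pr} → Inv t st Pr → (∀ {v} → v ∈ˡ proj₂ (slots t F st) → v ∈ S t) →
    (∀ {v} → v ∈ˡ proj₂ (slots t F st) → v ∉ burning G r S t × ¬ Pr v) ×
    Inv t (proj₁ (slots t F st)) (λ v → Pr v ⊎ v ∈ˡ proj₂ (slots t F st))
  slots-valid t zero st inv out = (λ ()) , inv-mono {st = st} (λ { (inj₁ p) → p }) inv
  slots-valid t (suc F) st {Pr} inv out with slot-valid t st inv (out ∘ ∈-++⁺ˡ)
  ... | fresh , inv′ with slots-valid t F (proj₁ (slot t st)) inv′ (out ∘ ∈-++⁺ʳ (proj₂ (slot t st)))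
  ... | fresh′ , inv″ = (λ v∈ → fresh″ (∈-++⁻ (proj₂ (slot t st)) v∈)) ,
        inv-mono {st = proj₁ (slots t F (proj₁ (slot t st)))} regroup inv″
    where
    fresh″ : ∀ {v} → v ∈ˡ proj₂ (slot t st) ⊎ v ∈ˡ _ → v ∉ burning G r S t × ¬ Pr v
    fresh″ (inj₁ v∈) = fresh v∈
    fresh″ (inj₂ v∈) = proj₁ (fresh′ v∈) , proj₂ (fresh′ v∈) ∘ inj₁
    regroup : ∀ {v} → Pr v ⊎ v ∈ˡ proj₂ (slots t (suc F) st) →
      (Pr v ⊎ v ∈ˡ proj₂ (slot t st)) ⊎ v ∈ˡ proj₂ (slots t F (proj₁ (slot t st)))
    regroup (inj₁ p) = inj₁ (inj₁ p)
    regroup (inj₂ v∈) with ∈-++⁻ (proj₂ (slot t st)) v∈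
    ... | inj₁ h = inj₁ (inj₂ h)
    ... | inj₂ h = inj₂ h

  slot-length : ∀ t st → length (proj₂ (slot t st)) ≤ 1
  slot-length t (idle d) with search t d
  ... | yes _ = ≤-refl
  ... | no _ = z≤n
  slot-length t (pending z t₀ d l g) with t₀ ≤? t | t <? suc n
  ... | yes _ | no _ = z≤n
  ... | no _ | _ = z≤n
  ... | yes a | yes b with proj₁ (g (fromℕ< b) (subst (t₀ ≤_) (≡sym (toℕ-fromℕ< b)) a)) ≟ z
  ... | yes _ = z≤n
  ... | no _ = ≤-refl

  slots-length : ∀ t F st → length (proj₂ (slots t F st)) ≤ F
  slots-length t zero st = z≤n
  slots-length t (suc F) st = ≤-trans (≤-reflexive (length-++ (proj₂ (slot t st))))
    (+-mono-≤ (slot-length t st) (slots-length t F (proj₁ (slot t st))))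

  invariant : ∀ t → Inv t (states t) (_∈ protected G r S t)
  invariant zero = (λ _ _ _ x∈ → contradiction x∈ ∉⊥) , (λ v∈ → contradiction v∈ ∉⊥)
  invariant (suc t) = inv-suc (states (suc t)) (inv-mono {st = states (suc t)} split
      (proj₂ (slots-valid t (f t) (states t) (invariant t) placed⇒S)))
    where
    split : ∀ {v} → v ∈ protected G r S (suc t) → v ∈ protected G r S t ⊎ v ∈ˡ placed t
    split v∈ with x∈p∪q⁻ (protected G r S t) (S t) v∈
    ... | inj₁ h = inj₁ h
    ... | inj₂ h = inj₂ (S⇒placed h)

  valid : Valid G r f S
  valid t = ≤-trans (≤-reflexive (cong ∣_∣ (S-placed t))) (≤-trans (∣toSet∣≤ (placed t)) (slots-length t (f t) (states t))) ,
    λ v v∈ → proj₁ (slots-valid t (f t) (states t) (invariant t) placed⇒S) (S⇒placed v∈)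

-- Comparison with an offline strategy

elements : Subset n → List (Fin n)
elements [] = []
elements (inside ∷ p) = zero ∷ map suc (elements p)
elements (outside ∷ p) = map suc (elements p)

length-elements : ∀ (p : Subset n) → length (elements p) ≡ ∣ p ∣
length-elements [] = refl
length-elements (inside ∷ p) = cong suc (trans (length-map suc (elements p)) (length-elements p))
length-elements (outside ∷ p) = trans (length-map suc (elements p)) (length-elements p)

∈-elements : ∀ {p : Subset n} {x} → x ∈ p → x ∈ˡ elements p
∈-elements {p = inside ∷ p} here = here refl
∈-elements {p = inside ∷ p} (there x∈) = there (∈-map⁺ suc (∈-elements x∈))
∈-elements {p = outside ∷ p} (there x∈) = ∈-map⁺ suc (∈-elements x∈)

module Charging {n : ℕ} (G : Graph n) (r : Fin n) (f : ℕ → ℕ) (cactus : Cactus G)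
    (O : Strategy n) (O-valid : Valid G r f O) (X : Subset n) (X-saved : SavedSet G r O X) where
  open Walks G
  open Regions G r
  open Algorithm G r
  open Phase G r s
  open Run f
  open Validity G r f
  private
    module FO = Fire G r O
    module FS = Fire G r S

  -- A vertex that O saves from the unhindered fire lies behind some firefighter
  -- p′, in the component of p′ outside the ball burnt by the unhindered fire.
  Culprit : ℕ → V → ℕ → V → Set
  Culprit T x t′ p′ = t′ < T × p′ ∈ O t′ × Far t′ p′ × Comp t′ p′ x

  culprit-later : ∀ {T T′ x t′ p′} → T ≤ T′ → Culprit T x t′ p′ → Culprit T′ x t′ p′
  culprit-later le (lt , rest) = ≤-trans lt le , rest

  -- By induction on the unhindered fire. The test `near? k x` singles out its first arrival at x;
  -- then x is still far at the time of the culprit and inherits that of its predecessor. If the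
  -- predecessor burns, x burns too or is protected and is its own culprit.
  near-trace : ∀ k {x} → Near k x → x ∈ burning G r O k ⊎ ∃[ t′ ] ∃[ p′ ] Culprit k x t′ p′
  near-trace k (stop _) = inj₁ (FO.r-burns k)
  near-trace (suc k) {x} (_▹_,_ {y = y} w a _) with near? k x
  ... | yes N with near-trace k N
  ...   | inj₁ b = inj₁ (FO.burning-suc k b)
  ...   | inj₂ (t′ , p′ , c) = inj₂ (t′ , p′ , culprit-later (n≤1+n k) c)
  near-trace (suc k) {x} (w ▹ a , _) | no F with near-trace k w
  ... | inj₂ (t′ , p′ , lt , p∈ , Fp , c) =
        inj₂ (t′ , p′ , m≤n⇒m≤1+n lt , p∈ , Fp , comp-step c a (far-anti (<⇒≤ lt) F))
  ... | inj₁ b with x ∈? protected G r O (suc k)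
  ...   | no ∉P = inj₁ (x∈p∪q⁺ (inj₂ (FO.spread⁺ ∉P b a)))
  ...   | yes ∈P with FO.protected⇒placed (suc k) ∈P
  ...     | t′ , s≤s t′≤k , x∈ = inj₂ (t′ , x , s≤s t′≤k , x∈ , far-anti t′≤k F , comp-refl (far-anti t′≤k F))

  saved-near : ∀ {T x} → x ∈ X → Near T x → ∃[ t′ ] ∃[ p′ ] Culprit T x t′ p′
  saved-near {T} {x} x∈ N with near-trace T N
  ... | inj₁ b = contradiction b (X-saved x x∈ T)
  ... | inj₂ c = c

  near⇒ball : ∀ {t₀ t p x} → t ≤ t₀ → Far t₀ p → Near t x → Ball p t x
  near⇒ball le F N = mapW (λ { N′ refl → F (weaken le N′) }) (visited N)

  module Quiet {t₀ T p} (F₀ : Far t₀ p) (quiet : ∀ {t′ v} → v ∈ O t′ → t′ < T → t′ ≤ t₀) where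

    -- The same for the fire hindered by p only. Up to time t₀ it agrees with the unhindered fire,
    -- because p is far at t₀; as all firefighters placed before T came by t₀, the culprits can
    -- again be stated with unhindered balls.
    ball-trace : ∀ k {x} → k ≤ T → Ball p k x →
      x ∈ burning G r O k ⊎ ∃[ t′ ] ∃[ p′ ] p′ ≢ p × t′ ≤ t₀ × Culprit k x t′ p′
    ball-trace k k≤T (stop _) = inj₁ (FO.r-burns k)
    ball-trace (suc k) {x} k≤T (_▹_,_ {y = y} w a x≢p) with ball? p k x
    ... | yes b with ball-trace k (<⇒≤ k≤T) b
    ...   | inj₁ b′ = inj₁ (FO.burning-suc k b′)
    ...   | inj₂ (t′ , p′ , ne , le , c) = inj₂ (t′ , p′ , ne , le , culprit-later (n≤1+n k) c)
    ball-trace (suc k) {x} k≤T (w ▹ a , x≢p) | no ¬b with ball-trace k (<⇒≤ k≤T) w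
    ... | inj₂ (t′ , p′ , ne , le , lt , p∈ , Fp , c) =
          inj₂ (t′ , p′ , ne , le , m≤n⇒m≤1+n lt , p∈ , Fp , comp-step c a
            (λ N → ¬b (weaken (<⇒≤ lt) (near⇒ball le F₀ N))))
    ... | inj₁ b with x ∈? protected G r O (suc k)
    ...   | no ∉P = inj₁ (x∈p∪q⁺ (inj₂ (FO.spread⁺ ∉P b a)))
    ...   | yes ∈P with FO.protected⇒placed (suc k) ∈P
    ...     | t′ , s≤s t′≤k , x∈ = inj₂ (t′ , x , x≢p , le , s≤s t′≤k , x∈ , Fx , comp-refl Fx)
      where
      le : t′ ≤ t₀
      le = quiet x∈ (≤-trans (s≤s t′≤k) k≤T)
      Fx : Far t′ x
      Fx N = ¬b (weaken t′≤k (near⇒ball le F₀ N))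

    saved-ball : ∀ {x} → x ∈ X → Ball p T x → ∃[ t′ ] ∃[ p′ ] p′ ≢ p × t′ ≤ t₀ × Culprit T x t′ p′
    saved-ball {x} x∈ b with ball-trace T ≤-refl b
    ... | inj₁ b′ = contradiction b′ (X-saved x x∈ T)
    ... | inj₂ c = c

  Move : Set
  Move = Maybe V

  chargeable? : ∀ t p → Dec (Reachable p × Far t p)
  chargeable? t p = near? n p ×-dec ¬? (near? t p)

  -- Unreachable vertices are saved by every strategy and are accounted for separately in
  -- `competitive`; here they are charged to nobody.
  chargeSet : ℕ → Move → Subset n
  chargeSet t nothing = ⊥
  chargeSet t (just p) with chargeable? t p
  ... | yes _ = compSet t p
  ... | no _ = ⊥

  chargeSet⁻ : ∀ {t y} mv → y ∈ chargeSet t mv → ∃[ p ] mv ≡ just p × Reachable p × Far t p × Comp t p y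
  chargeSet⁻ nothing y∈ = contradiction y∈ ∉⊥
  chargeSet⁻ {t} (just p) y∈ with chargeable? t p
  ... | yes (R , F) = p , refl , R , F , ∈-subset⁻ (comp? t p) y∈
  ... | no _ = contradiction y∈ ∉⊥

  chargeSet⁺ : ∀ {t p y} → Reachable p → Far t p → Comp t p y → y ∈ chargeSet t (just p)
  chargeSet⁺ {t} {p} R F c with chargeable? t p
  ... | yes _ = ∈-subset⁺ (comp? t p) c
  ... | no ¬c = contradiction (R , F) ¬c

  closed-chargeSet : ∀ {t₀ t} mv → t₀ ≤ t → Closed t (chargeSet t₀ mv)
  closed-chargeSet nothing le a fx fy x∈ = contradiction x∈ ∉⊥
  closed-chargeSet {t₀} (just p) le with chargeable? t₀ p
  ... | yes _ = closed-compSet le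
  ... | no _ = λ a fx fy x∈ → contradiction x∈ ∉⊥

  closed-forward : ∀ {t d p y} → Closed t d → Comp t p y → p ∈ d → y ∈ d
  closed-forward cl c p∈ = closed-comp cl (comp-sym c) p∈

  -- The part of X in charged is paid for by secured; the components of all
  -- offline firefighters placed so far are charged.
  record Charged (t : ℕ) (d : Subset n) (Done : V → ℕ → Set) : Set where
    field
      charged secured : Subset n
      d-closed : Closed t d
      d⊆charged : d ⊆ charged
      charged-closed : Closed t charged
      done-charged : ∀ {p t′} → Done p t′ → Reachable p → Far t′ p → ∀ {y} → Comp t′ p y → y ∈ charged
      secured⊆d : secured ⊆ d
      secured-reachable : ∀ {v} → v ∈ secured → Reachable v
      secured-saved : SavedSet G r S secured
      paid : Bound 39 ∣ X ∩ charged ∣ ∣ secured ∣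

  NeverBurns : V → Set
  NeverBurns v = ∀ τ → v ∉ burning G r S τ

  placed-never-burns : ∀ {t v} → v ∈ S t → NeverBurns v
  placed-never-burns {t} {v} v∈ = FS.never-burns {s = t} (FS.placed⇒protected t v∈) (proj₁ (proj₂ (valid t) v v∈))

  _∪ᵐ_at_ : (V → ℕ → Set) → Move → ℕ → V → ℕ → Set
  (Done ∪ᵐ mv at t) p t′ = Done p t′ ⊎ (mv ≡ just p × t′ ≡ t)

  -- An open phase keeps the account as of its start t₀ and holds back the offline firefighter `mv`
  -- matched with z. All times in `Done` are at most t₀, since the next slot closes the phase; this
  -- is what `Quiet` relies on.
  Charge : ℕ → State → (V → ℕ → Set) → Set₁
  Charge t (idle d) Done = Lift _ (Charged t d Done)
  Charge t (pending z t₀ d l g) Done = t₀ ≤ t × NeverBurns z × Σ (V → ℕ → Set) λ Done₀ → Σ Move λ mv →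
    Charged t₀ d Done₀ × (∀ {p t′} → Done p t′ → (Done₀ ∪ᵐ mv at t₀) p t′) × (∀ {p t′} → Done p t′ → t′ ≤ t₀)

  -- Both z and q lie in the component of z. Any other reachable vertex is reached through the ball
  -- and, if far, then through its own component, so both are avoided.
  cut⊆comp : ∀ {t z q v} → Far t z → Comp t z q → Cut z q v → Comp t z v
  cut⊆comp {t} {z} {q} {v} F c (R , ¬w) with near? t v
  ... | yes N = ⊥-elim (¬w (shortenₙ (mapW (λ N′ → (λ { refl → F N′ }) , (λ { refl → end c N′ })) (visited N))))
  ... | no Fv with entry R Fv
  ...   | b , u , Nb , e , cu with comp? t z v
  ...     | yes cv = cv
  ...     | no ¬cv = ⊥-elim (¬w (shortenₙ
            ((mapW (λ N′ → (λ { refl → F N′ }) , (λ { refl → end c N′ })) (visited Nb) ▹ e , start av) ⊕ av)))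
    where
    av : Walk (Avoid z q) u v n
    av = mapW (λ w → (λ { refl → ¬cv (comp-trans (comp-sym w) cu) }) ,
                     (λ { refl → ¬cv (comp-trans c (comp-trans (comp-sym w) cu)) })) (visited cu)

  bound-weaken : ∀ {c m m′ g g′} → m′ ≤ m → g ≤ g′ → Bound c m g → Bound c m′ g′
  bound-weaken m≤ g≤ (inj₁ lt) = inj₁ (≤-trans lt g≤)
  bound-weaken {c} m≤ g≤ (inj₂ le) = inj₂ (≤-trans m≤ (≤-trans le (*-monoʳ-≤ c (*-monoʳ-≤ s g≤))))

  bound-+ : ∀ {a b₁ b₂ b₃ g h} → Bound 39 a g → Bound 13 b₁ h → Bound 13 b₂ h → Bound 13 b₃ h →
    Bound 39 (a + (b₁ + (b₂ + b₃))) (g + h)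
  bound-+ {g = g} {h} (inj₁ lt) _ _ _ = inj₁ (≤-trans lt (m≤m+n g h))
  bound-+ {g = g} {h} _ (inj₁ lt) _ _ = inj₁ (≤-trans lt (m≤n+m h g))
  bound-+ {g = g} {h} _ _ (inj₁ lt) _ = inj₁ (≤-trans lt (m≤n+m h g))
  bound-+ {g = g} {h} _ _ _ (inj₁ lt) = inj₁ (≤-trans lt (m≤n+m h g))
  bound-+ {g = g} {h} (inj₂ x) (inj₂ y₁) (inj₂ y₂) (inj₂ y₃) =
    inj₂ (≤-trans (+-mono-≤ x (+-mono-≤ y₁ (+-mono-≤ y₂ y₃))) (≤-reflexive (collect s g h)))
    where
    collect : ∀ s g h → 39 * (s * g) + (13 * (s * h) + (13 * (s * h) + 13 * (s * h))) ≡ 39 * (s * (g + h))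
    collect = solve-∀

  -- A phase z, q pays for three components: that of z itself and those of the two
  -- offline firefighters m₁, m₂ that became available together with z and q.
  module Close {z t₀ d} (l : Live t₀ d z) {Done₀ : V → ℕ → Set} (ch : Charged t₀ d Done₀)
      (m₁ m₂ : Move) {Done : V → ℕ → Set}
      (done : ∀ {p t′} → Done p t′ → (Done₀ ∪ᵐ m₁ at t₀) p t′) (early : ∀ {p t′} → Done p t′ → t′ ≤ t₀)
      {T q} (t₀≤T : t₀ ≤ T) (past : ∀ {p t′} → p ∈ O t′ → t′ < T → Done p t′)
      (ans : Answer t₀ d z T q) (z-nb : NeverBurns z) (q-nb : NeverBurns q) where
    open Charged ch

    Fz : Far t₀ z
    Fz = proj₁ (proj₂ l)

    culprit-charged : ∀ {x t′ p′} → Culprit T x t′ p′ → Reachable x → x ∈ charged ⊎ (m₁ ≡ just p′ × t′ ≡ t₀)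
    culprit-charged (lt , p∈ , F , c) R with done (past p∈ lt)
    ... | inj₁ D = inj₁ (done-charged D (comp-reachable R (comp-sym c)) F c)
    ... | inj₂ e = inj₂ e

    Paid : Subset n → Set
    Paid M = Bound 13 ∣ M ∣ ∣ cutSet z q ∣

    paid-⊥ : Paid ⊥
    paid-⊥ = inj₂ (≤-trans (≤-reflexive (∣⊥∣≡0 n)) z≤n)

    first : ∃[ M ] Paid M × (∀ {x} → x ∈ X → x ∈ chargeSet t₀ m₁ → x ∉ charged → x ∈ M)
    first = go m₁ refl
      where
      go : ∀ mv → m₁ ≡ mv → ∃[ M ] Paid M × (∀ {x} → x ∈ X → x ∈ chargeSet t₀ mv → x ∉ charged → x ∈ M)
      go nothing _ = ⊥ , paid-⊥ , λ _ x∈ _ → x∈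
      go (just p) eq with live? t₀ d p
      ... | no ¬l = ⊥ , paid-⊥ , λ x∈X x∈ x∉ → case chargeSet⁻ (just p) x∈ of λ
              { (_ , refl , R , F , c) → ⊥-elim (¬l (R , F , λ p∈d → x∉ (closed-forward charged-closed c (d⊆charged p∈d)))) }
      ... | yes lp@(R , F , _) = lateSet t₀ p T , proj₂ (proj₂ ans) p lp , late
        where
        late : ∀ {x} → x ∈ X → x ∈ chargeSet t₀ (just p) → x ∉ charged → x ∈ lateSet t₀ p T
        late {x} x∈X x∈ x∉ with chargeSet⁻ (just p) x∈
        ... | _ , refl , _ , _ , c = ∈-subset⁺ (late? t₀ p T) (c , ¬ball)
          where
          -- If the fire hindered by p alone reached x by T, another offline firefighter would have
          -- to save x, and its component is charged already.
          ¬ball : ¬ Ball p T x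
          ¬ball b with Quiet.saved-ball F (λ v∈ lt → early (past v∈ lt)) x∈X b
          ... | t′ , p′ , ne , _ , cu with culprit-charged cu (comp-reachable R c)
          ... | inj₁ x∈C = x∉ x∈C
          ... | inj₂ (e , _) with trans (≡sym e) eq
          ... | refl = ne refl

    second : ∃[ M ] Paid M × (∀ {x} → x ∈ chargeSet T m₂ → x ∉ charged → x ∈ M)
    second = go m₂
      where
      go : ∀ mv → ∃[ M ] Paid M × (∀ {x} → x ∈ chargeSet T mv → x ∉ charged → x ∈ M)
      go nothing = ⊥ , paid-⊥ , λ x∈ _ → x∈
      go (just p) with live? t₀ d p
      ... | no ¬l = ⊥ , paid-⊥ , λ x∈ x∉ → case chargeSet⁻ (just p) x∈ of λ
              { (_ , refl , R , F , c) → ⊥-elim (¬l (R , far-anti t₀≤T F ,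
                  λ p∈d → x∉ (closed-forward charged-closed (comp-anti t₀≤T c) (d⊆charged p∈d)))) }
      -- m₂ is placed only at T, when its component is still outside the unhindered ball and a
      -- fortiori outside `Ball p T`.
      ... | yes lp = lateSet t₀ p T , proj₂ (proj₂ ans) p lp , λ x∈ _ → case chargeSet⁻ (just p) x∈ of λ
              { (_ , refl , _ , _ , c) → ∈-subset⁺ (late? t₀ p T) (comp-anti t₀≤T c , λ b → end c (forget b)) }

    charged′ secured′ : Subset n
    charged′ = charged ∪ (compSet t₀ z ∪ (chargeSet t₀ m₁ ∪ chargeSet T m₂))
    secured′ = secured ∪ cutSet z q

    split : ∀ {x} → x ∈ X ∩ charged′ →
      x ∈ X ∩ charged ⊎ x ∈ lateSet t₀ z T ∪ (proj₁ first ∪ proj₁ second)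
    split {x} x∈ with x∈p∩q⁻ X charged′ x∈
    ... | x∈X , x∈C′ with x ∈? charged
    ... | yes x∈C = inj₁ (x∈p∩q⁺ (x∈X , x∈C))
    ... | no x∉C with x ∈? chargeSet t₀ m₁
    ... | yes x∈₁ = inj₂ (x∈p∪q⁺ (inj₂ (x∈p∪q⁺ (inj₁ (proj₂ (proj₂ first) x∈X x∈₁ x∉C)))))
    ... | no x∉₁ with x∈p∪q⁻ charged _ x∈C′
    ... | inj₁ x∈C = contradiction x∈C x∉C
    ... | inj₂ x∈′ with x∈p∪q⁻ (compSet t₀ z) _ x∈′
    ... | inj₂ x∈″ with x∈p∪q⁻ (chargeSet t₀ m₁) _ x∈″
    ...   | inj₁ x∈₁ = contradiction x∈₁ x∉₁
    ...   | inj₂ x∈₂ = inj₂ (x∈p∪q⁺ (inj₂ (x∈p∪q⁺ (inj₂ (proj₂ (proj₂ second) x∈₂ x∉C)))))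
    split {x} x∈ | x∈X , _ | no x∉C | no x∉₁ | inj₂ _ | inj₁ x∈z =
        inj₂ (x∈p∪q⁺ (inj₁ (∈-subset⁺ (late? t₀ z T) (c , ¬ball))))
      where
      c : Comp t₀ z x
      c = ∈-subset⁻ (comp? t₀ z) x∈z
      R : Reachable x
      R = comp-reachable (proj₁ l) c
      -- Even the unhindered fire cannot have reached x by T: the culprit would be charged already
      -- or be m₁, whose component was excluded.
      ¬ball : ¬ Ball z T x
      ¬ball b with saved-near x∈X (forget b)
      ... | t′ , p′ , cu@(_ , _ , F , c′) with culprit-charged cu R
      ... | inj₁ x∈C = x∉C x∈C
      ... | inj₂ (e , refl) = x∉₁ (subst (λ mv → x ∈ chargeSet t₀ mv) (≡sym e)
              (chargeSet⁺ (comp-reachable R (comp-sym c′)) F c′))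

    z-paid : Paid (lateSet t₀ z T)
    z-paid = proj₂ (proj₂ ans) z l

    count : ∣ X ∩ charged′ ∣ ≤ ∣ X ∩ charged ∣ + (∣ lateSet t₀ z T ∣ + (∣ proj₁ first ∣ + ∣ proj₁ second ∣))
    count = ≤-trans (cover (X ∩ charged) (lateSet t₀ z T ∪ (proj₁ first ∪ proj₁ second)) split)
      (+-monoʳ-≤ ∣ X ∩ charged ∣ (≤-trans (∣p∪q∣≤∣p∣+∣q∣ (lateSet t₀ z T) _)
        (+-monoʳ-≤ ∣ lateSet t₀ z T ∣ (∣p∪q∣≤∣p∣+∣q∣ (proj₁ first) (proj₁ second)))))

    cut-comp : ∀ {v} → v ∈ cutSet z q → Comp t₀ z v
    cut-comp v∈ = cut⊆comp Fz (proj₁ ans) (∈-subset⁻ (cut? z q) v∈)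

    -- Earlier gains lie in the dead set, the new one in the component of the live vertex z.
    gain : ∣ secured ∣ + ∣ cutSet z q ∣ ≤ ∣ secured′ ∣
    gain = disjoint-∣∪∣ secured (cutSet z q) λ v∈ v∈′ →
      proj₂ (proj₂ l) (closed-comp d-closed (cut-comp v∈′) (secured⊆d v∈))

    closed-phase : Charged T (d ∪ compSet t₀ z) (Done ∪ᵐ m₂ at T)
    closed-phase = record
      { charged = charged′ ; secured = secured′
      ; d-closed = closed-∪ (closed-later t₀≤T d-closed) (closed-compSet t₀≤T)
      ; d⊆charged = λ x∈ → case x∈p∪q⁻ d (compSet t₀ z) x∈ of λ
          { (inj₁ h) → x∈p∪q⁺ (inj₁ (d⊆charged h)) ; (inj₂ h) → x∈p∪q⁺ (inj₂ (x∈p∪q⁺ (inj₁ h))) }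
      ; charged-closed = closed-∪ (closed-later t₀≤T charged-closed) (closed-∪ (closed-compSet t₀≤T)
          (closed-∪ (closed-chargeSet m₁ t₀≤T) (closed-chargeSet m₂ ≤-refl)))
      ; done-charged = dc
      ; secured⊆d = λ v∈ → case x∈p∪q⁻ secured (cutSet z q) v∈ of λ
          { (inj₁ h) → x∈p∪q⁺ (inj₁ (secured⊆d h))
          ; (inj₂ h) → x∈p∪q⁺ (inj₂ (∈-subset⁺ (comp? t₀ z) (cut-comp h))) }
      ; secured-reachable = λ v∈ → case x∈p∪q⁻ secured (cutSet z q) v∈ of λ
          { (inj₁ h) → secured-reachable h ; (inj₂ h) → proj₁ (∈-subset⁻ (cut? z q) h) }
      ; secured-saved = λ v v∈ τ b → case x∈p∪q⁻ secured (cutSet z q) v∈ of λ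
          { (inj₁ h) → secured-saved v h τ b
          ; (inj₂ h) → proj₂ (∈-subset⁻ (cut? z q) h) (shortenₙ (FS.burning⇒walk
              (λ τ b → (λ { refl → z-nb τ b }) , (λ { refl → q-nb τ b })) τ b)) }
      ; paid = bound-weaken {39} count gain (bound-+ paid z-paid (proj₁ (proj₂ first)) (proj₁ (proj₂ second))) }
      where
      dc : ∀ {p t′} → (Done ∪ᵐ m₂ at T) p t′ → Reachable p → Far t′ p → ∀ {y} → Comp t′ p y → y ∈ charged′
      dc (inj₁ D) R F c with done D
      ... | inj₁ D₀ = x∈p∪q⁺ (inj₁ (done-charged D₀ R F c))
      ... | inj₂ (refl , refl) = x∈p∪q⁺ (inj₂ (x∈p∪q⁺ (inj₂ (x∈p∪q⁺ (inj₁ (chargeSet⁺ R F c))))))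
      dc (inj₂ (refl , refl)) R F c = x∈p∪q⁺ (inj₂ (x∈p∪q⁺ (inj₂ (x∈p∪q⁺ (inj₂ (chargeSet⁺ R F c))))))

  charge-mono : ∀ {t st} {Done Done′ : V → ℕ → Set} → (∀ {p t′} → Done′ p t′ → Done p t′) →
    Charge t st Done → Charge t st Done′
  charge-mono {st = idle d} h (lift ch) = lift (record { Charged ch ; done-charged = λ D → Charged.done-charged ch (h D) })
  charge-mono {st = pending z t₀ d l g} h (le , nb , Done₀ , mv , ch , done , early) =
    le , nb , Done₀ , mv , ch , done ∘ h , early ∘ h

  charge-suc : ∀ {t} st {Done} → Charge t st Done → Charge (suc t) st Done
  charge-suc (idle d) (lift ch) = lift (record
    { Charged ch
    ; d-closed = closed-later (n≤1+n _) (Charged.d-closed ch)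
    ; charged-closed = closed-later (n≤1+n _) (Charged.charged-closed ch) })
  charge-suc (pending z t₀ d l g) (le , rest) = m≤n⇒m≤1+n le , rest

  unless-equal⁺ : ∀ z q → q ≡ z ⊎ q ∈ˡ unless-equal z q
  unless-equal⁺ z q with q ≟ z
  ... | yes eq = inj₁ eq
  ... | no _ = inj₂ (here refl)

  slot-charge : ∀ t st {Done} mv → t ≤ n → Charge t st Done → (∀ {p t′} → p ∈ O t′ → t′ < t → Done p t′) →
    (∀ {p t′} → Done p t′ → t′ ≤ t) → (∀ {v} → v ∈ˡ proj₂ (slot t st) → v ∈ S t) →
    Charge t (proj₁ (slot t st)) (Done ∪ᵐ mv at t)
  slot-charge t (idle d) {Done} mv t≤n (lift ch) past recent out with search t d
  ... | yes (z , l , g) = ≤-refl , placed-never-burns {t} (out (here refl)) , Done , mv , ch , id ,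
        λ { (inj₁ D) → recent D ; (inj₂ (_ , refl)) → ≤-refl }
  ... | no none = lift (record { Charged ch ; done-charged = dc })
    where
    open Charged ch
    dc : ∀ {p t′} → (Done ∪ᵐ mv at t) p t′ → Reachable p → Far t′ p → ∀ {y} → Comp t′ p y → y ∈ charged
    dc (inj₁ D) = done-charged D
    dc {p} (inj₂ (_ , refl)) R F c with p ∈? d
    ... | yes p∈ = closed-forward charged-closed c (d⊆charged p∈)
    -- A failed search means, by `phase`, that no live vertex exists; so the component of p is dead
    -- and charged.
    ... | no p∉ = ⊥-elim (none (phase cactus d-closed (p , R , F , p∉)))
  slot-charge t (pending z t₀ d l g) {Done} mv t≤n (t₀≤t , nb , Done₀ , m₁ , ch , done , early) past recent out
    with t₀ ≤? t | t <? suc n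
  ... | no ≰ | _ = contradiction t₀≤t ≰
  ... | yes _ | no ≮ = contradiction (s≤s t≤n) ≮
  ... | yes le | yes t< = lift (Close.closed-phase l ch m₁ mv {Done} done early t₀≤t past answer nb q-nb)
    where
    found : ∃ (Answer t₀ d z (toℕ (fromℕ< t<)))
    found = g (fromℕ< t<) (subst (t₀ ≤_) (≡sym (toℕ-fromℕ< t<)) le)
    q : V
    q = proj₁ found
    answer : Answer t₀ d z t q
    answer = subst (λ τ → Answer t₀ d z τ q) (toℕ-fromℕ< t<) (proj₂ found)
    q-nb : NeverBurns q
    q-nb = case unless-equal⁺ z q of λ
      { (inj₁ eq) → subst NeverBurns (≡sym eq) nb ; (inj₂ q∈) → placed-never-burns {t} (out q∈) }

  -- `ps` are the offline firefighters of the round, at most F, matched one by one with the slots; a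
  -- surplus slot is matched with `nothing`.
  slots-charge : ∀ t F st {Done} (ps : List V) → length ps ≤ F → t ≤ n → Charge t st Done →
    (∀ {p t′} → p ∈ O t′ → t′ < t → Done p t′) → (∀ {p t′} → Done p t′ → t′ ≤ t) →
    (∀ {v} → v ∈ˡ proj₂ (slots t F st) → v ∈ S t) →
    Charge t (proj₁ (slots t F st)) (λ p t′ → Done p t′ ⊎ (p ∈ˡ ps × t′ ≡ t))
  slots-charge t zero st [] le t≤n ch past recent out =
    charge-mono {st = st} (λ { (inj₁ D) → D ; (inj₂ (() , _)) }) ch
  slots-charge t (suc F) st {Done} ps le t≤n ch past recent out =
    charge-mono {st = proj₁ (slots t F (proj₁ (slot t st)))} (regroup ps)
      (slots-charge t F (proj₁ (slot t st)) (rest ps) (rest-length ps le) t≤n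
        (slot-charge t st (move ps) t≤n ch past recent (out ∘ ∈-++⁺ˡ))
        (λ p∈ lt → inj₁ (past p∈ lt)) (λ { (inj₁ D) → recent D ; (inj₂ (_ , refl)) → ≤-refl })
        (out ∘ ∈-++⁺ʳ (proj₂ (slot t st))))
    where
    move : List V → Move
    move [] = nothing
    move (p ∷ _) = just p
    rest : List V → List V
    rest [] = []
    rest (_ ∷ ps) = ps
    rest-length : ∀ ps → length ps ≤ suc F → length (rest ps) ≤ F
    rest-length [] _ = z≤n
    rest-length (_ ∷ _) (s≤s le) = le
    regroup : ∀ ps {p t′} → Done p t′ ⊎ (p ∈ˡ ps × t′ ≡ t) →
      (Done ∪ᵐ move ps at t) p t′ ⊎ (p ∈ˡ rest ps × t′ ≡ t)
    regroup ps (inj₁ D) = inj₁ (inj₁ D)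
    regroup (p ∷ ps) (inj₂ (here refl , eq)) = inj₁ (inj₂ (refl , eq))
    regroup (p ∷ ps) (inj₂ (there p∈ , eq)) = inj₂ (p∈ , eq)

  Before : ℕ → V → ℕ → Set
  Before t p t′ = p ∈ O t′ × t′ < t

  charges : ∀ t → t ≤ n → Charge t (states t) (Before t)
  charges zero _ = lift (record
    { charged = ⊥ ; secured = ⊥ ; d-closed = empty-closed ; d⊆charged = id ; charged-closed = empty-closed
    ; done-charged = λ { (_ , ()) } ; secured⊆d = id ; secured-reachable = λ v∈ → contradiction v∈ ∉⊥
    ; secured-saved = λ v v∈ → contradiction v∈ ∉⊥
    ; paid = inj₂ (≤-trans (∣p∩q∣≤∣q∣ X ⊥) (≤-trans (≤-reflexive (∣⊥∣≡0 n)) z≤n)) })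
    where
    empty-closed : Closed 0 ⊥
    empty-closed _ _ _ x∈ = contradiction x∈ ∉⊥
  charges (suc t) t<n = charge-suc (states (suc t)) (charge-mono {st = states (suc t)} advance
    (slots-charge t (f t) (states t) (elements (O t))
      (≤-trans (≤-reflexive (length-elements (O t))) (proj₁ (O-valid t))) (<⇒≤ t<n) (charges t (<⇒≤ t<n))
      _,_ (<⇒≤ ∘ proj₂) placed⇒S))
    where
    advance : ∀ {p t′} → Before (suc t) p t′ → Before t p t′ ⊎ (p ∈ˡ elements (O t) × t′ ≡ t)
    advance (p∈ , s≤s t′≤t) with m≤n⇒m<n∨m≡n t′≤t
    ... | inj₁ lt = inj₁ (p∈ , lt)
    ... | inj₂ refl = inj₂ (∈-elements p∈ , refl)

  final : ∃[ d ] Charged n d (Before n)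
  final = go (states n) (charges n ≤-refl)
    where
    go : ∀ st → Charge n st (Before n) → ∃[ d ] Charged n d (Before n)
    go (idle d) (lift ch) = d , ch
    -- A phase still open at time n closes without a second firefighter: the answer q for T = n is
    -- not reached within n rounds, hence never.
    go (pending z t₀ d l g) (t₀≤n , nb , Done₀ , m₁ , ch , done , early) =
      _ , record { Charged closed ; done-charged = Charged.done-charged closed ∘ inj₁ }
      where
      found : ∃ (Answer t₀ d z (toℕ (fromℕ n)))
      found = g (fromℕ n) (subst (t₀ ≤_) (≡sym (toℕ-fromℕ n)) t₀≤n)
      q : V
      q = proj₁ found
      answer : Answer t₀ d z n q
      answer = subst (λ τ → Answer t₀ d z τ q) (toℕ-fromℕ n) (proj₂ found)
      q-nb : NeverBurns q
      q-nb τ b = proj₁ (proj₂ answer)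
        (shortenₙ (FS.burning⇒walk (λ τ b eq → nb τ (subst (_∈ burning G r S τ) eq b)) τ b))
      closed : Charged n (d ∪ compSet t₀ z) (Before n ∪ᵐ nothing at n)
      closed = Close.closed-phase l ch m₁ nothing {Before n} done early t₀≤n _,_ answer nb q-nb

  saved : Subset n
  saved = subset (λ v → ¬? (v ∈? burning G r S n))

  -- The fire runs through vertices that are never protected. Such a walk can be shortened to length
  -- n and burns in that time.
  burnt-by-n : ∀ τ {v} → v ∈ burning G r S τ → v ∈ burning G r S n
  burnt-by-n τ b = FS.walk⇒burning ≤-refl (shortenₙ (mapW (λ h → h n) (FS.burning⇒walk unprotected τ b)))
    where
    unprotected : ∀ t {v} → v ∈ burning G r S t → ∀ τ → v ∉ protected G r S τ
    unprotected t v∈ τ v∈P with FS.protected⇒placed τ v∈P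
    ... | s′ , _ , v∈S = placed-never-burns {s′} v∈S t v∈

  saved-saved : SavedSet G r S saved
  saved-saved v v∈ τ b = ∈-subset⁻ (λ v → ¬? (v ∈? burning G r S n)) v∈ (burnt-by-n τ b)

  competitive : (∣ X ∣ ∸ ∣ saved ∣) ^ 2 ≤ 225 * n * ∣ saved ∣ ^ 2
  competitive = conclude (Charged.paid ch)
    where
    ch : Charged n (proj₁ final) (Before n)
    ch = proj₂ final
    open Charged ch
    unreachable? : ∀ v → Dec (¬ Reachable v)
    unreachable? v = ¬? (near? n v)
    U : Subset n
    U = subset unreachable?
    X-cover : ∀ {x} → x ∈ X → x ∈ X ∩ charged ⊎ x ∈ U
    X-cover {x} x∈ with near? n x
    ... | no ¬R = inj₂ (∈-subset⁺ unreachable? ¬R)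
    ... | yes R with saved-near x∈ R
    ... | t′ , p′ , lt , p∈ , F , c = inj₁ (x∈p∩q⁺ (x∈ , done-charged (p∈ , lt) (comp-reachable R (comp-sym c)) F c))
    into-saved : ∀ {v} → (∀ τ → v ∉ burning G r S τ) → v ∈ saved
    into-saved h = ∈-subset⁺ (λ v → ¬? (v ∈? burning G r S n)) (h n)
    below : ∣ U ∣ + ∣ secured ∣ ≤ ∣ saved ∣
    below = ≤-trans (disjoint-∣∪∣ U secured λ u∈ v∈ → ∈-subset⁻ unreachable? u∈ (secured-reachable v∈))
      (p⊆q⇒∣p∣≤∣q∣ λ v∈ → into-saved (case x∈p∪q⁻ U secured v∈ of λ
        { (inj₁ u∈) τ b → ∈-subset⁻ unreachable? u∈ (near⇒reachable (burning⇒near τ b))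
        ; (inj₂ h) → secured-saved _ h }))
    secured≤ : ∣ secured ∣ ≤ ∣ saved ∣
    secured≤ = ≤-trans (m≤n+m _ ∣ U ∣) below
    -- The subtracted `∣ saved ∣`, the summand 1 of the ratio, covers the unreachable vertices of X.
    gap : ∣ X ∣ ∸ ∣ saved ∣ ≤ ∣ X ∩ charged ∣
    gap = m≤n+o⇒m∸n≤o ∣ X ∣ ∣ saved ∣ (≤-trans (cover (X ∩ charged) U X-cover)
      (≤-trans (+-monoʳ-≤ ∣ X ∩ charged ∣ (≤-trans (m≤m+n ∣ U ∣ ∣ secured ∣) below))
        (≤-reflexive (+-comm ∣ X ∩ charged ∣ ∣ saved ∣))))
    conclude : Bound 39 ∣ X ∩ charged ∣ ∣ secured ∣ → (∣ X ∣ ∸ ∣ saved ∣) ^ 2 ≤ 225 * n * ∣ saved ∣ ^ 2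
    -- X has at most n vertices, and n < 225(s + 1)² with s + 1 at most `∣ saved ∣`.
    conclude (inj₁ s<) = begin
      (∣ X ∣ ∸ ∣ saved ∣) ^ 2                      ≤⟨ ^-monoˡ-≤ 2 (≤-trans (m∸n≤m ∣ X ∣ ∣ saved ∣) (∣p∣≤n X)) ⟩
      n ^ 2                                        ≡⟨ cong (n *_) (*-identityʳ n) ⟩
      n * n                                        ≤⟨ *-monoʳ-≤ n (<⇒≤ (proj₂ (proj₂ (root n)))) ⟩
      n * (225 * (suc s * suc s))                  ≤⟨ *-monoʳ-≤ n (*-monoʳ-≤ 225 (*-mono-≤ s<Y s<Y)) ⟩
      n * (225 * (∣ saved ∣ * ∣ saved ∣))          ≡⟨ square n ∣ saved ∣ ⟩
      225 * n * ∣ saved ∣ ^ 2 ∎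
      where
      open ≤-Reasoning
      s<Y : s < ∣ saved ∣
      s<Y = ≤-trans s< secured≤
      square : ∀ n y → n * (225 * (y * y)) ≡ 225 * n * (y * (y * 1))
      square = solve-∀
    -- 39² = 1521 is below 225², and 225·s² is at most n.
    conclude (inj₂ le) = begin
      (∣ X ∣ ∸ ∣ saved ∣) ^ 2                      ≤⟨ ^-monoˡ-≤ 2 (≤-trans gap (≤-trans le
                                                        (*-monoʳ-≤ 39 (*-monoʳ-≤ s secured≤)))) ⟩
      (39 * (s * ∣ saved ∣)) ^ 2                   ≡⟨ square s ∣ saved ∣ ⟩
      1521 * (s * s) * ∣ saved ∣ ^ 2               ≤⟨ *-monoˡ-≤ (∣ saved ∣ ^ 2) (≤-trans
                                                        (*-monoˡ-≤ (s * s) (≤ᵇ⇒≤ 1521 (225 * 225) tt))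
                                                        (≤-trans (≤-reflexive (*-assoc 225 225 (s * s)))
                                                          (*-monoʳ-≤ 225 (proj₁ (proj₂ (root n)))))) ⟩
      225 * n * ∣ saved ∣ ^ 2 ∎
      where
      open ≤-Reasoning
      square : ∀ s y → (39 * (s * y)) * ((39 * (s * y)) * 1) ≡ 1521 * (s * s) * (y * (y * 1))
      square = solve-∀

pairing-valid : ValidOnCacti pairing
pairing-valid n G r f _ = Validity.valid G r f

pairing-competitive : Competitive15 pairing
pairing-competitive n G r f cactus O O-valid X X-saved = saved , saved-saved , competitive
  where open Charging G r f cactus O O-valid X X-saved

-- The lower bound

∣p∣≤1 : ∀ (p : Subset n) → (∀ {u v} → u ∈ p → v ∈ p → u ≡ v) → ∣ p ∣ ≤ 1
∣p∣≤1 {n} p unique with nonempty? p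
... | no empty = ≤-trans (p⊆q⇒∣p∣≤∣q∣ {q = ⊥} (λ x∈ → contradiction (_ , x∈) empty))
                   (≤-trans (≤-reflexive (∣⊥∣≡0 n)) z≤n)
... | yes (x , x∈) = ≤-trans (p⊆q⇒∣p∣≤∣q∣ {q = ⁅ x ⁆} (λ y∈ → subst (_∈ ⁅ x ⁆) (unique x∈ y∈) (x∈⁅x⁆ x)))
                       (≤-reflexive (∣⁅x⁆∣≡1 x))

∣p∣≤1⇒unique : ∀ {p : Subset n} {u v} → ∣ p ∣ ≤ 1 → u ∈ p → v ∈ p → u ≡ v
∣p∣≤1⇒unique {p = p} {u} {v} le u∈ v∈ with u ≟ v
... | yes eq = eq
... | no ne = contradiction (≤-trans (length≤∣q∣ (u ∷ v ∷ []) ((ne ∷ []) ∷ [] ∷ []) (u∈ ∷ v∈ ∷ [])) le)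
                λ { (s≤s ()) }

-- The path 0, 1, …, ℓ with the additional edge {k, ℓ}: a cycle through k with
-- the path k, k − 1, …, 0 attached to it.
module Lollipop (k ℓ : ℕ) (k+3≤ℓ : 3 + k ≤ ℓ) where

  Next : ℕ → ℕ → Set
  Next a b = b ≡ suc a ⊎ (a ≡ ℓ × b ≡ k)

  Link : ℕ → ℕ → Set
  Link a b = Next a b ⊎ Next b a

  next? : ∀ a b → Dec (Next a b)
  next? a b = (b ≟ℕ suc a) ⊎-dec ((a ≟ℕ ℓ) ×-dec (b ≟ℕ k))

  abstract
    link? : ∀ a b → Dec (Link a b)
    link? a b = next? a b ⊎-dec next? b a

  swap-link : ∀ {a b} → Link a b → Link b a
  swap-link (inj₁ x) = inj₂ x
  swap-link (inj₂ x) = inj₁ x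

  k<ℓ : k < ℓ
  k<ℓ = ≤-trans (s≤s (≤-trans (n≤1+n k) (n≤1+n (suc k)))) k+3≤ℓ

  no-loop : ∀ {a} → ¬ Next a a
  no-loop (inj₁ eq) = 1+n≢n (≡sym eq)
  no-loop (inj₂ (refl , eq)) = <⇒≢ k<ℓ (≡sym eq)

  V : Set
  V = Fin (suc ℓ)

  G : Graph (suc ℓ)
  G = record
    { E = λ u v → does (link? (toℕ u) (toℕ v))
    ; sym = λ u v → does-⇔ (mk⇔ swap-link swap-link) (link? (toℕ u) (toℕ v)) (link? (toℕ v) (toℕ u))
    ; irrefl = λ v → dec-false (link? (toℕ v) (toℕ v)) [ no-loop , no-loop ]′ }

  open Walks G hiding (V)

  link⇒Adj : ∀ {u v} → Link (toℕ u) (toℕ v) → Adj G u v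
  link⇒Adj {u} {v} = dec-true (link? (toℕ u) (toℕ v))

  Adj⇒link : ∀ {u v} → Adj G u v → Link (toℕ u) (toℕ v)
  Adj⇒link {u} {v} a with link? (toℕ u) (toℕ v) | a
  ... | yes lk | _ = lk
  ... | no _ | ()

  toℕ≤ℓ : ∀ (v : V) → toℕ v ≤ ℓ
  toℕ≤ℓ v = ≤-pred (toℕ<n v)

  next-functional : ∀ {v a b} → a ≤ ℓ → b ≤ ℓ → Next v a → Next v b → a ≡ b
  next-functional a≤ b≤ (inj₁ refl) (inj₁ refl) = refl
  next-functional a≤ b≤ (inj₁ refl) (inj₂ (refl , _)) = contradiction a≤ 1+n≰n
  next-functional a≤ b≤ (inj₂ (refl , _)) (inj₁ refl) = contradiction b≤ 1+n≰n
  next-functional a≤ b≤ (inj₂ (_ , refl)) (inj₂ (_ , refl)) = refl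

  next-injective : ∀ {v a b} → k ≤ a → k ≤ b → Next a v → Next b v → a ≡ b
  next-injective k≤a k≤b (inj₁ refl) (inj₁ eq) = suc-injective eq
  next-injective k≤a k≤b (inj₁ refl) (inj₂ (_ , refl)) = contradiction k≤a 1+n≰n
  next-injective k≤a k≤b (inj₂ (_ , refl)) (inj₁ refl) = contradiction k≤b 1+n≰n
  next-injective k≤a k≤b (inj₂ (refl , _)) (inj₂ (refl , _)) = refl

  third-link : ∀ {v a b w} → a ≤ ℓ → b ≤ ℓ → w ≤ ℓ → k ≤ a → k ≤ b → k ≤ w →
    Link v a → Link v b → Link v w → a ≢ b → w ≡ a ⊎ w ≡ b
  third-link a≤ b≤ w≤ ka kb kw (inj₁ x) (inj₁ y) _ ne = contradiction (next-functional a≤ b≤ x y) ne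
  third-link a≤ b≤ w≤ ka kb kw (inj₂ x) (inj₂ y) _ ne = contradiction (next-injective ka kb x y) ne
  third-link a≤ b≤ w≤ ka kb kw (inj₁ x) (inj₂ y) (inj₁ z) ne = inj₁ (next-functional w≤ a≤ z x)
  third-link a≤ b≤ w≤ ka kb kw (inj₁ x) (inj₂ y) (inj₂ z) ne = inj₂ (next-injective kw kb z y)
  third-link a≤ b≤ w≤ ka kb kw (inj₂ x) (inj₁ y) (inj₁ z) ne = inj₂ (next-functional w≤ b≤ z y)
  third-link a≤ b≤ w≤ ka kb kw (inj₂ x) (inj₁ y) (inj₂ z) ne = inj₁ (next-injective kw ka z x)

  abstract
    at : ℕ → V
    at i with i <? suc ℓ
    ... | yes i< = fromℕ< i<
    ... | no _ = zero

    toℕ-at : ∀ {i} → i ≤ ℓ → toℕ (at i) ≡ i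
    toℕ-at {i} i≤ with i <? suc ℓ
    ... | yes i< = toℕ-fromℕ< i<
    ... | no ≮ = contradiction (s≤s i≤) ≮

  at-toℕ : ∀ v → at (toℕ v) ≡ v
  at-toℕ v = toℕ-injective (toℕ-at (toℕ≤ℓ v))

  Ring : V → V → Set
  Ring x y = k ≤ toℕ x × k ≤ toℕ y × Link (toℕ x) (toℕ y)

  module OnCycle (C : Cycle G) where

    Position : Set
    Position = Fin (suc (m C))

    succ : ∀ (i : Position) → ∃[ j ] EdgeOf C (vert C i) (vert C j) ×
      (toℕ j ≡ suc (toℕ i) ⊎ (toℕ i ≡ m C × toℕ j ≡ 0))
    succ i with view i
    ... | ‵fromℕ = zero , inj₂ (inj₁ (refl , refl)) , inj₂ (toℕ-fromℕ (m C) , refl)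
    ... | ‵inject₁ j = suc j , inj₁ (j , inj₁ (refl , refl)) , inj₁ (cong suc (≡sym (toℕ-inject₁ j)))

    prev : ∀ (i : Position) → ∃[ j ] EdgeOf C (vert C i) (vert C j) ×
      (toℕ i ≡ suc (toℕ j) ⊎ (toℕ i ≡ 0 × toℕ j ≡ m C))
    prev zero = fromℕ (m C) , inj₂ (inj₂ (refl , refl)) , inj₂ (refl , toℕ-fromℕ (m C))
    prev (suc i) = inject₁ i , inj₁ (i , inj₂ (refl , refl)) , inj₁ (cong suc (≡sym (toℕ-inject₁ i)))

    succ≢prev : ∀ i → vert C (proj₁ (succ i)) ≢ vert C (proj₁ (prev i))
    succ≢prev i eq with succ i | prev i
    ... | j , _ , p | j′ , _ , q with inj C j j′ eq
    succ≢prev i eq | j , _ , inj₁ p | _ , _ , inj₁ q | refl = <⇒≢ (m<n⇒m<1+n (n<1+n (toℕ i))) (trans q (cong suc p))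
    succ≢prev i eq | j , _ , inj₁ p | _ , _ , inj₂ (z , q) | refl =
      <⇒≢ (long C) (trans (cong suc (≡sym z)) (trans (≡sym p) q))
    succ≢prev i eq | j , _ , inj₂ (z , p) | _ , _ , inj₁ q | refl =
      <⇒≢ (long C) (trans (cong suc (≡sym p)) (trans (≡sym q) z))
    succ≢prev i eq | j , _ , inj₂ (z , p) | _ , _ , inj₂ (y , q) | refl =
      <⇒≢ (≤-trans (s≤s z≤n) (long C)) (trans (≡sym p) q)

    edge⇒Adj : ∀ {x y} → EdgeOf C x y → Adj G x y
    edge⇒Adj (inj₁ (i , inj₁ (refl , refl))) = step C i
    edge⇒Adj (inj₁ (i , inj₂ (refl , refl))) = Adj-sym (step C i)
    edge⇒Adj (inj₂ (inj₁ (refl , refl))) = close C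
    edge⇒Adj (inj₂ (inj₂ (refl , refl))) = Adj-sym (close C)

    edge⇒link : ∀ {x y} → EdgeOf C x y → Link (toℕ x) (toℕ y)
    edge⇒link e = Adj⇒link (edge⇒Adj e)

    On : V → Set
    On v = ∃[ i ] vert C i ≡ v

    edge⇒on : ∀ {x y} → EdgeOf C x y → On x × On y
    edge⇒on (inj₁ (i , inj₁ (refl , refl))) = (_ , refl) , (_ , refl)
    edge⇒on (inj₁ (i , inj₂ (refl , refl))) = (_ , refl) , (_ , refl)
    edge⇒on (inj₂ (inj₁ (refl , refl))) = (_ , refl) , (_ , refl)
    edge⇒on (inj₂ (inj₂ (refl , refl))) = (_ , refl) , (_ , refl)

    low-links : ∀ {v a} → v < k → Link v a → a ≡ suc v ⊎ v ≡ suc a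
    low-links v<k (inj₁ (inj₁ eq)) = inj₁ eq
    low-links v<k (inj₁ (inj₂ (refl , _))) = contradiction (<-trans k<ℓ v<k) (<-irrefl refl)
    low-links v<k (inj₂ (inj₁ eq)) = inj₂ eq
    low-links v<k (inj₂ (inj₂ (_ , refl))) = contradiction v<k (<-irrefl refl)

    -- On the tail the only neighbours are j - 1 and j + 1. The two cycle neighbours are distinct,
    -- so one of them is j - 1, and the cycle would descend below 0.
    above-k : ∀ j i → toℕ (vert C i) ≡ j → ¬ j < k
    above-k j i eq j<k with low-links (subst (_< k) (≡sym eq) j<k) (edge⇒link (proj₁ (proj₂ (succ i))))
                          | low-links (subst (_< k) (≡sym eq) j<k) (edge⇒link (proj₁ (proj₂ (prev i))))
    ... | inj₁ p | inj₁ q = succ≢prev i (toℕ-injective (trans p (≡sym q)))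
    above-k zero i eq j<k | inj₂ p | _ = contradiction (trans (≡sym eq) p) λ ()
    above-k zero i eq j<k | inj₁ _ | inj₂ q = contradiction (trans (≡sym eq) q) λ ()
    above-k (suc j) i eq j<k | inj₂ p | _ =
      above-k j (proj₁ (succ i)) (suc-injective (trans (≡sym p) eq)) (<-trans (n<1+n j) j<k)
    above-k (suc j) i eq j<k | inj₁ _ | inj₂ q =
      above-k j (proj₁ (prev i)) (suc-injective (trans (≡sym q) eq)) (<-trans (n<1+n j) j<k)

    on-above : ∀ {v} → On v → k ≤ toℕ v
    on-above (i , refl) = ≮⇒≥ (above-k _ i refl)

    edge⇒ring : ∀ {x y} → EdgeOf C x y → Ring x y
    edge⇒ring e = on-above (proj₁ (edge⇒on e)) , on-above (proj₂ (edge⇒on e)) , edge⇒link e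

    -- The two cycle neighbours of v are distinct and at least k, and v has no third such neighbour.
    on-edge : ∀ {v w} → On v → k ≤ toℕ w → Link (toℕ v) (toℕ w) → EdgeOf C v w
    on-edge {w = w} (i , refl) kw lk with succ i | prev i | succ≢prev i
    ... | j , e , _ | j′ , e′ , _ | ne
      with third-link (toℕ≤ℓ _) (toℕ≤ℓ _) (toℕ≤ℓ w) (on-above (j , refl)) (on-above (j′ , refl)) kw
             (edge⇒link e) (edge⇒link e′) lk (ne ∘ toℕ-injective)
    ... | inj₁ eq = subst (EdgeOf C (vert C i)) (≡sym (toℕ-injective eq)) e
    ... | inj₂ eq = subst (EdgeOf C (vert C i)) (≡sym (toℕ-injective eq)) e′

    on-next : ∀ {v w} → On v → k ≤ toℕ w → Next (toℕ v) (toℕ w) → On w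
    on-next o kw nx = proj₂ (edge⇒on (on-edge o kw (inj₁ nx)))

    climb : ∀ d {i} → k ≤ i → d + i ≤ ℓ → On (at i) → On (at (d + i))
    climb zero ki le o = o
    climb (suc d) {i} ki le o = on-next (climb d ki (<⇒≤ le) o)
      (≤-trans ki (≤-trans (m≤n+m i (suc d)) (≤-reflexive (≡sym (toℕ-at le)))))
      (inj₁ (trans (toℕ-at le) (cong suc (≡sym (toℕ-at (<⇒≤ le))))))

    climb-to : ∀ {i j} → k ≤ i → i ≤ j → j ≤ ℓ → On (at i) → On (at j)
    climb-to {i} {j} ki i≤j j≤ o = subst (λ h → On (at h)) (m∸n+n≡m i≤j)
      (climb (j ∸ i) ki (≤-trans (≤-reflexive (m∸n+n≡m i≤j)) j≤) o)

    -- From any vertex of the cycle climb to ℓ, wrap around to k, and climb again to v.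
    on-ring : ∀ v → k ≤ toℕ v → On v
    on-ring v kv = subst On (at-toℕ v) (climb-to ≤-refl kv (toℕ≤ℓ v) on-k)
      where
      v₀ : V
      v₀ = vert C zero
      on-ℓ : On (at ℓ)
      on-ℓ = climb-to (on-above (zero , refl)) (toℕ≤ℓ v₀) ≤-refl (zero , ≡sym (at-toℕ v₀))
      on-k : On (at k)
      on-k = on-next on-ℓ (≤-reflexive (≡sym (toℕ-at (<⇒≤ k<ℓ))))
        (inj₂ (toℕ-at ≤-refl , toℕ-at (<⇒≤ k<ℓ)))

    ring⇒edge : ∀ {x y} → Ring x y → EdgeOf C x y
    ring⇒edge {x} (kx , ky , lk) = on-edge (on-ring x kx) ky lk

  cactus : Cactus G
  cactus C₁ C₂ _ _ _ _ x y =
    (λ e → OnCycle.ring⇒edge C₂ (OnCycle.edge⇒ring C₁ e)) , (λ e → OnCycle.ring⇒edge C₁ (OnCycle.edge⇒ring C₂ e))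

  r : V
  r = at k

  toℕ-r : toℕ r ≡ k
  toℕ-r = toℕ-at (<⇒≤ k<ℓ)

  at-adj : ∀ {i} → suc i ≤ ℓ → Adj G (at i) (at (suc i))
  at-adj i< = link⇒Adj (inj₁ (inj₁ (trans (toℕ-at i<) (cong suc (≡sym (toℕ-at (<⇒≤ i<)))))))

  up-walk : ∀ {P : V → Set} d → P r → d + k ≤ ℓ → (∀ {i} → k < i → i ≤ d + k → P (at i)) → Walk P r (at (d + k)) d
  up-walk zero pr le p = stop pr
  up-walk (suc d) pr le p = up-walk d pr (<⇒≤ le) (λ k< i≤ → p k< (m≤n⇒m≤1+n i≤)) ▹ at-adj le
    , p (s≤s (m≤n+m k d)) ≤-refl

  descend : ∀ {P : V → Set} {u j} a d → d ≤ a → a ≤ ℓ → Walk P u (at a) j → (∀ {i} → a ∸ d ≤ i → i < a → P (at i)) →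
    Walk P u (at (a ∸ d)) (d + j)
  descend a zero d≤ a≤ w p = w
  descend a (suc d) d≤ a≤ w p = descend a d (<⇒≤ d≤) a≤ w (λ le → p (≤-trans (∸-monoʳ-≤ a (n≤1+n d)) le))
    ▹ Adj-sym (subst (λ h → Adj G (at (a ∸ suc d)) (at h)) (≡sym eq) (at-adj (≤-trans (≤-reflexive (≡sym eq))
        (≤-trans (m∸n≤m a d) a≤))))
    , p ≤-refl (≤-trans (≤-reflexive (≡sym eq)) (m∸n≤m a d))
    where
    eq : a ∸ d ≡ suc (a ∸ suc d)
    eq = +-∸-assoc 1 d≤

  descend-to : ∀ {P : V → Set} {u j} a b → b ≤ a → a ≤ ℓ → Walk P u (at a) j → (∀ {i} → b ≤ i → i < a → P (at i)) →
    ∃[ h ] Walk P u (at b) h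
  descend-to {P} {u} {j} a b b≤ a≤ w p = a ∸ b + j , subst (λ h → Walk P u (at h) (a ∸ b + j)) (m∸[m∸n]≡n b≤)
    (descend a (a ∸ b) (m∸n≤m a b) a≤ w (λ le → p (subst (_≤ _) (m∸[m∸n]≡n b≤) le)))

  module Short (S : Strategy (suc ℓ)) {f} (valid : Valid G r f S) (short : ∀ t → f (suc (suc t)) ≡ 0) where
    open Fire G r S

    -- No firefighter comes after the second round, so this is everything that is ever protected.
    P₂ : Subset (suc ℓ)
    P₂ = protected G r S 2

    none-later : ∀ {t v} → 2 ≤ t → v ∉ S t
    none-later {suc (suc t)} {v} (s≤s (s≤s _)) v∈ = contradiction
      (≤-trans (length≤∣q∣ (v ∷ []) ([] ∷ []) (v∈ ∷ [])) (≤-trans (proj₁ (valid (suc (suc t)))) (≤-reflexive (short t))))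
      λ ()

    P⊆P₂ : ∀ t {v} → v ∈ protected G r S t → v ∈ P₂
    P⊆P₂ t v∈ with protected⇒placed t v∈
    ... | zero , _ , v∈S = protected-mono (s≤s z≤n) (placed⇒protected 0 v∈S)
    ... | suc zero , _ , v∈S = placed⇒protected 1 v∈S
    ... | suc (suc t′) , _ , v∈S = contradiction v∈S (none-later (s≤s (s≤s z≤n)))

    burns : ∀ {v j} → Walk (_∉ P₂) r v j → v ∈ burning G r S j
    burns {j = j} w = walk⇒burning ≤-refl (mapW (λ ∉ v∈ → ∉ (P⊆P₂ j v∈)) w)

    r∉P₂ : r ∉ P₂
    r∉P₂ r∈ with protected⇒placed 2 r∈
    ... | t , _ , r∈S = proj₁ (proj₂ (valid t) r r∈S) (r-burns t)

    ring-burns : (∀ {u v} → u ∈ P₂ → v ∈ P₂ → k < toℕ u → k < toℕ v → u ≡ v) →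
      ∀ v → k < toℕ v → v ∉ P₂ → ∃[ t ] v ∈ burning G r S t
    ring-burns sole v kv v∉ with any? (λ u → (k <? toℕ u) ×-dec (toℕ u <? toℕ v) ×-dec (u ∈? P₂))
    ... | no none = toℕ v ∸ k , burns (subst (λ u → Walk (_∉ P₂) r u (toℕ v ∸ k)) (trans (cong at eq) (at-toℕ v))
            (up-walk (toℕ v ∸ k) r∉P₂ (≤-trans (≤-reflexive eq) (toℕ≤ℓ v)) safe))
      where
      eq : toℕ v ∸ k + k ≡ toℕ v
      eq = m∸n+n≡m (<⇒≤ kv)
      safe : ∀ {i} → k < i → i ≤ toℕ v ∸ k + k → at i ∉ P₂
      safe {i} ki i≤ i∈ with m≤n⇒m<n∨m≡n (subst (i ≤_) eq i≤)
      ... | inj₁ i<v = none (at i , subst (k <_) (≡sym e) ki , subst (_< toℕ v) (≡sym e) i<v , i∈)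
        where e = toℕ-at (≤-trans (<⇒≤ i<v) (toℕ≤ℓ v))
      ... | inj₂ refl = v∉ (subst (_∈ P₂) (at-toℕ v) i∈)
    -- The only protected ring vertex is below v, so the fire takes the other way round, through ℓ.
    ... | yes (u , ku , u<v , u∈) = proj₁ round , burns (subst (λ x → Walk (_∉ P₂) r x (proj₁ round)) (at-toℕ v) (proj₂ round))
      where
      safe : ∀ {i} → toℕ v ≤ i → i ≤ ℓ → at i ∉ P₂
      safe {i} vi i≤ i∈ = <⇒≢ (≤-trans u<v vi) (trans (cong toℕ
        (sole u∈ i∈ ku (≤-trans kv (≤-trans vi (≤-reflexive (≡sym (toℕ-at i≤))))))) (toℕ-at i≤))
      round : ∃[ h ] Walk (_∉ P₂) r (at (toℕ v)) h
      round = descend-to ℓ (toℕ v) (toℕ≤ℓ v) ≤-refl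
        (stop {k = 0} r∉P₂ ▹ link⇒Adj (inj₂ (inj₂ (toℕ-at ≤-refl , toℕ-r))) , safe (toℕ≤ℓ v) ≤-refl)
        (λ vi i< → safe vi (<⇒≤ i<))

    tail-burns : (∀ {u} → u ∈ P₂ → k ≤ toℕ u) → ∀ v → toℕ v < k → ∃[ t ] v ∈ burning G r S t
    tail-burns none v vk = proj₁ down , burns (subst (λ x → Walk (_∉ P₂) r x (proj₁ down)) (at-toℕ v) (proj₂ down))
      where
      down : ∃[ h ] Walk (_∉ P₂) r (at (toℕ v)) h
      down = descend-to k (toℕ v) (<⇒≤ vk) (<⇒≤ k<ℓ) (stop {k = 0} r∉P₂)
        (λ {i} _ i<k i∈ → <⇒≱ i<k (subst (k ≤_) (toℕ-at (≤-trans (<⇒≤ i<k) (<⇒≤ k<ℓ))) (none i∈)))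

    saved-above : ∀ {Y v} → SavedSet G r S Y → v ∈ Y → ¬ toℕ v < k → k < toℕ v
    saved-above saved v∈ ≮ with m≤n⇒m<n∨m≡n (≮⇒≥ ≮)
    ... | inj₁ lt = lt
    ... | inj₂ eq = contradiction (r-burns 0) (saved r (subst (_∈ _) (≡sym (trans (cong at eq) (at-toℕ _))) v∈) 0)

  tail? : ∀ (v : V) → Dec (toℕ v < k)
  tail? v = toℕ v <? k

  arc? : ∀ (v : V) → Dec (k < toℕ v × toℕ v < ℓ)
  arc? v = (k <? toℕ v) ×-dec (toℕ v <? ℓ)

  tail arc : Subset (suc ℓ)
  tail = subset tail?
  arc = subset arc?

  interval≤ : ∀ {p : Subset (suc ℓ)} a d → a + d ≤ suc ℓ → (∀ {i} → a ≤ i → i < a + d → at i ∈ p) → d ≤ ∣ p ∣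
  interval≤ {p} a d le h = subst (_≤ ∣ p ∣) (length-applyUpTo (λ i → at (a + i)) d)
    (length≤∣q∣ (applyUpTo (λ i → at (a + i)) d)
      (applyUpTo⁺₁ (λ i → at (a + i)) d λ i<j j<d eq → <⇒≢ (+-monoʳ-< a i<j)
        (trans (≡sym (toℕ-at (small (<-trans i<j j<d)))) (trans (cong toℕ eq) (toℕ-at (small j<d)))))
      (All.applyUpTo⁺₁ (λ i → at (a + i)) d λ i<d → h (m≤m+n a _) (+-monoʳ-< a i<d)))
    where
    small : ∀ {i} → i < d → a + i ≤ ℓ
    small i<d = ≤-pred (≤-trans (+-monoʳ-< a i<d) le)

  k≤∣tail∣ : k ≤ ∣ tail ∣
  k≤∣tail∣ = interval≤ 0 k (m≤n⇒m≤1+n (<⇒≤ k<ℓ)) λ {i} _ i<k →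
    ∈-subset⁺ tail? (subst (_< k) (≡sym (toℕ-at (≤-trans (<⇒≤ i<k) (<⇒≤ k<ℓ)))) i<k)

  ∣tail∣≤k : ∣ tail ∣ ≤ k
  ∣tail∣≤k = ≤-trans (union-bound (λ i → subset (label? i)) (upTo k)
      (λ i → ∣p∣≤1 (subset (label? i)) λ u∈ v∈ →
        toℕ-injective (trans (∈-subset⁻ (label? i) u∈) (≡sym (∈-subset⁻ (label? i) v∈))))
      tail (λ {x} x∈ → lose (∈-upTo⁺ (∈-subset⁻ tail? x∈)) (∈-subset⁺ (label? (toℕ x)) refl)))
    (≤-reflexive (trans (cong (_* 1) (length-upTo k)) (*-identityʳ k)))
    where
    label? : ∀ i (v : V) → Dec (toℕ v ≡ i)
    label? i v = toℕ v ≟ℕ i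

  arc-size : ∀ d → suc (k + d) ≤ ℓ → d ≤ ∣ arc ∣
  arc-size d le = interval≤ (suc k) d (m≤n⇒m≤1+n le) λ {i} k<i i< →
    let e = ≡sym (toℕ-at (<⇒≤ (≤-trans i< le))) in
    ∈-subset⁺ arc? (subst (k <_) e k<i , subst (_< ℓ) e (≤-trans i< le))

  f₁ f₂ : ℕ → ℕ
  f₁ zero = 1
  f₁ (suc _) = 0
  f₂ zero = 1
  f₂ (suc zero) = 1
  f₂ (suc (suc _)) = 0

  once : V → Strategy (suc ℓ)
  once a zero = ⁅ a ⁆
  once a (suc _) = ⊥

  twice : V → V → Strategy (suc ℓ)
  twice a b zero = ⁅ a ⁆
  twice a b (suc zero) = ⁅ b ⁆
  twice a b (suc (suc _)) = ⊥

  module SaveTail (0<k : 0 < k) where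
    w : V
    w = at (pred k)

    toℕ-w : suc (toℕ w) ≡ k
    toℕ-w = trans (cong suc (toℕ-at (≤-trans (pred[n]≤n {k}) (<⇒≤ k<ℓ)))) (suc-pred k {{>-nonZero 0<k}})

    w≢r : w ≢ r
    w≢r eq = 1+n≢n (trans toℕ-w (trans (≡sym toℕ-r) (cong toℕ (≡sym eq))))

    open Fire G r (once w)

    valid : Valid G r f₁ (once w)
    valid zero = ≤-reflexive (∣⁅x⁆∣≡1 w) , λ v v∈ → case x∈⁅y⁆⇒x≡y w v∈ of λ
      { refl → w≢r ∘ x∈⁅y⁆⇒x≡y r , ∉⊥ }
    valid (suc t) = ≤-reflexive (∣⊥∣≡0 (suc ℓ)) , λ v v∈ → contradiction v∈ ∉⊥

    above : ∀ {v j} → Walk (_≢ w) r v j → k ≤ toℕ v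
    above (stop _) = ≤-reflexive (≡sym toℕ-r)
    above (_▹_,_ {y = y} {z = z} u a ≢w) with Adj⇒link {y} {z} a
    ... | inj₁ (inj₁ eq) = ≤-trans (above u) (≤-trans (n≤1+n _) (≤-reflexive (≡sym eq)))
    ... | inj₁ (inj₂ (_ , eq)) = ≤-reflexive (≡sym eq)
    ... | inj₂ (inj₂ (eq , _)) = ≤-trans (<⇒≤ k<ℓ) (≤-reflexive (≡sym eq))
    ... | inj₂ (inj₁ eq) with m≤n⇒m<n∨m≡n (above u)
    ...   | inj₁ k<y = ≤-pred (≤-trans k<y (≤-reflexive eq))
    ...   | inj₂ k≡y = contradiction (toℕ-injective (suc-injective (trans (≡sym eq) (trans (≡sym k≡y) (≡sym toℕ-w))))) ≢w

    saved : SavedSet G r (once w) tail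
    saved v v∈ t b = <⇒≱ (∈-subset⁻ tail? v∈) (above (burning⇒walk
      (λ { τ b refl → never-burns {s = 0} (placed⇒protected 0 (x∈⁅x⁆ w)) (w≢r ∘ x∈⁅y⁆⇒x≡y r) τ b }) t b))

  module SaveArc where
    a b : V
    a = at (suc k)
    -- Not ℓ, which is adjacent to the source and burns in the first round. The hypothesis 3 + k ≤ ℓ
    -- makes a and b distinct.
    b = at (pred ℓ)

    toℕ-a : toℕ a ≡ suc k
    toℕ-a = toℕ-at k<ℓ

    toℕ-b : suc (toℕ b) ≡ ℓ
    toℕ-b = trans (cong suc (toℕ-at (pred[n]≤n {ℓ}))) (suc-pred ℓ {{>-nonZero (≤-trans (s≤s z≤n) k<ℓ)}})

    a<b : suc (toℕ a) ≤ toℕ b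
    a<b = ≤-pred (≤-trans (≤-reflexive (cong (λ h → suc (suc h)) toℕ-a)) (≤-trans k+3≤ℓ (≤-reflexive (≡sym toℕ-b))))

    k<b : suc k < toℕ b
    k<b = subst (_< toℕ b) toℕ-a a<b

    a≢r : a ≢ r
    a≢r eq = 1+n≢n (trans (≡sym toℕ-a) (trans (cong toℕ eq) toℕ-r))

    b≢r : b ≢ r
    b≢r eq = <⇒≢ (<-trans (n<1+n k) k<b) (trans (≡sym toℕ-r) (cong toℕ (≡sym eq)))

    S : Strategy (suc ℓ)
    S = twice a b

    open Fire G r S

    b∉burning₁ : b ∉ burning G r S 1
    b∉burning₁ b∈ with burning-step 0 b∈
    ... | inj₁ h = b≢r (x∈⁅y⁆⇒x≡y r h)
    ... | inj₂ (_ , u , u∈ , adj) with x∈⁅y⁆⇒x≡y r u∈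
    ... | refl with Adj⇒link {r} {b} adj
    ... | inj₁ (inj₁ eq) = <⇒≢ k<b (≡sym (trans eq (cong suc toℕ-r)))
    ... | inj₁ (inj₂ (eq , _)) = <⇒≢ k<ℓ (trans (≡sym toℕ-r) eq)
    ... | inj₂ (inj₁ eq) = <⇒≱ k<b (≤-trans (n≤1+n _) (≤-trans (≤-reflexive (trans (≡sym eq) toℕ-r)) (n≤1+n k)))
    ... | inj₂ (inj₂ (eq , _)) = 1+n≢n (trans toℕ-b (≡sym eq))

    b∉protected₁ : b ∉ protected G r S 1
    b∉protected₁ b∈ with x∈p∪q⁻ ⊥ ⁅ a ⁆ b∈
    ... | inj₁ h = ∉⊥ h
    ... | inj₂ h = <⇒≢ a<b (cong toℕ (≡sym (x∈⁅y⁆⇒x≡y a h)))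

    valid : Valid G r f₂ S
    valid zero = ≤-reflexive (∣⁅x⁆∣≡1 a) , λ v v∈ → case x∈⁅y⁆⇒x≡y a v∈ of λ
      { refl → a≢r ∘ x∈⁅y⁆⇒x≡y r , ∉⊥ }
    valid (suc zero) = ≤-reflexive (∣⁅x⁆∣≡1 b) , λ v v∈ → case x∈⁅y⁆⇒x≡y b v∈ of λ
      { refl → b∉burning₁ , b∉protected₁ }
    valid (suc (suc t)) = ≤-reflexive (∣⊥∣≡0 (suc ℓ)) , λ v v∈ → contradiction v∈ ∉⊥

    outside-arc : ∀ {v j} → Walk (λ v → v ≢ a × v ≢ b) r v j → ¬ (k < toℕ v × toℕ v < ℓ)
    outside-arc (stop _) (kv , _) = <-irrefl (≡sym toℕ-r) kv
    outside-arc (_▹_,_ {y = y} {z = z} w adj (≢a , ≢b)) (kz , zℓ) with Adj⇒link {y} {z} adj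
    ... | inj₁ (inj₂ (_ , eq)) = <-irrefl (≡sym eq) kz
    ... | inj₂ (inj₂ (eq , _)) = <-irrefl eq zℓ
    ... | inj₁ (inj₁ eq) with m≤n⇒m<n∨m≡n (≤-pred (≤-trans kz (≤-reflexive eq)))
    ...   | inj₁ ky = outside-arc w (ky , <-trans (≤-reflexive (≡sym eq)) zℓ)
    ...   | inj₂ k≡y = ≢a (toℕ-injective (trans eq (trans (cong suc (≡sym k≡y)) (≡sym toℕ-a))))
    outside-arc (_▹_,_ {y = y} {z = z} w adj (≢a , ≢b)) (kz , zℓ) | inj₂ (inj₁ eq)
      with m≤n⇒m<n∨m≡n (toℕ≤ℓ y)
    ...   | inj₁ yℓ = outside-arc w (<-trans kz (≤-reflexive (≡sym eq)) , yℓ)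
    ...   | inj₂ y≡ℓ = ≢b (toℕ-injective (suc-injective (trans (≡sym eq) (trans y≡ℓ (≡sym toℕ-b)))))

    saved : SavedSet G r S arc
    saved v v∈ t burnt = outside-arc (burning⇒walk (λ τ h →
        (λ { refl → never-burns {s = 0} (placed⇒protected 0 (x∈⁅x⁆ a)) (a≢r ∘ x∈⁅y⁆⇒x≡y r) τ h }) ,
        (λ { refl → never-burns {s = 1} (placed⇒protected 1 (x∈⁅x⁆ b)) b∉burning₁ τ h })) t burnt)
      (∈-subset⁻ arc? v∈)

  -- A first move outside the tail is punished by sending no firefighter any
  -- more, a first move in the tail by sending a single one in the second round.
  module Adversary (A : OnlineAlg) (A-valid : ValidOnCacti A) where

    S₁ S₂ : Strategy (suc ℓ)
    S₁ = run A G r f₁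
    S₂ = run A G r f₂

    starts-in-tail? : Dec (∃[ u ] toℕ u < k × u ∈ S₁ 0)
    starts-in-tail? = any? λ u → tail? u ×-dec (u ∈? S₁ 0)

    module OffTail (off : ¬ (∃[ u ] toℕ u < k × u ∈ S₁ 0)) where
      v₁ : Valid G r f₁ S₁
      v₁ = A-valid _ G r f₁ cactus
      open Short S₁ v₁ (λ _ → refl)
      open Fire G r S₁

      first : ∀ {v} → v ∈ P₂ → v ∈ S₁ 0
      first v∈ with protected⇒placed 2 v∈
      ... | zero , _ , h = h
      ... | suc zero , _ , h = contradiction (≤-trans (length≤∣q∣ (_ ∷ []) ([] ∷ []) (h ∷ [])) (proj₁ (v₁ 1))) λ ()
      ... | suc (suc _) , s≤s (s≤s ()) , _

      sole : ∀ {u v} → u ∈ P₂ → v ∈ P₂ → u ≡ v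
      sole u∈ v∈ = ∣p∣≤1⇒unique {p = S₁ 0} (proj₁ (v₁ 0)) (first u∈) (first v∈)

      saves-one : ∀ Y → SavedSet G r S₁ Y → ∣ Y ∣ ≤ 1
      saves-one Y Y-saved = ∣p∣≤1 Y λ u∈ v∈ → sole (in-P₂ u∈) (in-P₂ v∈)
        where
        in-P₂ : ∀ {v} → v ∈ Y → v ∈ P₂
        in-P₂ {v} v∈ with v ∈? P₂
        ... | yes h = h
        ... | no v∉ with toℕ v <? k
        ... | yes low = let t , b = tail-burns (λ {u} u∈ → ≮⇒≥ λ lo → off (u , lo , first u∈)) v low in
                contradiction b (Y-saved v v∈ t)
        ... | no ≮ = let t , b = ring-burns (λ u∈ v∈ _ _ → sole u∈ v∈) v (saved-above Y-saved v∈ ≮) v∉ in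
                contradiction b (Y-saved v v∈ t)

    module InTail {u} (low : toℕ u < k) (u∈ : u ∈ S₂ 0) where
      v₂ : Valid G r f₂ S₂
      v₂ = A-valid _ G r f₂ cactus
      open Short S₂ v₂ (λ _ → refl)
      open Fire G r S₂

      second : ∀ {v} → v ∈ P₂ → k < toℕ v → v ∈ S₂ 1
      second v∈ kv with protected⇒placed 2 v∈
      -- The single firefighter of the first round was spent in the tail.
      ... | zero , _ , h = contradiction
              (subst (k <_) (cong toℕ (∣p∣≤1⇒unique {p = S₂ 0} (proj₁ (v₂ 0)) h u∈)) kv) (<⇒≯ low)
      ... | suc zero , _ , h = h
      ... | suc (suc _) , s≤s (s≤s ()) , _

      sole : ∀ {u v} → u ∈ P₂ → v ∈ P₂ → k < toℕ u → k < toℕ v → u ≡ v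
      sole u∈ v∈ ku kv = ∣p∣≤1⇒unique {p = S₂ 1} (proj₁ (v₂ 1)) (second u∈ ku) (second v∈ kv)

      ring? : ∀ (v : V) → Dec (k < toℕ v × v ∈ P₂)
      ring? v = (k <? toℕ v) ×-dec (v ∈? P₂)

      saves-few : ∀ Y → SavedSet G r S₂ Y → ∣ Y ∣ ≤ k + 1
      saves-few Y Y-saved = ≤-trans (cover tail (subset ring?) split)
        (+-mono-≤ ∣tail∣≤k (∣p∣≤1 (subset ring?) λ u∈ v∈ →
          let ku , u∈P = ∈-subset⁻ ring? u∈ ; kv , v∈P = ∈-subset⁻ ring? v∈ in sole u∈P v∈P ku kv))
        where
        split : ∀ {v} → v ∈ Y → v ∈ tail ⊎ v ∈ subset ring?
        split {v} v∈ with toℕ v <? k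
        ... | yes lo = inj₁ (∈-subset⁺ tail? lo)
        ... | no ≮ with v ∈? P₂
        ... | yes h = inj₂ (∈-subset⁺ ring? (saved-above Y-saved v∈ ≮ , h))
        ... | no v∉ = let t , b = ring-burns sole v (saved-above Y-saved v∈ ≮) v∉ in
                contradiction b (Y-saved v v∈ t)

module Defeat (k ℓ d : ℕ) (k+3≤ℓ : 3 + k ≤ ℓ) (0<k : 0 < k) (fits : suc (k + d) ≤ ℓ)
    (tail-large : suc ℓ * 1 ^ 2 < (4 * k) ^ 2) (arc-large : suc ℓ * (k + 1) ^ 2 < (4 * d) ^ 2)
    (A : OnlineAlg) (A-valid : ValidOnCacti A) where
  open Lollipop k ℓ k+3≤ℓ
  open Adversary A A-valid
  open SaveTail 0<k using (w) renaming (valid to w-valid; saved to w-saved)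

  defeat : ¬ (∀ f O → Valid G r f O → ∀ X → SavedSet G r O X →
    ∃[ Y ] SavedSet G r (run A G r f) Y × ((4 * ∣ X ∣) ^ 2 ≤ suc ℓ * ∣ Y ∣ ^ 2))
  defeat ratio with starts-in-tail?
  ... | no off with ratio f₁ (once w) w-valid tail w-saved
  ...   | Y , Y-saved , le = <⇒≱ tail-large (≤-trans (^-monoˡ-≤ 2 (*-monoʳ-≤ 4 k≤∣tail∣)) (≤-trans le
            (*-monoʳ-≤ (suc ℓ) (^-monoˡ-≤ 2 (OffTail.saves-one off Y Y-saved)))))
  -- `u∈` is about `S₁ 0`, but `S₂ 0` is the same decision by computation, since both budgets start
  -- with 1.
  defeat ratio | yes (u , low , u∈) with ratio f₂ SaveArc.S SaveArc.valid arc SaveArc.saved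
  ...   | Y , Y-saved , le = <⇒≱ arc-large (≤-trans (^-monoˡ-≤ 2 (*-monoʳ-≤ 4 (arc-size d fits)))
            (≤-trans le (*-monoʳ-≤ (suc ℓ) (^-monoˡ-≤ 2 (InTail.saves-few low u∈ Y Y-saved)))))

-- The tail has k ≈ √n vertices and the cycle about n.
not-little-o : ∀ (A : OnlineAlg) → ValidOnCacti A → ¬ LittleOSqrtCompetitive A
not-little-o A A-valid little with little 4 (s≤s z≤n)
-- With K = 2 + N: tail K, ℓ = K + K², and the open arc has K² - 1 = (K - 1)(K + 1) vertices. The
-- factor K + 1 cancels against the K + 1 vertices saved online, and what remains is K² + K + 1 <
-- 16(K - 1)², true from K = 2 on.
... | N , ratio = Defeat.defeat (2 + N) (ℓ N) (suc N * (3 + N)) (room N) (s≤s z≤n) (fits N) (tail-large N) (arc-large N)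
    A A-valid (λ f → ratio (suc (ℓ N)) (large N) (Lollipop.G (2 + N) (ℓ N) (room N))
      (Lollipop.r (2 + N) (ℓ N) (room N)) f (Lollipop.cactus (2 + N) (ℓ N) (room N)))
  where
  ℓ : ℕ → ℕ
  ℓ N = (2 + N) + (2 + N) * (2 + N)

  -- Polynomial inequalities are reduced to ring identities by naming the difference, a polynomial
  -- with nonnegative coefficients.
  slack : ∀ {a b} c → a + c ≡ b → a ≤ b
  slack c refl = m≤m+n _ c

  abstract
    room : ∀ N → 3 + (2 + N) ≤ ℓ N
    room N = slack (N * N + 4 * N + 1) (expand N)
      where
      expand : ∀ N → 3 + (2 + N) + (N * N + 4 * N + 1) ≡ (2 + N) + (2 + N) * (2 + N)
      expand = solve-∀

    large : ∀ N → N ≤ suc (ℓ N)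
    large N = ≤-trans (m≤n+m N 3) (s≤s (m≤m+n (2 + N) _))

    fits : ∀ N → suc ((2 + N) + suc N * (3 + N)) ≤ ℓ N
    fits N = ≤-reflexive (expand N)
      where
      expand : ∀ N → suc ((2 + N) + suc N * (3 + N)) ≡ (2 + N) + (2 + N) * (2 + N)
      expand = solve-∀

    tail-large : ∀ N → suc (ℓ N) * 1 ^ 2 < (4 * (2 + N)) ^ 2
    tail-large N = slack (15 * (N * N) + 59 * N + 56) (expand N)
      where
      expand : ∀ N → suc (suc ((2 + N) + (2 + N) * (2 + N)) * 1) + (15 * (N * N) + 59 * N + 56)
        ≡ (4 * (2 + N)) * ((4 * (2 + N)) * 1)
      expand = solve-∀

    arc-large : ∀ N → suc (ℓ N) * ((2 + N) + 1) ^ 2 < (4 * (suc N * (3 + N))) ^ 2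
    arc-large N = subst (λ c → suc (ℓ N) * c ^ 2 < (4 * (suc N * (3 + N))) ^ 2) (+-comm 1 (2 + N))
      (≤-trans (*-monoˡ-< ((3 + N) ^ 2) base) (≤-reflexive (regroup (suc N) (3 + N))))
      where
      expand : ∀ N → suc (suc ((2 + N) + (2 + N) * (2 + N))) + (15 * (N * N) + 27 * N + 8) ≡ 16 * (suc N * suc N)
      expand = solve-∀
      base : suc (ℓ N) < 16 * (suc N * suc N)
      base = slack (15 * (N * N) + 27 * N + 8) (expand N)
      regroup : ∀ a c → 16 * (a * a) * (c * (c * 1)) ≡ (4 * (a * c)) * ((4 * (a * c)) * 1)
      regroup = solve-∀

theorem3 : (∃[ A ] ValidOnCacti A × Competitive15 A)
    × (∀ (A : OnlineAlg) → ValidOnCacti A → ¬ LittleOSqrtCompetitive A)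
theorem3 = (pairing , pairing-valid , pairing-competitive) , not-little-o
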